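{- Let $m=m_n\ge 1$ and let $f=f_n$ be a probability distribution on $\{0,\dots,n\}$ with $(f)_2\lesssim (f)_0$. Let $G_{nmf}$ be the random intersection graph defined in the context. Then, as $n\to\infty$, \[ \mathbb{P}(G_{nmf} \text{ is connected}) \to \begin{cases} 0 & \text{if } \log n - \frac{m}{n}(f)_1 \to +\infty,\\ 1 & \text{if } \log n - \frac{m}{n}(f)_1 \to -\infty.\end{cases} \]
   Context: $G_{nmf}$ is the random graph on node set $\{1,\dots,n\}$ obtained by sampling mutually independent random sets $V_1,\dots,V_m\subset\{1,\dots,n\}$, each with probability mass function $A\mapsto f(|A|)\binom{n}{|A|}^{ -1}$, and declaring an unordered pair $\{i,j\}$ of distinct nodes adjacent iff some $V_k$ contains both $i$ and $j$. Moments: $(f)_r=\sum_{x=2}^n x^r f(x)$. $a_n\lesssim b_n$ means $\limsup a_n/|b_n|<\infty$. -}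

module Defs where

open import Data.Fin.Base using (Fin; toℕ; fromℕ<)
import Data.Fin.Properties as Fin
open import Data.Fin.Subset using (Subset; inside; outside; _∈_; ∣_∣)
open import Data.Fin.Subset.Properties using (∣p∣≤n; _∈?_)
open import Data.Integer.Base as ℤ using (+_)
open import Data.List.Base using (List; []; _∷_; [_]; map; filter; foldr; allFin; cartesianProductWith)
open import Data.List.Membership.Propositional using () renaming (_∈_ to _∈ₗ_)
open import Data.List.Membership.Propositional.Properties using (∈-allFin)
open import Data.List.Relation.Unary.Any using (here; there)
open import Data.Nat.Base as ℕ using (ℕ; zero; suc; NonZero; s≤s)
open import Data.Nat.Combinatorics using (_C_; nCk≡n!/k![n-k]!; k![n∸k]!∣n!)
open import Data.Nat.DivMod using (m≥n⇒m/n>0)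
open import Data.Nat.Divisibility using (∣⇒≤)
import Data.Nat.Properties as ℕ
open import Data.Nat.Solver using (module +-*-Solver)
open import Data.Product.Base using (∃-syntax; _×_; _,_)
open import Data.Rational.Base as ℚ using (ℚ; 0ℚ; 1ℚ; ½; _/_)
import Data.Rational.Properties as ℚ
import Data.Rational.Unnormalised.Base as ℚᵘ
import Data.Rational.Unnormalised.Properties as ℚᵘ
open import Data.Sum.Base using (_⊎_; inj₁; inj₂)
open import Data.Vec.Base as Vec using (Vec; lookup)
open import Level using (0ℓ)
open import Relation.Binary.Core using (Rel)
open import Relation.Binary.Definitions using (Decidable)
open import Relation.Binary.Construct.Closure.ReflexiveTransitive as Star using (Star; _◅_; _◅◅_)
open import Relation.Binary.PropositionalEquality hiding ([_])
open import Relation.Nullary.Decidable using (Dec; yes; no; map′; _×-dec_; _⊎-dec_; ¬?)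
open import Relation.Unary as U using (Pred)

infix  4 _≤ʳ_ _≃ʳ_
infixl 6 _+ʳ_ _-ʳ_
infixl 7 _*ʳ_

-- Constructive Cauchy reals; equality of real numbers is _≃ʳ_, and the
-- operations below act termwise on representing sequences.

IsCauchy : (ℕ → ℚ) → Set
IsCauchy x = ∀ ε → 0ℚ ℚ.< ε →
  ∃[ N ] (∀ i j → N ℕ.≤ i → N ℕ.≤ j → ℚ.∣ x i ℚ.- x j ∣ ℚ.≤ ε)

record ℝ : Set where
  constructor mkℝ
  field
    seq    : ℕ → ℚ
    cauchy : IsCauchy seq

open ℝ public

_≤ʳ_ : Rel ℝ 0ℓ
x ≤ʳ y = ∀ ε → 0ℚ ℚ.< ε → ∃[ N ] (∀ i → N ℕ.≤ i → seq x i ℚ.≤ seq y i ℚ.+ ε)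

_≃ʳ_ : Rel ℝ 0ℓ
x ≃ʳ y = x ≤ʳ y × y ≤ʳ x

private
  ½*-pos : ∀ ε → 0ℚ ℚ.< ε → 0ℚ ℚ.< ½ ℚ.* ε
  ½*-pos ε ε>0 = subst (ℚ._< ½ ℚ.* ε) (ℚ.*-zeroʳ ½) (ℚ.*-monoʳ-<-pos ½ ε>0)

  ½+½ : ∀ ε → ½ ℚ.* ε ℚ.+ ½ ℚ.* ε ≡ ε
  ½+½ ε = trans (sym (ℚ.*-distribʳ-+ ε ½ ½)) (ℚ.*-identityˡ ε)

  neg-sub : ∀ p q → ℚ.- (p ℚ.- q) ≡ q ℚ.- p
  neg-sub p q = trans (ℚ.neg-distrib-+ p (ℚ.- q)) (trans (cong (ℚ.- p ℚ.+_) q′) (ℚ.+-comm (ℚ.- p) q))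
    where
    open import Algebra.Properties.Group ℚ.+-0-group using (⁻¹-involutive)
    q′ : ℚ.- (ℚ.- q) ≡ q
    q′ = ⁻¹-involutive q

  sub-add : ∀ p q → (p ℚ.- q) ℚ.+ q ≡ p
  sub-add p q = trans (ℚ.+-assoc p (ℚ.- q) q)
    (trans (cong (p ℚ.+_) (ℚ.+-inverseˡ q)) (ℚ.+-identityʳ p))

  add-sub : ∀ p q → (p ℚ.+ q) ℚ.- q ≡ p
  add-sub p q = trans (ℚ.+-assoc p q (ℚ.- q))
    (trans (cong (p ℚ.+_) (ℚ.+-inverseʳ q)) (ℚ.+-identityʳ p))

  ∣∣-swap : ∀ p q → ℚ.∣ p ℚ.- q ∣ ≡ ℚ.∣ q ℚ.- p ∣
  ∣∣-swap p q = trans (sym (ℚ.∣-p∣≡∣p∣ (p ℚ.- q))) (cong ℚ.∣_∣ (neg-sub p q))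

  p≤∣p∣ : ∀ p → p ℚ.≤ ℚ.∣ p ∣
  p≤∣p∣ p with ℚ.≤-total 0ℚ p
  ... | inj₁ 0≤p = ℚ.≤-reflexive (sym (ℚ.0≤p⇒∣p∣≡p 0≤p))
  ... | inj₂ p≤0 = ℚ.≤-trans p≤0 (ℚ.0≤∣p∣ p)

  ∣p∣≤ : ∀ p r → p ℚ.≤ r → ℚ.- p ℚ.≤ r → ℚ.∣ p ∣ ℚ.≤ r
  ∣p∣≤ p r p≤r -p≤r with ℚ.∣p∣≡p∨∣p∣≡-p p
  ... | inj₁ eq = ℚ.≤-trans (ℚ.≤-reflexive eq) p≤r
  ... | inj₂ eq = ℚ.≤-trans (ℚ.≤-reflexive eq) -p≤r

  ∣p∣-∣q∣≤∣p-q∣ : ∀ p q → ℚ.∣ p ∣ ℚ.- ℚ.∣ q ∣ ℚ.≤ ℚ.∣ p ℚ.- q ∣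
  ∣p∣-∣q∣≤∣p-q∣ p q = begin
    ℚ.∣ p ∣ ℚ.- ℚ.∣ q ∣                              ≡⟨ cong (λ z → ℚ.∣ z ∣ ℚ.- ℚ.∣ q ∣) (sub-add p q) ⟨
    ℚ.∣ (p ℚ.- q) ℚ.+ q ∣ ℚ.- ℚ.∣ q ∣                ≤⟨ ℚ.+-monoˡ-≤ (ℚ.- ℚ.∣ q ∣) (ℚ.∣p+q∣≤∣p∣+∣q∣ (p ℚ.- q) q) ⟩
    (ℚ.∣ p ℚ.- q ∣ ℚ.+ ℚ.∣ q ∣) ℚ.- ℚ.∣ q ∣          ≡⟨ add-sub ℚ.∣ p ℚ.- q ∣ ℚ.∣ q ∣ ⟩
    ℚ.∣ p ℚ.- q ∣                                    ∎
    where open ℚ.≤-Reasoning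

  ∣∣p∣-∣q∣∣≤∣p-q∣ : ∀ p q → ℚ.∣ ℚ.∣ p ∣ ℚ.- ℚ.∣ q ∣ ∣ ℚ.≤ ℚ.∣ p ℚ.- q ∣
  ∣∣p∣-∣q∣∣≤∣p-q∣ p q = ∣p∣≤ _ _ (∣p∣-∣q∣≤∣p-q∣ p q)
    (subst₂ ℚ._≤_ (sym (neg-sub ℚ.∣ p ∣ ℚ.∣ q ∣)) (∣∣-swap q p) (∣p∣-∣q∣≤∣p-q∣ q p))

  ∣∣-mono-* : ∀ a b c d → 0ℚ ℚ.≤ a → 0ℚ ℚ.≤ d → a ℚ.≤ b → c ℚ.≤ d → a ℚ.* c ℚ.≤ b ℚ.* d
  ∣∣-mono-* a b c d 0≤a 0≤d a≤b c≤d = ℚ.≤-trans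
    (ℚ.*-monoˡ-≤-nonNeg a {{ℚ.nonNegative 0≤a}} c≤d)
    (ℚ.*-monoʳ-≤-nonNeg d {{ℚ.nonNegative 0≤d}} a≤b)

  maxBelow : (ℕ → ℚ) → ℕ → ℚ
  maxBelow x zero    = 0ℚ
  maxBelow x (suc n) = ℚ.∣ x n ∣ ℚ.⊔ maxBelow x n

  ≤maxBelow : ∀ x n i → i ℕ.< n → ℚ.∣ x i ∣ ℚ.≤ maxBelow x n
  ≤maxBelow x (suc n) i (s≤s i≤n) with ℕ.m≤n⇒m<n∨m≡n i≤n
  ... | inj₁ i<n  = ℚ.≤-trans (≤maxBelow x n i i<n) (ℚ.p≤q⊔p ℚ.∣ x n ∣ (maxBelow x n))
  ... | inj₂ refl = ℚ.p≤p⊔q ℚ.∣ x n ∣ (maxBelow x n)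

  0<1 : 0ℚ ℚ.< 1ℚ
  0<1 = ℚ.positive⁻¹ 1ℚ

  bounded : (x : ℝ) → ∃[ B ] (0ℚ ℚ.< B × (∀ i → ℚ.∣ seq x i ∣ ℚ.≤ B))
  bounded x with cauchy x 1ℚ 0<1
  ... | N , close = B , B>0 , bd
    where
    open ℚ.≤-Reasoning
    y = seq x
    M = maxBelow y (suc N)
    B = 1ℚ ℚ.+ M
    M≥0 : 0ℚ ℚ.≤ M
    M≥0 = ℚ.≤-trans (ℚ.0≤∣p∣ (y 0)) (≤maxBelow y (suc N) 0 (s≤s ℕ.z≤n))
    B>0 : 0ℚ ℚ.< B
    B>0 = ℚ.+-mono-<-≤ 0<1 M≥0
    bd : ∀ i → ℚ.∣ y i ∣ ℚ.≤ B
    bd i with ℕ.≤-total N i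
    ... | inj₂ i≤N = begin
      ℚ.∣ y i ∣    ≤⟨ ≤maxBelow y (suc N) i (s≤s i≤N) ⟩
      M            ≡⟨ ℚ.+-identityˡ M ⟨
      0ℚ ℚ.+ M     ≤⟨ ℚ.+-monoˡ-≤ M (ℚ.<⇒≤ 0<1) ⟩
      B            ∎
    ... | inj₁ N≤i = begin
      ℚ.∣ y i ∣                            ≡⟨ cong ℚ.∣_∣ (sub-add (y i) (y N)) ⟨
      ℚ.∣ (y i ℚ.- y N) ℚ.+ y N ∣          ≤⟨ ℚ.∣p+q∣≤∣p∣+∣q∣ (y i ℚ.- y N) (y N) ⟩
      ℚ.∣ y i ℚ.- y N ∣ ℚ.+ ℚ.∣ y N ∣      ≤⟨ ℚ.+-mono-≤ (close i N N≤i ℕ.≤-refl)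
                                                          (≤maxBelow y (suc N) N ℕ.≤-refl) ⟩
      B                                    ∎

fromℚ : ℚ → ℝ
fromℚ q = mkℝ (λ _ → q) λ ε ε>0 → 0 , λ i j _ _ →
  ℚ.≤-trans (ℚ.≤-reflexive (cong ℚ.∣_∣ (ℚ.+-inverseʳ q))) (ℚ.<⇒≤ ε>0)

0ℝ 1ℝ : ℝ
0ℝ = fromℚ 0ℚ
1ℝ = fromℚ 1ℚ

_+ʳ_ : ℝ → ℝ → ℝ
x +ʳ y = mkℝ (λ i → seq x i ℚ.+ seq y i) cauchy-+
  where
  open import Algebra.Bundles using (CommutativeMonoid)
  open import Algebra.Properties.CommutativeSemigroup
    (CommutativeMonoid.commutativeSemigroup ℚ.+-0-commutativeMonoid) using (interchange)
  open ℚ.≤-Reasoning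
  cauchy-+ : IsCauchy (λ i → seq x i ℚ.+ seq y i)
  cauchy-+ ε ε>0 with cauchy x (½ ℚ.* ε) (½*-pos ε ε>0) | cauchy y (½ ℚ.* ε) (½*-pos ε ε>0)
  ... | N₁ , h₁ | N₂ , h₂ = N₁ ℕ.⊔ N₂ , λ i j N≤i N≤j →
    let a = seq x i; b = seq x j; c = seq y i; d = seq y j in begin
    ℚ.∣ (a ℚ.+ c) ℚ.- (b ℚ.+ d) ∣            ≡⟨ cong (λ z → ℚ.∣ (a ℚ.+ c) ℚ.+ z ∣) (ℚ.neg-distrib-+ b d) ⟩
    ℚ.∣ (a ℚ.+ c) ℚ.+ (ℚ.- b ℚ.- d) ∣        ≡⟨ cong ℚ.∣_∣ (interchange a c (ℚ.- b) (ℚ.- d)) ⟩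
    ℚ.∣ (a ℚ.- b) ℚ.+ (c ℚ.- d) ∣            ≤⟨ ℚ.∣p+q∣≤∣p∣+∣q∣ (a ℚ.- b) (c ℚ.- d) ⟩
    ℚ.∣ a ℚ.- b ∣ ℚ.+ ℚ.∣ c ℚ.- d ∣          ≤⟨ ℚ.+-mono-≤
                                                  (h₁ i j (ℕ.m⊔n≤o⇒m≤o N₁ N₂ N≤i) (ℕ.m⊔n≤o⇒m≤o N₁ N₂ N≤j))
                                                  (h₂ i j (ℕ.m⊔n≤o⇒n≤o N₁ N₂ N≤i) (ℕ.m⊔n≤o⇒n≤o N₁ N₂ N≤j)) ⟩
    ½ ℚ.* ε ℚ.+ ½ ℚ.* ε                      ≡⟨ ½+½ ε ⟩
    ε                                        ∎

-ʳ_ : ℝ → ℝ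
-ʳ x = mkℝ (λ i → ℚ.- seq x i) λ ε ε>0 → let N , h = cauchy x ε ε>0 in
  N , λ i j N≤i N≤j → subst (ℚ._≤ ε)
    (trans (sym (ℚ.∣-p∣≡∣p∣ (seq x i ℚ.- seq x j))) (cong ℚ.∣_∣ (ℚ.neg-distrib-+ (seq x i) (ℚ.- seq x j))))
    (h i j N≤i N≤j)

_-ʳ_ : ℝ → ℝ → ℝ
x -ʳ y = x +ʳ (-ʳ y)

∣_∣ʳ : ℝ → ℝ
∣ x ∣ʳ = mkℝ (λ i → ℚ.∣ seq x i ∣) λ ε ε>0 → let N , h = cauchy x ε ε>0 in
  N , λ i j N≤i N≤j → ℚ.≤-trans (∣∣p∣-∣q∣∣≤∣p-q∣ (seq x i) (seq x j)) (h i j N≤i N≤j)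

_*ʳ_ : ℝ → ℝ → ℝ
x *ʳ y = mkℝ (λ i → seq x i ℚ.* seq y i) cauchy-*
  where
  open ℚ.≤-Reasoning
  over : ∀ ε B → 0ℚ ℚ.< ε → 0ℚ ℚ.< B → ∃[ δ ] (0ℚ ℚ.< δ × B ℚ.* δ ≡ ½ ℚ.* ε)
  over ε B ε>0 B>0 = δ , δ>0 , Bδ≡
    where
    instance
      B+ : ℚ.Positive B
      B+ = ℚ.positive B>0
      B≠ : ℚ.NonZero B
      B≠ = ℚ.pos⇒nonZero B
      h+ : ℚ.Positive (½ ℚ.* ε)
      h+ = ℚ.positive (½*-pos ε ε>0)
      i+ : ℚ.Positive (ℚ.1/ B)
      i+ = ℚ.1/pos⇒pos B
    δ = (ℚ.1/ B) ℚ.* (½ ℚ.* ε)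
    δ>0 : 0ℚ ℚ.< δ
    δ>0 = ℚ.positive⁻¹ δ {{ℚ.pos*pos⇒pos (ℚ.1/ B) (½ ℚ.* ε)}}
    Bδ≡ : B ℚ.* δ ≡ ½ ℚ.* ε
    Bδ≡ = trans (sym (ℚ.*-assoc B (ℚ.1/ B) (½ ℚ.* ε)))
            (trans (cong (ℚ._* (½ ℚ.* ε)) (ℚ.*-inverseʳ B)) (ℚ.*-identityˡ _))
  split : ∀ a b c d → a ℚ.* c ℚ.- b ℚ.* d ≡ a ℚ.* (c ℚ.- d) ℚ.+ d ℚ.* (a ℚ.- b)
  split a b c d = begin-equality
    a ℚ.* c ℚ.- b ℚ.* d                                       ≡⟨ cong (ℚ._- b ℚ.* d) (sub-add (a ℚ.* c) (a ℚ.* d)) ⟨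
    ((a ℚ.* c ℚ.- a ℚ.* d) ℚ.+ a ℚ.* d) ℚ.- b ℚ.* d           ≡⟨ ℚ.+-assoc (a ℚ.* c ℚ.- a ℚ.* d) (a ℚ.* d) (ℚ.- (b ℚ.* d)) ⟩
    (a ℚ.* c ℚ.- a ℚ.* d) ℚ.+ (a ℚ.* d ℚ.- b ℚ.* d)           ≡⟨ cong₂ ℚ._+_ (distr a c d) (cong₂ ℚ._-_ (ℚ.*-comm a d) (ℚ.*-comm b d)) ⟩
    a ℚ.* (c ℚ.- d) ℚ.+ (d ℚ.* a ℚ.- d ℚ.* b)                 ≡⟨ cong (a ℚ.* (c ℚ.- d) ℚ.+_) (distr d a b) ⟩
    a ℚ.* (c ℚ.- d) ℚ.+ d ℚ.* (a ℚ.- b)                       ∎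
    where
    distr : ∀ p q r → p ℚ.* q ℚ.- p ℚ.* r ≡ p ℚ.* (q ℚ.- r)
    distr p q r = trans (cong (p ℚ.* q ℚ.+_) (ℚ.neg-distribʳ-* p r)) (sym (ℚ.*-distribˡ-+ p q (ℚ.- r)))
  cauchy-* : IsCauchy (λ i → seq x i ℚ.* seq y i)
  cauchy-* ε ε>0 with bounded x | bounded y
  ... | B , B>0 , x≤B | D , D>0 , y≤D with over ε B ε>0 B>0 | over ε D ε>0 D>0
  ... | δ , δ>0 , Bδ | γ , γ>0 , Dγ with cauchy y δ δ>0 | cauchy x γ γ>0
  ... | N₁ , h₁ | N₂ , h₂ = N₁ ℕ.⊔ N₂ , λ i j N≤i N≤j →
    let a = seq x i; b = seq x j; c = seq y i; d = seq y j in begin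
    ℚ.∣ a ℚ.* c ℚ.- b ℚ.* d ∣                            ≡⟨ cong ℚ.∣_∣ (split a b c d) ⟩
    ℚ.∣ a ℚ.* (c ℚ.- d) ℚ.+ d ℚ.* (a ℚ.- b) ∣            ≤⟨ ℚ.∣p+q∣≤∣p∣+∣q∣ (a ℚ.* (c ℚ.- d)) (d ℚ.* (a ℚ.- b)) ⟩
    ℚ.∣ a ℚ.* (c ℚ.- d) ∣ ℚ.+ ℚ.∣ d ℚ.* (a ℚ.- b) ∣      ≡⟨ cong₂ ℚ._+_ (ℚ.∣p*q∣≡∣p∣*∣q∣ a (c ℚ.- d)) (ℚ.∣p*q∣≡∣p∣*∣q∣ d (a ℚ.- b)) ⟩
    ℚ.∣ a ∣ ℚ.* ℚ.∣ c ℚ.- d ∣ ℚ.+ ℚ.∣ d ∣ ℚ.* ℚ.∣ a ℚ.- b ∣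
      ≤⟨ ℚ.+-mono-≤
           (∣∣-mono-* _ B _ δ (ℚ.0≤∣p∣ a) (ℚ.<⇒≤ δ>0) (x≤B i)
             (h₁ i j (ℕ.m⊔n≤o⇒m≤o N₁ N₂ N≤i) (ℕ.m⊔n≤o⇒m≤o N₁ N₂ N≤j)))
           (∣∣-mono-* _ D _ γ (ℚ.0≤∣p∣ d) (ℚ.<⇒≤ γ>0) (y≤D j)
             (h₂ i j (ℕ.m⊔n≤o⇒n≤o N₁ N₂ N≤i) (ℕ.m⊔n≤o⇒n≤o N₁ N₂ N≤j))) ⟩
    B ℚ.* δ ℚ.+ D ℚ.* γ                                  ≡⟨ cong₂ ℚ._+_ Bδ Dγ ⟩
    ½ ℚ.* ε ℚ.+ ½ ℚ.* ε                                  ≡⟨ ½+½ ε ⟩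
    ε                                                    ∎

sumʳ : List ℝ → ℝ
sumʳ = foldr _+ʳ_ 0ℝ

sumℚ : ℕ → (ℕ → ℚ) → ℚ
sumℚ zero    f = 0ℚ
sumℚ (suc k) f = sumℚ k f ℚ.+ f k

-- log n = ∫₁ⁿ dt/t as the limit of its right-endpoint Riemann sums with
-- N = suc i subintervals per unit length: subinterval j < (n - 1)N has
-- width 1/N and right endpoint 1 + (j + 1)/N, so it contributes
-- (1/N) · 1/(1 + (j + 1)/N) = 1/(N + j + 1).
logRiemann : ℕ → ℕ → ℚ
logRiemann n i = sumℚ ((n ℕ.∸ 1) ℕ.* N) (λ j → + 1 / suc (N ℕ.+ j))
  where
  N = suc i

private
  rec : ℕ → ℚ
  rec k = + 1 / suc k

  /-mono : ∀ a b c d → .{{_ : NonZero b}} → .{{_ : NonZero d}} →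
           a ℕ.* d ℕ.≤ c ℕ.* b → + a / b ℚ.≤ + c / d
  /-mono a (suc b) c (suc d) le = ℚ.toℚᵘ-cancel-≤ (begin
    ℚ.toℚᵘ (+ a / suc b)   ≃⟨ ℚ.toℚᵘ-fromℚᵘ (ℚᵘ.mkℚᵘ (+ a) b) ⟩
    ℚᵘ.mkℚᵘ (+ a) b        ≤⟨ ℚᵘ.*≤* (subst₂ ℤ._≤_ (ℤ.pos-* a (suc d)) (ℤ.pos-* c (suc b)) (ℤ.+≤+ le)) ⟩
    ℚᵘ.mkℚᵘ (+ c) d        ≃⟨ ℚ.toℚᵘ-fromℚᵘ (ℚᵘ.mkℚᵘ (+ c) d) ⟨
    ℚ.toℚᵘ (+ c / suc d)   ∎)
    where
    open ℚᵘ.≤-Reasoning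
    import Data.Integer.Properties as ℤ

  rec-anti : ∀ {a b} → a ℕ.≤ b → rec b ℚ.≤ rec a
  rec-anti {a} {b} a≤b = /-mono 1 (suc b) 1 (suc a) (ℕ.*-monoʳ-≤ 1 (s≤s a≤b))

  const-/ : ∀ k d → .{{_ : NonZero d}} → sumℚ k (λ _ → + 1 / d) ≡ + k / d
  const-/ zero    d       = sym (ℚ.0/n≡0 d)
  const-/ (suc k) (suc d) = trans (cong (ℚ._+ rec d) (const-/ k (suc d))) (ℚ.toℚᵘ-injective (begin
    ℚ.toℚᵘ (+ k / suc d ℚ.+ rec d)                 ≈⟨ ℚ.toℚᵘ-homo-+ (+ k / suc d) (rec d) ⟩
    ℚ.toℚᵘ (+ k / suc d) ℚᵘ.+ ℚ.toℚᵘ (rec d)       ≈⟨ ℚᵘ.+-cong (ℚ.toℚᵘ-fromℚᵘ (ℚᵘ.mkℚᵘ (+ k) d)) (ℚ.toℚᵘ-fromℚᵘ (ℚᵘ.mkℚᵘ (+ 1) d)) ⟩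
    ℚᵘ.mkℚᵘ (+ k) d ℚᵘ.+ ℚᵘ.mkℚᵘ (+ 1) d           ≈⟨ ℚᵘ.*≡* eq ⟩
    ℚᵘ.mkℚᵘ (+ suc k) d                            ≈⟨ ℚ.toℚᵘ-fromℚᵘ (ℚᵘ.mkℚᵘ (+ suc k) d) ⟨
    ℚ.toℚᵘ (+ suc k / suc d)                       ∎))
    where
    open import Relation.Binary.Reasoning.Setoid ℚᵘ.≃-setoid
    import Data.Integer.Solver as ℤSolver
    open ℤSolver.+-*-Solver
    eq : (+ k ℤ.* + suc d ℤ.+ + 1 ℤ.* + suc d) ℤ.* + suc d ≡ + suc k ℤ.* (+ suc d ℤ.* + suc d)
    eq = solve 2 (λ k d → (k :* d :+ con (+ 1) :* d) :* d := (con (+ 1) :+ k) :* (d :* d)) refl (+ k) (+ suc d)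

  sum-mono : ∀ k (f g : ℕ → ℚ) → (∀ j → j ℕ.< k → f j ℚ.≤ g j) → sumℚ k f ℚ.≤ sumℚ k g
  sum-mono zero    f g f≤g = ℚ.≤-refl
  sum-mono (suc k) f g f≤g = ℚ.+-mono-≤ (sum-mono k f g (λ j j<k → f≤g j (ℕ.m<n⇒m<1+n j<k))) (f≤g k ℕ.≤-refl)

  H : ℕ → ℚ
  H k = sumℚ k rec

  H-+ : ∀ a k → H (a ℕ.+ k) ≡ sumℚ k (λ j → rec (a ℕ.+ j)) ℚ.+ H a
  H-+ a zero    = trans (cong H (ℕ.+-identityʳ a)) (sym (ℚ.+-identityˡ (H a)))
  H-+ a (suc k) = begin
    H (a ℕ.+ suc k)                    ≡⟨ cong H (ℕ.+-suc a k) ⟩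
    H (a ℕ.+ k) ℚ.+ rec (a ℕ.+ k)      ≡⟨ cong (ℚ._+ rec (a ℕ.+ k)) (H-+ a k) ⟩
    (S ℚ.+ H a) ℚ.+ rec (a ℕ.+ k)      ≡⟨ ℚ.+-assoc S (H a) _ ⟩
    S ℚ.+ (H a ℚ.+ rec (a ℕ.+ k))      ≡⟨ cong (S ℚ.+_) (ℚ.+-comm (H a) _) ⟩
    S ℚ.+ (rec (a ℕ.+ k) ℚ.+ H a)      ≡⟨ ℚ.+-assoc S _ (H a) ⟨
    (S ℚ.+ rec (a ℕ.+ k)) ℚ.+ H a      ∎
    where
    open ≡-Reasoning
    S = sumℚ k (λ j → rec (a ℕ.+ j))

  -- Passing from N to N + 1 subintervals per unit length increases the
  -- Riemann sum by at most 1/N - 1/(N + 1).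
  module Step (p i : ℕ) where
    N = suc i
    a = N ℕ.+ p ℕ.* N
    block = sumℚ (suc p) (λ j → rec (a ℕ.+ j))
    L L′ : ℚ
    L  = logRiemann (suc p) i
    L′ = logRiemann (suc p) (suc i)

    step : L′ ℚ.+ rec N ≡ block ℚ.+ L
    step = cancel (begin
      (L′ ℚ.+ rec N) ℚ.+ H N              ≡⟨ ℚ.+-assoc L′ (rec N) (H N) ⟩
      L′ ℚ.+ (rec N ℚ.+ H N)              ≡⟨ cong (L′ ℚ.+_) (ℚ.+-comm (rec N) (H N)) ⟩
      L′ ℚ.+ H (suc N)                    ≡⟨ H-+ (suc N) (p ℕ.* suc N) ⟨
      H (suc N ℕ.+ p ℕ.* suc N)           ≡⟨ cong H (solve 2 (λ p N → (con 1 :+ N) :+ p :* (con 1 :+ N) := (N :+ p :* N) :+ (con 1 :+ p)) refl p N) ⟩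
      H (a ℕ.+ suc p)                     ≡⟨ H-+ a (suc p) ⟩
      block ℚ.+ H a                       ≡⟨ cong (block ℚ.+_) (H-+ N (p ℕ.* N)) ⟩
      block ℚ.+ (L ℚ.+ H N)               ≡⟨ ℚ.+-assoc block L (H N) ⟨
      (block ℚ.+ L) ℚ.+ H N               ∎)
      where
      open ≡-Reasoning
      open +-*-Solver
      cancel : ∀ {x y} → x ℚ.+ H N ≡ y ℚ.+ H N → x ≡ y
      cancel {x} {y} eq = trans (sym (add-sub x (H N))) (trans (cong (ℚ._- H N) eq) (add-sub y (H N)))

    block≥ : rec N ℚ.≤ block
    block≥ = begin
      rec N                                              ≤⟨ /-mono 1 (suc N) (suc p) (suc (a ℕ.+ p)) (ℕ.≤-reflexive (solve 2 (λ p N → con 1 :* (con 1 :+ ((N :+ p :* N) :+ p)) := (con 1 :+ p) :* (con 1 :+ N)) refl p N)) ⟩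
      + suc p / suc (a ℕ.+ p)                            ≡⟨ const-/ (suc p) (suc (a ℕ.+ p)) ⟨
      sumℚ (suc p) (λ _ → rec (a ℕ.+ p))                 ≤⟨ sum-mono (suc p) (λ _ → rec (a ℕ.+ p)) (λ j → rec (a ℕ.+ j)) (λ { j (s≤s j≤p) → rec-anti (ℕ.+-monoʳ-≤ a j≤p) }) ⟩
      block                                              ∎
      where
      open ℚ.≤-Reasoning
      open +-*-Solver

    block≤ : block ℚ.≤ rec i
    block≤ = begin
      block                                              ≤⟨ sum-mono (suc p) (λ j → rec (a ℕ.+ j)) (λ _ → rec (i ℕ.+ p ℕ.* N)) (λ j _ → rec-anti (ℕ.≤-trans (ℕ.n≤1+n _) (ℕ.m≤m+n a j))) ⟩
      sumℚ (suc p) (λ _ → rec (i ℕ.+ p ℕ.* N))           ≡⟨ const-/ (suc p) a ⟩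
      + suc p / a                                        ≤⟨ /-mono (suc p) a 1 N (ℕ.≤-reflexive (solve 2 (λ p N → (con 1 :+ p) :* N := con 1 :* (N :+ p :* N)) refl p N)) ⟩
      rec i                                              ∎
      where
      open ℚ.≤-Reasoning
      open +-*-Solver

    step-mono : L ℚ.≤ L′
    step-mono = begin
      L                            ≡⟨ ℚ.+-identityʳ L ⟨
      L ℚ.+ 0ℚ                     ≡⟨ cong (L ℚ.+_) (ℚ.+-inverseʳ (rec N)) ⟨
      L ℚ.+ (rec N ℚ.- rec N)      ≡⟨ ℚ.+-assoc L (rec N) (ℚ.- rec N) ⟨
      (L ℚ.+ rec N) ℚ.- rec N      ≤⟨ ℚ.+-monoˡ-≤ (ℚ.- rec N) (ℚ.+-monoʳ-≤ L block≥) ⟩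
      (L ℚ.+ block) ℚ.- rec N      ≡⟨ cong (ℚ._- rec N) (trans (ℚ.+-comm L block) (sym step)) ⟩
      (L′ ℚ.+ rec N) ℚ.- rec N     ≡⟨ add-sub L′ (rec N) ⟩
      L′                           ∎
      where open ℚ.≤-Reasoning

    step-anti : L′ ℚ.+ rec N ℚ.≤ L ℚ.+ rec i
    step-anti = begin
      L′ ℚ.+ rec N   ≡⟨ trans step (ℚ.+-comm block L) ⟩
      L ℚ.+ block    ≤⟨ ℚ.+-monoʳ-≤ L block≤ ⟩
      L ℚ.+ rec i    ∎
      where open ℚ.≤-Reasoning

  rec>0 : ∀ k → 0ℚ ℚ.< rec k
  rec>0 k = ℚ.positive⁻¹ (rec k) {{ℚ.normalize-pos 1 (suc k)}}

  archimedes : ∀ ε → 0ℚ ℚ.< ε → ∃[ N ] rec N ℚ.≤ ε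
  archimedes ε ε>0 with ε | ℚ.positive ε>0
  ... | q@(ℚ.mkℚ ℤ.+[1+ k ] d _) | _ = d , (begin
    rec d                   ≤⟨ /-mono 1 (suc d) (suc k) (suc d) (ℕ.*-monoˡ-≤ (suc d) (s≤s {0} {k} ℕ.z≤n)) ⟩
    + suc k / suc d         ≡⟨ ℚ.↥p/↧p≡p q ⟩
    q                       ∎)
    where open ℚ.≤-Reasoning

  squeeze : (x : ℕ → ℚ) → (∀ i → x i ℚ.≤ x (suc i)) →
            (∀ i → x (suc i) ℚ.+ rec (suc i) ℚ.≤ x i ℚ.+ rec i) → IsCauchy x
  squeeze x up down ε ε>0 with archimedes ε ε>0
  ... | N , rec≤ε = N , cauchy′
    where
    open ℚ.≤-Reasoning
    mono : ∀ {i j} → i ℕ.≤′ j → x i ℚ.≤ x j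
    mono ℕ.≤′-refl       = ℚ.≤-refl
    mono (ℕ.≤′-step i≤j) = ℚ.≤-trans (mono i≤j) (up _)
    anti : ∀ {i j} → i ℕ.≤′ j → x j ℚ.+ rec j ℚ.≤ x i ℚ.+ rec i
    anti ℕ.≤′-refl       = ℚ.≤-refl
    anti (ℕ.≤′-step i≤j) = ℚ.≤-trans (down _) (anti i≤j)
    close : ∀ i j → N ℕ.≤ i → i ℕ.≤ j → ℚ.∣ x j ℚ.- x i ∣ ℚ.≤ ε
    close i j N≤i i≤j = ∣p∣≤ _ _
      (begin
        x j ℚ.- x i                    ≡⟨ cong (ℚ._- x i) (ℚ.+-identityʳ (x j)) ⟨
        (x j ℚ.+ 0ℚ) ℚ.- x i           ≤⟨ ℚ.+-monoˡ-≤ (ℚ.- x i) (ℚ.+-monoʳ-≤ (x j) (ℚ.<⇒≤ (rec>0 j))) ⟩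
        (x j ℚ.+ rec j) ℚ.- x i        ≤⟨ ℚ.+-monoˡ-≤ (ℚ.- x i) (anti (ℕ.≤⇒≤′ i≤j)) ⟩
        (x i ℚ.+ rec i) ℚ.- x i        ≡⟨ cong (ℚ._- x i) (ℚ.+-comm (x i) (rec i)) ⟩
        (rec i ℚ.+ x i) ℚ.- x i        ≡⟨ add-sub (rec i) (x i) ⟩
        rec i                          ≤⟨ rec-anti N≤i ⟩
        rec N                          ≤⟨ rec≤ε ⟩
        ε                              ∎)
      (begin
        ℚ.- (x j ℚ.- x i)              ≡⟨ neg-sub (x j) (x i) ⟩
        x i ℚ.- x j                    ≤⟨ ℚ.+-monoˡ-≤ (ℚ.- x j) (mono (ℕ.≤⇒≤′ i≤j)) ⟩
        x j ℚ.- x j                    ≡⟨ ℚ.+-inverseʳ (x j) ⟩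
        0ℚ                             ≤⟨ ℚ.<⇒≤ ε>0 ⟩
        ε                              ∎)
    cauchy′ : ∀ i j → N ℕ.≤ i → N ℕ.≤ j → ℚ.∣ x i ℚ.- x j ∣ ℚ.≤ ε
    cauchy′ i j N≤i N≤j with ℕ.≤-total i j
    ... | inj₁ i≤j = subst (ℚ._≤ ε) (∣∣-swap (x j) (x i)) (close i j N≤i i≤j)
    ... | inj₂ j≤i = close j i N≤j j≤i

log : (n : ℕ) .{{_ : NonZero n}} → ℝ
log (suc p) = mkℝ (logRiemann (suc p))
  (squeeze _ (λ i → Step.step-mono p i) (λ i → Step.step-anti p i))

Seq⁺ : Set → Set
Seq⁺ A = (n : ℕ) .{{_ : NonZero n}} → A

infix 4 _⟶_ _⟶+∞ _⟶-∞ _≲_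

_⟶_ : Seq⁺ ℝ → ℝ → Set
a ⟶ ℓ = ∀ ε → 0ℚ ℚ.< ε →
  ∃[ N ] (∀ n .{{_ : NonZero n}} → N ℕ.≤ n → ∣ a n -ʳ ℓ ∣ʳ ≤ʳ fromℚ ε)

_⟶+∞ _⟶-∞ : Seq⁺ ℝ → Set
a ⟶+∞ = ∀ K → ∃[ N ] (∀ n .{{_ : NonZero n}} → N ℕ.≤ n → fromℚ K ≤ʳ a n)
a ⟶-∞ = ∀ K → ∃[ N ] (∀ n .{{_ : NonZero n}} → N ℕ.≤ n → a n ≤ʳ fromℚ K)

-- limsup aₙ/|bₙ| < ∞, with the quotient cleared so that bₙ = 0 is allowed.
_≲_ : Seq⁺ ℝ → Seq⁺ ℝ → Set
a ≲ b = ∃[ K ] ∃[ N ] (∀ n .{{_ : NonZero n}} → N ℕ.≤ n → a n ≤ʳ fromℚ K *ʳ ∣ b n ∣ʳ)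

Connected : ∀ {n} → Rel (Fin n) 0ℓ → Set
Connected _~_ = ∀ i j → Star _~_ i j

-- Connectedness is decided by Warshall's algorithm.
module _ {n} {_~_ : Rel (Fin n) 0ℓ} (_~?_ : Decidable _~_) where

  private
    -- Paths from i to j all of whose interior vertices lie in the list.
    Via : List (Fin n) → Rel (Fin n) 0ℓ
    Via []       i j = i ≡ j ⊎ i ~ j
    Via (v ∷ vs) i j = Via vs i j ⊎ (Via vs i v × Via vs v j)

    via? : ∀ vs → Decidable (Via vs)
    via? []       i j = (i Fin.≟ j) ⊎-dec (i ~? j)
    via? (v ∷ vs) i j = via? vs i j ⊎-dec (via? vs i v ×-dec via? vs v j)

    sound : ∀ vs {i j} → Via vs i j → Star _~_ i j
    sound []       (inj₁ refl)    = Star.ε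
    sound []       (inj₂ e)       = e ◅ Star.ε
    sound (v ∷ vs) (inj₁ p)       = sound vs p
    sound (v ∷ vs) (inj₂ (p , q)) = sound vs p ◅◅ sound vs q

    base : ∀ vs {i j} → i ≡ j ⊎ i ~ j → Via vs i j
    base []       p = p
    base (v ∷ vs) p = inj₁ (base vs p)

    join : ∀ vs {i u j} → u ∈ₗ vs → Via vs i u → Via vs u j → Via vs i j
    join (v ∷ vs) (here refl) p q = inj₂ (to p , from q)
      where
      to : ∀ {i} → Via (v ∷ vs) i v → Via vs i v
      to (inj₁ p)       = p
      to (inj₂ (p , _)) = p
      from : ∀ {j} → Via (v ∷ vs) v j → Via vs v j
      from (inj₁ p)       = p
      from (inj₂ (_ , p)) = p
    join (v ∷ vs) (there u∈) (inj₁ p)       (inj₁ q)       = inj₁ (join vs u∈ p q)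
    join (v ∷ vs) (there u∈) (inj₁ p)       (inj₂ (q , r)) = inj₂ (join vs u∈ p q , r)
    join (v ∷ vs) (there u∈) (inj₂ (p , q)) (inj₁ r)       = inj₂ (p , join vs u∈ q r)
    join (v ∷ vs) (there u∈) (inj₂ (p , _)) (inj₂ (_ , r)) = inj₂ (p , r)

    complete : ∀ {i j} → Star _~_ i j → Via (allFin n) i j
    complete Star.ε             = base (allFin n) (inj₁ refl)
    complete (_◅_ {_} {u} e es) = join (allFin n) (∈-allFin u) (base (allFin n) (inj₂ e)) (complete es)

  connected? : Dec (Connected _~_)
  connected? = Fin.all? λ i → Fin.all? λ j → map′ (sound (allFin n)) complete (via? (allFin n) i j)

record Distribution (n : ℕ) : Set where
  field
    pmf    : Fin (suc n) → ℝ
    nonneg : ∀ x → 0ℝ ≤ʳ pmf x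
    total  : sumʳ (map pmf (allFin (suc n))) ≃ʳ 1ℝ

open Distribution public

moment : ∀ {n} → Distribution n → ℕ → ℝ
moment {n} f r = sumʳ
  (map (λ x → fromℚ (+ (toℕ x ℕ.^ r) / 1) *ʳ pmf f x)
       (filter (λ x → 2 ℕ.≤? toℕ x) (allFin (suc n))))

nCk≢0 : ∀ {n k} → k ℕ.≤ n → NonZero (n C k)
nCk≢0 {n} {k} k≤n = ℕ.>-nonZero (subst (0 ℕ.<_) (sym (nCk≡n!/k![n-k]! k≤n))
  (m≥n⇒m/n>0 {{k!≢0}} (∣⇒≤ {{n!≢0}} (k![n∸k]!∣n! k≤n))))
  where
  n!≢0 = ℕ._!≢0 n
  k!≢0 = ℕ._!*_!≢0 k (n ℕ.∸ k)

subsetPmf : ∀ {n} → Distribution n → Subset n → ℝ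
subsetPmf {n} f A =
  fromℚ ((+ 1 / (n C ∣ A ∣)) {{nCk≢0 (∣p∣≤n A)}}) *ʳ pmf f (fromℕ< (s≤s (∣p∣≤n A)))

vectors : ∀ {A : Set} → List A → (k : ℕ) → List (Vec A k)
vectors as zero    = [ Vec.[] ]
vectors as (suc k) = cartesianProductWith Vec._∷_ as (vectors as k)

allSubsets : ∀ n → List (Subset n)
allSubsets n = vectors (outside ∷ inside ∷ []) n

-- V₁, …, V_m are the coordinates of (Subset n)ᵐ under this product law, so
-- they are mutually independent, each with law subsetPmf f.
jointPmf : ∀ {n m} → Distribution n → Vec (Subset n) m → ℝ
jointPmf f = Vec.foldr (λ _ → ℝ) (λ A p → subsetPmf f A *ʳ p) 1ℝ

ℙ : ∀ {n} m → Distribution n → {E : Pred (Vec (Subset n) m) 0ℓ} → U.Decidable E → ℝ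
ℙ {n} m f E? = sumʳ (map (jointPmf f) (filter E? (vectors (allSubsets n) m)))

Adjacent : ∀ {n m} → Vec (Subset n) m → Rel (Fin n) 0ℓ
Adjacent V i j = i ≢ j × ∃[ k ] (i ∈ lookup V k × j ∈ lookup V k)

adjacent? : ∀ {n m} (V : Vec (Subset n) m) → Decidable (Adjacent V)
adjacent? V i j =
  ¬? (i Fin.≟ j) ×-dec Fin.any? (λ k → (i ∈? lookup V k) ×-dec (j ∈? lookup V k))

intersectionGraphConnected? : ∀ {n m} → U.Decidable (λ (V : Vec (Subset n) m) → Connected (Adjacent V))
intersectionGraphConnected? V = connected? (adjacent? V)

ℙ-connected : (n m : ℕ) → Distribution n → ℝ
ℙ-connected n m f = ℙ m f (intersectionGraphConnected? {n} {m})

{-# OPTIONS --safe #-}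

-- Let λ = (m/n)(f)₁ and say that a node is isolated if every Vₖ containing it has at
-- most one element. A given node is isolated with probability (1 - (f)₁/n)ᵐ, so about
-- e^(log n - λ) nodes are expected to be. Since (f)₂ ≲ (f)₀ ≤ (f)₁, two nodes are
-- almost independent, and Chebyshev's inequality yields an isolated node whenever
-- log n - λ → +∞. If the graph is disconnected, some set of k ≤ n/2 nodes is crossed by
-- no Vᵢ; when log n - λ → -∞ the union bound over all such sets is summable, because one
-- random set fails to cross with probability at most 1 - k(f)₁/n + k²(f)₂/n² and at most
-- 1 - k(f)₀/n.
--
-- Every comparison of powers with n = e^(log n) reduces to one fact: a product of
-- factors 1 + t, t ≥ -1, is at most 1 if the t sum to at most 0. It applies because
-- log n lies between Hₙ - 1 and Hₙ, while n and 1/n are products of the factors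
-- 1 + 1/j and 1 - 1/(j + 1). The estimates are proved for rational distributions and
-- transferred to real ones by clamping the terms of the Cauchy sequences.

module Submission where

open import Defs
open import Algebra.Bundles using (CommutativeRing)
open import Data.Fin.Base using (Fin; zero; suc; toℕ; fromℕ<)
import Data.Fin.Properties as Fin
open import Data.Fin.Subset using (Subset; inside; outside; _∈_; _∉_; _⊆_; ∣_∣; ⊤; ∁; ⁅_⁆; _∪_) renaming (_-_ to _∖_)
open import Data.Fin.Subset.Properties as Subset using (∣p∣≤n; _∈?_; _⊆?_)
open import Data.Integer.Base as ℤ using (+_)
import Data.Integer.Properties as ℤ
open import Data.List.Base using (List; []; _∷_; _++_; map; filter; allFin; cartesianProductWith)
import Data.List.Properties as List
open import Data.List.Relation.Unary.All as All using (All; []; _∷_)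
import Data.List.Relation.Unary.All.Properties as All
open import Data.Maybe.Base using (Maybe; just; nothing)
open import Data.Nat.Base as ℕ using (ℕ; zero; suc; NonZero; _≤_; s≤s; z≤n)
open import Data.Nat.Combinatorics using (_C_; nCn≡1; nC1≡n; nCk≡nC[n∸k]; nCk+nC[k+1]≡[n+1]C[k+1])
import Data.Nat.Properties as ℕ
open import Data.Nat.Solver using (module +-*-Solver)
open import Data.Product.Base using (∃-syntax; _×_; _,_; proj₁; proj₂)
open import Data.Rational.Base as ℚ using (ℚ; 0ℚ; 1ℚ; ½; _/_; _+_; _*_; _-_; -_)
  renaming (_≤_ to _≤ᵠ_; _<_ to _<ᵠ_)
import Data.Rational.Properties as ℚ
import Data.Rational.Unnormalised.Base as ℚᵘ
import Data.Rational.Unnormalised.Properties as ℚᵘ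
open import Data.Sum.Base using (_⊎_; inj₁; inj₂; [_,_]′)
open import Data.Vec.Base as Vec using (Vec; []; _∷_; lookup)
open import Function.Base using (_∘_; case_of_)
open import Level using (0ℓ)
open import Relation.Binary.Construct.Closure.ReflexiveTransitive as Star using (Star; _◅_; _◅◅_)
open import Relation.Binary.PropositionalEquality
open import Relation.Nullary.Decidable using (Dec; yes; no; _⊎-dec_; _×-dec_; ¬?)
open import Relation.Nullary.Negation using (¬_; contradiction)
open import Relation.Unary as U using (Pred)
open import Tactic.RingSolver using (solve-∀)
open import Tactic.RingSolver.Core.AlmostCommutativeRing using (AlmostCommutativeRing; fromCommutativeRing)
open import Algebra.Properties.CommutativeSemiring.Exp
  (CommutativeRing.commutativeSemiring ℚ.+-*-commutativeRing) using (_^_; ^-distrib-*)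

-- Ordered arithmetic in ℚ

-- Rational distributions come first because the merging of factors 1 + t decides at every step
-- which of two numbers is larger, and constructive reals offer no such decision. The delicate point
-- of the connected regime is that C(n,k) contributes about k log n to the exponent, which kλ must
-- beat with coefficient 1, so κ M₁ has to keep its full coefficient. The quadratic price κ² M₂ is
-- at most about Kκ times κ M₁, hence affordable while Kκ ≤ ½, which is the threshold 2Kk ≤ n. This
-- price multiplies log n as well; it stays bounded per node because κ (Hₙ - Hₖ) ≤ 1, and because
-- (n/k)^k, unlike n^k, leaves k Hₖ to spare. Beyond the threshold, 2ⁿ costs only a constant per
-- node of the cut, so a fixed fraction of kλ suffices and the cruder bound with M₀ is enough.

ℚ-ring : AlmostCommutativeRing _ _
ℚ-ring = fromCommutativeRing ℚ.+-*-commutativeRing isZero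
  where
  isZero : ∀ x → Maybe (0ℚ ≡ x)
  isZero x with 0ℚ ℚ.≟ x
  ... | yes p = just p
  ... | no _  = nothing

0≤1 : 0ℚ ≤ᵠ 1ℚ
0≤1 = ℚ.nonNegative⁻¹ 1ℚ

0≤+ : ∀ {x y} → 0ℚ ≤ᵠ x → 0ℚ ≤ᵠ y → 0ℚ ≤ᵠ x + y
0≤+ 0≤x 0≤y = ℚ.+-mono-≤ 0≤x 0≤y

*-monoˡ : ∀ {x y z} → 0ℚ ≤ᵠ x → y ≤ᵠ z → x * y ≤ᵠ x * z
*-monoˡ {x} 0≤x = ℚ.*-monoˡ-≤-nonNeg x {{ℚ.nonNegative 0≤x}}

*-monoʳ : ∀ {x y z} → 0ℚ ≤ᵠ x → y ≤ᵠ z → y * x ≤ᵠ z * x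
*-monoʳ {x} 0≤x = ℚ.*-monoʳ-≤-nonNeg x {{ℚ.nonNegative 0≤x}}

*-mono : ∀ {a b c d} → 0ℚ ≤ᵠ a → 0ℚ ≤ᵠ d → a ≤ᵠ b → c ≤ᵠ d → a * c ≤ᵠ b * d
*-mono 0≤a 0≤d a≤b c≤d = ℚ.≤-trans (*-monoˡ 0≤a c≤d) (*-monoʳ 0≤d a≤b)

0≤* : ∀ {x y} → 0ℚ ≤ᵠ x → 0ℚ ≤ᵠ y → 0ℚ ≤ᵠ x * y
0≤* {x} {y} 0≤x 0≤y = subst (_≤ᵠ x * y) (ℚ.*-zeroʳ x) (*-monoˡ 0≤x 0≤y)

0≤∸ : ∀ {x y} → x ≤ᵠ y → 0ℚ ≤ᵠ y - x
0≤∸ {x} {y} x≤y = subst (_≤ᵠ y - x) (ℚ.+-inverseʳ x) (ℚ.+-monoˡ-≤ (- x) x≤y)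

-- Proof by certificate: `d` is a difference that is visibly nonnegative, and the equation is left
-- to the ring solver. Most estimates below take this form.
≤-by : ∀ {x y} d → 0ℚ ≤ᵠ d → x + d ≡ y → x ≤ᵠ y
≤-by {x} d 0≤d refl = subst (_≤ᵠ x + d) (ℚ.+-identityʳ x) (ℚ.+-monoʳ-≤ x 0≤d)

^-nonneg : ∀ {x} n → 0ℚ ≤ᵠ x → 0ℚ ≤ᵠ x ^ n
^-nonneg zero    _   = 0≤1
^-nonneg (suc n) 0≤x = 0≤* 0≤x (^-nonneg n 0≤x)

^-mono : ∀ {x y} n → 0ℚ ≤ᵠ x → x ≤ᵠ y → x ^ n ≤ᵠ y ^ n
^-mono zero    _   _   = ℚ.≤-refl
^-mono (suc n) 0≤x x≤y = *-mono 0≤x (^-nonneg n (ℚ.≤-trans 0≤x x≤y)) x≤y (^-mono n 0≤x x≤y)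

1^ : ∀ n → 1ℚ ^ n ≡ 1ℚ
1^ zero    = refl
1^ (suc n) = trans (ℚ.*-identityˡ _) (1^ n)

⟦_⟧ : ℕ → ℚ
⟦ n ⟧ = + n / 1

private
  toℚᵘ-/ : ∀ a b .{{_ : NonZero b}} → ℚ.toℚᵘ (+ a / b) ℚᵘ.≃ (+ a ℚᵘ./ b)
  toℚᵘ-/ a (suc b) = ℚ.toℚᵘ-fromℚᵘ (ℚᵘ.mkℚᵘ (+ a) b)

⟦⟧-+ : ∀ a b → ⟦ a ℕ.+ b ⟧ ≡ ⟦ a ⟧ + ⟦ b ⟧
⟦⟧-+ a b = ℚ.toℚᵘ-injective (begin
  ℚ.toℚᵘ ⟦ a ℕ.+ b ⟧               ≈⟨ toℚᵘ-/ (a ℕ.+ b) 1 ⟩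
  + (a ℕ.+ b) ℚᵘ./ 1               ≈⟨ ℚᵘ.*≡* (cong (ℤ._* + 1) (sym (cong₂ ℤ._+_ (ℤ.*-identityʳ (+ a)) (ℤ.*-identityʳ (+ b))))) ⟩
  (+ a ℚᵘ./ 1) ℚᵘ.+ (+ b ℚᵘ./ 1)   ≈⟨ ℚᵘ.+-cong (toℚᵘ-/ a 1) (toℚᵘ-/ b 1) ⟨
  ℚ.toℚᵘ ⟦ a ⟧ ℚᵘ.+ ℚ.toℚᵘ ⟦ b ⟧   ≈⟨ ℚ.toℚᵘ-homo-+ ⟦ a ⟧ ⟦ b ⟧ ⟨
  ℚ.toℚᵘ (⟦ a ⟧ + ⟦ b ⟧)           ∎)
  where open import Relation.Binary.Reasoning.Setoid ℚᵘ.≃-setoid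

⟦⟧-* : ∀ a b → ⟦ a ℕ.* b ⟧ ≡ ⟦ a ⟧ * ⟦ b ⟧
⟦⟧-* a b = ℚ.toℚᵘ-injective (begin
  ℚ.toℚᵘ ⟦ a ℕ.* b ⟧               ≈⟨ toℚᵘ-/ (a ℕ.* b) 1 ⟩
  + (a ℕ.* b) ℚᵘ./ 1               ≈⟨ ℚᵘ.*≡* (cong (ℤ._* + 1) (ℤ.pos-* a b)) ⟩
  (+ a ℚᵘ./ 1) ℚᵘ.* (+ b ℚᵘ./ 1)   ≈⟨ ℚᵘ.*-cong (toℚᵘ-/ a 1) (toℚᵘ-/ b 1) ⟨
  ℚ.toℚᵘ ⟦ a ⟧ ℚᵘ.* ℚ.toℚᵘ ⟦ b ⟧   ≈⟨ ℚ.toℚᵘ-homo-* ⟦ a ⟧ ⟦ b ⟧ ⟨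
  ℚ.toℚᵘ (⟦ a ⟧ * ⟦ b ⟧)           ∎)
  where open import Relation.Binary.Reasoning.Setoid ℚᵘ.≃-setoid

⟦⟧-suc : ∀ n → ⟦ suc n ⟧ ≡ 1ℚ + ⟦ n ⟧
⟦⟧-suc n = ⟦⟧-+ 1 n

0≤⟦_⟧ : ∀ n → 0ℚ ≤ᵠ ⟦ n ⟧
0≤⟦ n ⟧ = ℚ.nonNegative⁻¹ ⟦ n ⟧ {{ℚ.normalize-nonNeg n 1}}

⟦⟧-mono : ∀ {a b} → a ≤ b → ⟦ a ⟧ ≤ᵠ ⟦ b ⟧
⟦⟧-mono {a} {b} a≤b = ≤-by ⟦ b ℕ.∸ a ⟧ 0≤⟦ b ℕ.∸ a ⟧
  (trans (sym (⟦⟧-+ a (b ℕ.∸ a))) (cong ⟦_⟧ (ℕ.m+[n∸m]≡n a≤b)))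

0<⟦_⟧ : ∀ n .{{_ : NonZero n}} → 0ℚ <ᵠ ⟦ n ⟧
0<⟦ n ⟧ = ℚ.positive⁻¹ ⟦ n ⟧ {{ℚ.normalize-pos n 1}}

1≤⟦_⟧ : ∀ n .{{_ : NonZero n}} → 1ℚ ≤ᵠ ⟦ n ⟧
1≤⟦ n ⟧ = ⟦⟧-mono (ℕ.>-nonZero⁻¹ n)

/-*-cancel : ∀ a b .{{_ : NonZero b}} → (+ a / b) * ⟦ b ⟧ ≡ ⟦ a ⟧
/-*-cancel a b@(suc _) = ℚ.toℚᵘ-injective (begin
  ℚ.toℚᵘ ((+ a / b) * ⟦ b ⟧)             ≈⟨ ℚ.toℚᵘ-homo-* (+ a / b) ⟦ b ⟧ ⟩
  ℚ.toℚᵘ (+ a / b) ℚᵘ.* ℚ.toℚᵘ ⟦ b ⟧     ≈⟨ ℚᵘ.*-cong (toℚᵘ-/ a b) (toℚᵘ-/ b 1) ⟩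
  (+ a ℚᵘ./ b) ℚᵘ.* (+ b ℚᵘ./ 1)         ≈⟨ ℚᵘ.*≡* (trans (ℤ.*-identityʳ _) (cong (+ a ℤ.*_) (cong +_ (sym (ℕ.*-identityʳ b))))) ⟩
  + a ℚᵘ./ 1                             ≈⟨ toℚᵘ-/ a 1 ⟨
  ℚ.toℚᵘ ⟦ a ⟧                           ∎)
  where open import Relation.Binary.Reasoning.Setoid ℚᵘ.≃-setoid

0≤/ : ∀ a b .{{_ : NonZero b}} → 0ℚ ≤ᵠ + a / b
0≤/ a b = ℚ.nonNegative⁻¹ (+ a / b) {{ℚ.normalize-nonNeg a b}}

*-cancelʳ : ∀ {x y z} → 0ℚ <ᵠ z → x * z ≤ᵠ y * z → x ≤ᵠ y
*-cancelʳ {z = z} 0<z = ℚ.*-cancelʳ-≤-pos z {{ℚ.positive 0<z}}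

*-cancelʳ-≡ : ∀ {x y z} → 0ℚ <ᵠ z → x * z ≡ y * z → x ≡ y
*-cancelʳ-≡ 0<z eq = ℚ.≤-antisym (*-cancelʳ 0<z (ℚ.≤-reflexive eq)) (*-cancelʳ 0<z (ℚ.≤-reflexive (sym eq)))

-- Exponential bounds

Σ⁺ : List ℚ → ℚ
Σ⁺ []       = 0ℚ
Σ⁺ (x ∷ xs) = x + Σ⁺ xs

Π⁺ Π⁻ : List ℚ → ℚ
Π⁺ []       = 1ℚ
Π⁺ (b ∷ bs) = (1ℚ + b) * Π⁺ bs
Π⁻ []       = 1ℚ
Π⁻ (a ∷ as) = (1ℚ - a) * Π⁻ as

NonNeg Unit : ℚ → Set
NonNeg x = 0ℚ ≤ᵠ x
Unit x   = 0ℚ ≤ᵠ x × x ≤ᵠ 1ℚ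

Σ⁺-nonneg : ∀ {xs} → All NonNeg xs → 0ℚ ≤ᵠ Σ⁺ xs
Σ⁺-nonneg []       = ℚ.≤-refl
Σ⁺-nonneg (p ∷ ps) = 0≤+ p (Σ⁺-nonneg ps)

Π⁺-nonneg : ∀ {xs} → All NonNeg xs → 0ℚ ≤ᵠ Π⁺ xs
Π⁺-nonneg []       = 0≤1
Π⁺-nonneg (p ∷ ps) = 0≤* (0≤+ 0≤1 p) (Π⁺-nonneg ps)

Π⁻-unit : ∀ {xs} → All Unit xs → Unit (Π⁻ xs)
Π⁻-unit []                   = 0≤1 , ℚ.≤-refl
Π⁻-unit {x ∷ xs} ((0≤x , x≤1) ∷ ps) with Π⁻-unit ps
... | 0≤P , P≤1 = 0≤* (0≤∸ x≤1) 0≤P ,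
  ≤-by (x * Π⁻ xs + (1ℚ - Π⁻ xs)) (0≤+ (0≤* 0≤x 0≤P) (0≤∸ P≤1)) (go x (Π⁻ xs))
  where
  go : ∀ x P → (1ℚ - x) * P + (x * P + (1ℚ - P)) ≡ 1ℚ
  go = solve-∀ ℚ-ring

-- Both cases merge one factor 1 - a with one factor 1 + b, using
-- (1 - a)(1 + b) ≤ 1 + (b - a).
Π⁻Π⁺≤1 : ∀ {a} as bs → Unit a → All Unit as → All NonNeg bs → Σ⁺ bs ≤ᵠ a + Σ⁺ as →
         (1ℚ - a) * Π⁻ as * Π⁺ bs ≤ᵠ 1ℚ
Π⁻Π⁺≤1 {a} as [] ua uas [] _ =
  subst (_≤ᵠ 1ℚ) (sym (ℚ.*-identityʳ _)) (proj₂ (Π⁻-unit (ua ∷ uas)))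
Π⁻Π⁺≤1 {a} as (b ∷ bs) ua uas (0≤b ∷ pbs) le with ℚ.≤-total b a
Π⁻Π⁺≤1 {a} as (b ∷ bs) (0≤a , a≤1) uas (0≤b ∷ pbs) le | inj₁ b≤a =
  ℚ.≤-trans
    (≤-by (a * b * (Π⁻ as * Π⁺ bs)) (0≤* (0≤* 0≤a 0≤b) (0≤* (proj₁ (Π⁻-unit uas)) (Π⁺-nonneg pbs)))
      (lem a b (Π⁻ as) (Π⁺ bs)))
    (Π⁻Π⁺≤1 {a - b} as bs (0≤∸ b≤a , ℚ.≤-trans (≤-by b 0≤b (e₁ a b)) a≤1) uas pbs
      (≤-by (a + Σ⁺ as - (b + Σ⁺ bs)) (0≤∸ le) (e₂ a b (Σ⁺ as) (Σ⁺ bs))))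
  where
  lem : ∀ a b p q → (1ℚ - a) * p * ((1ℚ + b) * q) + a * b * (p * q) ≡ (1ℚ - (a - b)) * p * q
  lem = solve-∀ ℚ-ring
  e₁ : ∀ a b → (a - b) + b ≡ a
  e₁ = solve-∀ ℚ-ring
  e₂ : ∀ a b s t → t + (a + s - (b + t)) ≡ a - b + s
  e₂ = solve-∀ ℚ-ring
-- With no further fall the hypothesis also forces `b ≤ a`, so the merged factor 1 + (b - a) is at
-- most 1 and is replaced by a fall of 0.
Π⁻Π⁺≤1 {a} [] (b ∷ bs) ua@(0≤a , a≤1) [] (0≤b ∷ pbs) le | inj₂ a≤b =
  ℚ.≤-trans
    (≤-by (a * b * Π⁺ bs) (0≤* (0≤* 0≤a 0≤b) (Π⁺-nonneg pbs)) (lem a b (Π⁺ bs)))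
    (ℚ.≤-trans (*-monoʳ (Π⁺-nonneg pbs) (*-monoʳ 0≤1 (≤-by {1ℚ + b - a} (a - b) (0≤∸ b≤a) (e₂ a b))))
      (Π⁻Π⁺≤1 {0ℚ} [] bs (ℚ.≤-refl , 0≤1) [] pbs
        (≤-by (b - a + (a + 0ℚ - (b + Σ⁺ bs))) (0≤+ (0≤∸ a≤b) (0≤∸ le)) (e₁ a b (Σ⁺ bs)))))
  where
  b≤a : b ≤ᵠ a
  b≤a = ≤-by (a + 0ℚ - (b + Σ⁺ bs) + Σ⁺ bs) (0≤+ (0≤∸ le) (Σ⁺-nonneg pbs)) (e₀ a b (Σ⁺ bs))
    where
    e₀ : ∀ a b t → b + (a + 0ℚ - (b + t) + t) ≡ a
    e₀ = solve-∀ ℚ-ring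
  lem : ∀ a b q → (1ℚ - a) * 1ℚ * ((1ℚ + b) * q) + a * b * q ≡ (1ℚ + b - a) * 1ℚ * q
  lem = solve-∀ ℚ-ring
  e₁ : ∀ a b t → t + (b - a + (a + 0ℚ - (b + t))) ≡ 0ℚ + 0ℚ
  e₁ = solve-∀ ℚ-ring
  e₂ : ∀ a b → (1ℚ + b - a) + (a - b) ≡ 1ℚ - 0ℚ
  e₂ = solve-∀ ℚ-ring
Π⁻Π⁺≤1 {a} (a′ ∷ as) (b ∷ bs) (0≤a , a≤1) (ua′ ∷ uas) (0≤b ∷ pbs) le | inj₂ a≤b =
  ℚ.≤-trans
    (≤-by (a * b * ((1ℚ - a′) * Π⁻ as * Π⁺ bs))
      (0≤* (0≤* 0≤a 0≤b) (0≤* (proj₁ (Π⁻-unit (ua′ ∷ uas))) (Π⁺-nonneg pbs)))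
      (lem a b ((1ℚ - a′)) (Π⁻ as) (Π⁺ bs)))
    (Π⁻Π⁺≤1 {a′} as ((b - a) ∷ bs) ua′ uas (0≤∸ a≤b ∷ pbs)
      (≤-by (a + (a′ + Σ⁺ as) - (b + Σ⁺ bs)) (0≤∸ le) (e a b a′ (Σ⁺ as) (Σ⁺ bs))))
  where
  lem : ∀ a b c p q → (1ℚ - a) * (c * p) * ((1ℚ + b) * q) + a * b * (c * p * q)
                    ≡ c * p * ((1ℚ + (b - a)) * q)
  lem = solve-∀ ℚ-ring
  e : ∀ a b c s t → (b - a + t) + (a + (c + s) - (b + t)) ≡ c + s
  e = solve-∀ ℚ-ring

-- P ≤exp s expresses P ≤ eˢ for P ≥ 0 without mentioning the exponential: it
-- records factors 1 + t ≤ eᵗ, with exponents t summing to at most s, whose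
-- product dominates P.
record _≤exp_ (P s : ℚ) : Set where
  constructor mk≤exp
  field
    falls rises : List ℚ
    unit        : All Unit falls
    nonneg      : All NonNeg rises
    0≤P         : 0ℚ ≤ᵠ P
    bound       : P ≤ᵠ Π⁻ falls * Π⁺ rises
    exponent    : Σ⁺ rises - Σ⁺ falls ≤ᵠ s

infix 4 _≤exp_

-- Every use of an `≤exp` bound ends here: all factors of an estimate are gathered into one product
-- whose total exponent is at most 0. The extra fall 0 supplies the head that `Π⁻Π⁺≤1` expects.
≤exp⇒≤1 : ∀ {P s} → P ≤exp s → s ≤ᵠ 0ℚ → P ≤ᵠ 1ℚ
≤exp⇒≤1 (mk≤exp as bs uas pbs _ P≤ s≥) s≤0 = ℚ.≤-trans P≤
  (subst (_≤ᵠ 1ℚ) (e (Π⁻ as) (Π⁺ bs)) (Π⁻Π⁺≤1 as bs (ℚ.≤-refl , 0≤1) uas pbs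
    (≤-by (0ℚ - (Σ⁺ bs - Σ⁺ as)) (0≤∸ (ℚ.≤-trans s≥ s≤0)) (e′ (Σ⁺ as) (Σ⁺ bs)))))
  where
  e : ∀ p q → (1ℚ - 0ℚ) * p * q ≡ p * q
  e = solve-∀ ℚ-ring
  e′ : ∀ s t → t + (0ℚ - (t - s)) ≡ 0ℚ + s
  e′ = solve-∀ ℚ-ring

≤exp-mono : ∀ {P Q s t} → 0ℚ ≤ᵠ P → P ≤ᵠ Q → s ≤ᵠ t → Q ≤exp s → P ≤exp t
≤exp-mono 0≤P P≤Q s≤t (mk≤exp as bs uas pbs _ Q≤ ≤s) =
  mk≤exp as bs uas pbs 0≤P (ℚ.≤-trans P≤Q Q≤) (ℚ.≤-trans ≤s s≤t)

≤exp-resp : ∀ {P Q s t} → P ≡ Q → s ≡ t → P ≤exp s → Q ≤exp t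
≤exp-resp refl refl h = h

1≤exp0 : 1ℚ ≤exp 0ℚ
1≤exp0 = mk≤exp [] [] [] [] 0≤1 ℚ.≤-refl ℚ.≤-refl

1+t≤exp : ∀ {t} → 0ℚ ≤ᵠ 1ℚ + t → 1ℚ + t ≤exp t
1+t≤exp {t} h with ℚ.≤-total 0ℚ t
... | inj₁ 0≤t = mk≤exp [] (t ∷ []) [] (0≤t ∷ []) h (ℚ.≤-reflexive (e t)) (ℚ.≤-reflexive (e′ t))
  where
  e : ∀ t → 1ℚ + t ≡ 1ℚ * ((1ℚ + t) * 1ℚ)
  e = solve-∀ ℚ-ring
  e′ : ∀ t → t + 0ℚ - 0ℚ ≡ t
  e′ = solve-∀ ℚ-ring
... | inj₂ t≤0 = mk≤exp (- t ∷ []) [] ((ℚ.neg-antimono-≤ t≤0 , ≤-by (1ℚ + t) h (e″ t)) ∷ []) [] h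
        (ℚ.≤-reflexive (e t)) (ℚ.≤-reflexive (e′ t))
  where
  e : ∀ t → 1ℚ + t ≡ (1ℚ - - t) * 1ℚ * 1ℚ
  e = solve-∀ ℚ-ring
  e′ : ∀ t → 0ℚ - (- t + 0ℚ) ≡ t
  e′ = solve-∀ ℚ-ring
  e″ : ∀ t → - t + (1ℚ + t) ≡ 1ℚ
  e″ = solve-∀ ℚ-ring

private
  Σ⁺-++ : ∀ xs ys → Σ⁺ (xs ++ ys) ≡ Σ⁺ xs + Σ⁺ ys
  Σ⁺-++ []       ys = sym (ℚ.+-identityˡ _)
  Σ⁺-++ (x ∷ xs) ys = trans (cong (λ z → x + z) (Σ⁺-++ xs ys)) (sym (ℚ.+-assoc x _ _))

  Π⁺-++ : ∀ xs ys → Π⁺ (xs ++ ys) ≡ Π⁺ xs * Π⁺ ys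
  Π⁺-++ []       ys = sym (ℚ.*-identityˡ _)
  Π⁺-++ (x ∷ xs) ys = trans (cong ((1ℚ + x) *_) (Π⁺-++ xs ys)) (sym (ℚ.*-assoc (1ℚ + x) _ _))

  Π⁻-++ : ∀ xs ys → Π⁻ (xs ++ ys) ≡ Π⁻ xs * Π⁻ ys
  Π⁻-++ []       ys = sym (ℚ.*-identityˡ _)
  Π⁻-++ (x ∷ xs) ys = trans (cong ((1ℚ - x) *_) (Π⁻-++ xs ys)) (sym (ℚ.*-assoc (1ℚ - x) _ _))

≤exp-* : ∀ {P Q s t} → P ≤exp s → Q ≤exp t → P * Q ≤exp s + t
≤exp-* {P} {Q} {s} {t} (mk≤exp as bs uas pbs 0≤P P≤ ≤s) (mk≤exp cs ds ucs pds 0≤Q Q≤ ≤t) =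
  mk≤exp (as ++ cs) (bs ++ ds) (All.++⁺ uas ucs) (All.++⁺ pbs pds) (0≤* 0≤P 0≤Q)
    (subst (P * Q ≤ᵠ_)
      (trans (e (Π⁻ as) (Π⁺ bs) (Π⁻ cs) (Π⁺ ds)) (sym (cong₂ _*_ (Π⁻-++ as cs) (Π⁺-++ bs ds))))
      (*-mono 0≤P (0≤* (proj₁ (Π⁻-unit ucs)) (Π⁺-nonneg pds)) P≤ Q≤))
    (subst (_≤ᵠ s + t)
      (trans (e′ (Σ⁺ as) (Σ⁺ bs) (Σ⁺ cs) (Σ⁺ ds)) (sym (cong₂ _-_ (Σ⁺-++ bs ds) (Σ⁺-++ as cs))))
      (ℚ.+-mono-≤ ≤s ≤t))
  where
  e : ∀ a b c d → a * b * (c * d) ≡ a * c * (b * d)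
  e = solve-∀ ℚ-ring
  e′ : ∀ a b c d → (b - a) + (d - c) ≡ (b + d) - (a + c)
  e′ = solve-∀ ℚ-ring

≤exp-^ : ∀ {P s} m → P ≤exp s → P ^ m ≤exp ⟦ m ⟧ * s
≤exp-^ {s = s} zero    h = ≤exp-resp refl (sym (ℚ.*-zeroˡ s)) 1≤exp0
≤exp-^ {s = s} (suc m) h = ≤exp-resp refl
  (sym (trans (cong (_* s) (⟦⟧-suc m)) (e s ⟦ m ⟧))) (≤exp-* h (≤exp-^ m h))
  where
  e : ∀ s k → (1ℚ + k) * s ≡ s + k * s
  e = solve-∀ ℚ-ring

-- Harmonic numbers and the logarithm

r : ℕ → ℚ
r k = + 1 / suc k

r-* : ∀ k → r k * ⟦ suc k ⟧ ≡ 1ℚ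
r-* k = /-*-cancel 1 (suc k)

0≤r : ∀ k → 0ℚ ≤ᵠ r k
0≤r k = 0≤/ 1 (suc k)

r≤ : ∀ {x} k → 1ℚ ≤ᵠ x * ⟦ suc k ⟧ → r k ≤ᵠ x
r≤ {x} k h = *-cancelʳ 0<⟦ suc k ⟧ (subst (_≤ᵠ x * ⟦ suc k ⟧) (sym (r-* k)) h)

≤r : ∀ {x} k → x * ⟦ suc k ⟧ ≤ᵠ 1ℚ → x ≤ᵠ r k
≤r {x} k h = *-cancelʳ 0<⟦ suc k ⟧ (subst (x * ⟦ suc k ⟧ ≤ᵠ_) (sym (r-* k)) h)

r≤1 : ∀ k → r k ≤ᵠ 1ℚ
r≤1 k = r≤ k (subst (1ℚ ≤ᵠ_) (sym (ℚ.*-identityˡ _)) (1≤⟦ suc k ⟧))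

r-*-cancel : ∀ c d → (r c * r d) * (⟦ suc c ⟧ * ⟦ suc d ⟧) ≡ 1ℚ
r-*-cancel c d = trans (e (r c) (r d) ⟦ suc c ⟧ ⟦ suc d ⟧) (cong₂ _*_ (r-* c) (r-* d))
  where
  e : ∀ a b c d → a * b * (c * d) ≡ a * c * (b * d)
  e = solve-∀ ℚ-ring

r≤r*r : ∀ b c d → suc c ℕ.* suc d ≤ suc b → r b ≤ᵠ r c * r d
r≤r*r b c d h = r≤ b (subst (_≤ᵠ r c * r d * ⟦ suc b ⟧) (trans (cong ((r c * r d) *_) (⟦⟧-* (suc c) (suc d))) (r-*-cancel c d))
  (*-monoˡ (0≤* (0≤r c) (0≤r d)) (⟦⟧-mono h)))

r*r≤r : ∀ b c d → suc b ≤ suc c ℕ.* suc d → r c * r d ≤ᵠ r b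
r*r≤r b c d h = ≤r b (subst (r c * r d * ⟦ suc b ⟧ ≤ᵠ_) (trans (cong ((r c * r d) *_) (⟦⟧-* (suc c) (suc d))) (r-*-cancel c d))
  (*-monoˡ (0≤* (0≤r c) (0≤r d)) (⟦⟧-mono h)))

sumℚ-+ : ∀ a b f → sumℚ (a ℕ.+ b) f ≡ sumℚ a f + sumℚ b (λ j → f (a ℕ.+ j))
sumℚ-+ a zero    f = trans (cong (λ k → sumℚ k f) (ℕ.+-identityʳ a)) (sym (ℚ.+-identityʳ _))
sumℚ-+ a (suc b) f = trans (cong (λ k → sumℚ k f) (ℕ.+-suc a b))
  (trans (cong (_+ f (a ℕ.+ b)) (sumℚ-+ a b f)) (ℚ.+-assoc (sumℚ a f) _ (f (a ℕ.+ b))))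

sumℚ≤ : ∀ k f {x} → (∀ j → j ℕ.< k → f j ≤ᵠ x) → sumℚ k f ≤ᵠ ⟦ k ⟧ * x
sumℚ≤ zero    f {x} h = ℚ.≤-reflexive (sym (ℚ.*-zeroˡ x))
sumℚ≤ (suc k) f {x} h = subst (sumℚ (suc k) f ≤ᵠ_)
  (trans (e ⟦ k ⟧ x) (cong (_* x) (sym (⟦⟧-suc k))))
  (ℚ.+-mono-≤ (sumℚ≤ k f (λ j j<k → h j (ℕ.m<n⇒m<1+n j<k))) (h k ℕ.≤-refl))
  where
  e : ∀ k x → k * x + x ≡ (1ℚ + k) * x
  e = solve-∀ ℚ-ring

≤sumℚ : ∀ k f {x} → (∀ j → j ℕ.< k → x ≤ᵠ f j) → ⟦ k ⟧ * x ≤ᵠ sumℚ k f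
≤sumℚ zero    f {x} h = ℚ.≤-reflexive (ℚ.*-zeroˡ x)
≤sumℚ (suc k) f {x} h = subst (_≤ᵠ sumℚ (suc k) f)
  (trans (e ⟦ k ⟧ x) (cong (_* x) (sym (⟦⟧-suc k))))
  (ℚ.+-mono-≤ (≤sumℚ k f (λ j j<k → h j (ℕ.m<n⇒m<1+n j<k))) (h k ℕ.≤-refl))
  where
  e : ∀ k x → k * x + x ≡ (1ℚ + k) * x
  e = solve-∀ ℚ-ring

H : ℕ → ℚ
H k = sumℚ k r

0≤H : ∀ n → 0ℚ ≤ᵠ H n
0≤H zero    = ℚ.≤-refl
0≤H (suc n) = 0≤+ (0≤H n) (0≤r n)

H-mono-+ : ∀ k d → H k ≤ᵠ H (k ℕ.+ d)
H-mono-+ k zero    = ℚ.≤-reflexive (cong H (sym (ℕ.+-identityʳ k)))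
H-mono-+ k (suc d) = subst (λ m → H k ≤ᵠ H m) (sym (ℕ.+-suc k d))
  (ℚ.≤-trans (H-mono-+ k d) (≤-by (r (k ℕ.+ d)) (0≤r (k ℕ.+ d)) refl))

H-mono : ∀ {k n} → k ≤ n → H k ≤ᵠ H n
H-mono {k} {n} k≤n = subst (λ m → H k ≤ᵠ H m) (ℕ.m+[n∸m]≡n k≤n) (H-mono-+ k (n ℕ.∸ k))

H≤ : ∀ n → H n ≤ᵠ ⟦ n ⟧
H≤ n = subst (H n ≤ᵠ_) (ℚ.*-identityʳ _) (sumℚ≤ n r (λ j _ → r≤1 j))

module _ (i : ℕ) where
  private
    N = suc i
    f : ℕ → ℚ
    f j = + 1 / suc (N ℕ.+ j)

    r-scale : ∀ q → ⟦ N ⟧ * (r i * r q) ≡ r q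
    r-scale q = trans (e ⟦ N ⟧ (r i) (r q)) (trans (cong (_* r q) (r-* i)) (ℚ.*-identityˡ _))
      where
      e : ∀ a b c → a * (b * c) ≡ b * a * c
      e = solve-∀ ℚ-ring

    split : ∀ p → logRiemann (suc (suc p)) i ≡ logRiemann (suc p) i + sumℚ N (λ j → f (p ℕ.* N ℕ.+ j))
    split p = trans (cong (λ k → sumℚ k f) (ℕ.+-comm N (p ℕ.* N))) (sumℚ-+ (p ℕ.* N) N f)

    block≤ : ∀ p → sumℚ N (λ j → f (p ℕ.* N ℕ.+ j)) ≤ᵠ r p
    block≤ p = subst (sumℚ N (λ j → f (p ℕ.* N ℕ.+ j)) ≤ᵠ_) (r-scale p) (sumℚ≤ N (λ j → f (p ℕ.* N ℕ.+ j)) λ j _ → r≤r*r (N ℕ.+ (p ℕ.* N ℕ.+ j)) i p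
      (ℕ.≤-trans (ℕ.≤-trans (ℕ.≤-reflexive (solve′ p N)) (ℕ.m≤m+n (N ℕ.+ p ℕ.* N) j))
        (ℕ.≤-trans (ℕ.≤-reflexive (ℕ.+-assoc N _ j)) (ℕ.n≤1+n _))))
      where
      open +-*-Solver renaming (solve to solveℕ)
      solve′ : ∀ p N → N ℕ.* suc p ≡ N ℕ.+ p ℕ.* N
      solve′ = solveℕ 2 (λ p N → N :* (con 1 :+ p) := N :+ p :* N) refl

    ≤block : ∀ p → r (suc p) ≤ᵠ sumℚ N (λ j → f (p ℕ.* N ℕ.+ j))
    ≤block p = subst (_≤ᵠ sumℚ N (λ j → f (p ℕ.* N ℕ.+ j))) (r-scale (suc p)) (≤sumℚ N (λ j → f (p ℕ.* N ℕ.+ j)) λ j j<N → r*r≤r (N ℕ.+ (p ℕ.* N ℕ.+ j)) i (suc p)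
      (ℕ.≤-trans (ℕ.≤-reflexive (solve₁ p N j))
        (ℕ.≤-trans (ℕ.+-monoʳ-≤ (N ℕ.+ p ℕ.* N) j<N) (ℕ.≤-reflexive (solve₂ p N)))))
      where
      open +-*-Solver renaming (solve to solveℕ)
      solve₁ : ∀ p N j → suc (N ℕ.+ (p ℕ.* N ℕ.+ j)) ≡ N ℕ.+ p ℕ.* N ℕ.+ suc j
      solve₁ = solveℕ 3 (λ p N j → con 1 :+ (N :+ (p :* N :+ j)) := N :+ p :* N :+ (con 1 :+ j)) refl
      solve₂ : ∀ p N → N ℕ.+ p ℕ.* N ℕ.+ N ≡ N ℕ.* suc (suc p)
      solve₂ = solveℕ 2 (λ p N → N :+ p :* N :+ N := N :* (con 2 :+ p)) refl

  -- The sum splits into blocks of N terms, one for each unit interval, and the block over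
  -- [p + 1, p + 2] lies between 1/(p + 2) and 1/(p + 1). The comparison holds for every single
  -- Riemann sum, so no limit is taken.
  logRiemann≤H : ∀ p → logRiemann (suc p) i ≤ᵠ H p
  logRiemann≤H zero    = ℚ.≤-refl
  logRiemann≤H (suc p) = subst (_≤ᵠ H (suc p)) (sym (split p)) (ℚ.+-mono-≤ (logRiemann≤H p) (block≤ p))

  H≤logRiemann : ∀ p → H (suc p) ≤ᵠ 1ℚ + logRiemann (suc p) i
  H≤logRiemann zero    = ℚ.≤-refl
  H≤logRiemann (suc p) = subst (H (suc (suc p)) ≤ᵠ_)
    (trans (ℚ.+-assoc 1ℚ (logRiemann (suc p) i) _) (cong (λ z → 1ℚ + z) (sym (split p)))) (ℚ.+-mono-≤ (H≤logRiemann p) (≤block p))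

log≤H : ∀ n .{{_ : NonZero n}} i → seq (log n) i ≤ᵠ H n
log≤H (suc p) i = ℚ.≤-trans (logRiemann≤H i p) (H-mono (ℕ.n≤1+n p))

H≤log : ∀ n .{{_ : NonZero n}} i → H n ≤ᵠ 1ℚ + seq (log n) i
H≤log (suc p) i = H≤logRiemann i p

-- Each of the n - k terms beyond Hₖ is at most 1/k. For κ = k/n this gives κ (Hₙ - Hₖ) ≤ 1.
H-gap : ∀ {k n} → k ≤ n → ⟦ k ⟧ * (H n - H k) ≤ᵠ ⟦ n ⟧
H-gap {k} {n} k≤n = ℚ.≤-trans
  (subst (λ m → ⟦ k ⟧ * (H m - H k) ≤ᵠ ⟦ n ℕ.∸ k ⟧) (ℕ.m+[n∸m]≡n k≤n) (gap (n ℕ.∸ k)))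
  (⟦⟧-mono (ℕ.m∸n≤m n k))
  where
  term : ∀ d → ⟦ k ⟧ * r (k ℕ.+ d) ≤ᵠ 1ℚ
  term d = subst (⟦ k ⟧ * r (k ℕ.+ d) ≤ᵠ_) (trans (ℚ.*-comm _ (r (k ℕ.+ d))) (r-* (k ℕ.+ d)))
    (*-monoʳ (0≤r (k ℕ.+ d)) (⟦⟧-mono (ℕ.m≤n⇒m≤1+n (ℕ.m≤m+n k d))))
  gap : ∀ d → ⟦ k ⟧ * (H (k ℕ.+ d) - H k) ≤ᵠ ⟦ d ⟧
  gap zero    = ℚ.≤-reflexive (trans (cong (λ m → ⟦ k ⟧ * (H m - H k)) (ℕ.+-identityʳ k)) (e ⟦ k ⟧ (H k)))
    where
    e : ∀ k h → k * (h - h) ≡ 0ℚ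
    e = solve-∀ ℚ-ring
  gap (suc d) = subst₂ _≤ᵠ_
    (trans (e ⟦ k ⟧ (H (k ℕ.+ d)) (H k) (r (k ℕ.+ d))) (cong (λ m → ⟦ k ⟧ * (H m - H k)) (sym (ℕ.+-suc k d))))
    (sym (⟦⟧-suc d)) (ℚ.+-mono-≤ (term d) (gap d))
    where
    e : ∀ k h g r → k * r + k * (h - g) ≡ k * (h + r - g)
    e = solve-∀ ℚ-ring

-- The ratio (j + d + 1)/(j + 1) telescopes into the factors 1 + 1/(i + 1), j ≤ i < j + d, whose
-- exponents add up to the harmonic difference.
ratio≤exp : ∀ j d → ⟦ suc (j ℕ.+ d) ⟧ * r j ≤exp H (j ℕ.+ d) - H j
ratio≤exp j zero = ≤exp-resp
  (trans (sym (r-* j)) (trans (ℚ.*-comm (r j) _) (cong (λ k → ⟦ suc k ⟧ * r j) (sym (ℕ.+-identityʳ j)))))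
  (trans (sym (ℚ.+-inverseʳ (H j))) (cong (λ k → H k - H j) (sym (ℕ.+-identityʳ j)))) 1≤exp0
ratio≤exp j (suc d) = ≤exp-resp
  (trans (e₁ ⟦ suc k ⟧ (r j) (r k)) (cong (λ z → z * r j) (trans (cong (λ z → z + ⟦ suc k ⟧) (r-* k))
    (trans (sym (⟦⟧-suc (suc k))) (cong (λ m → ⟦ suc m ⟧) (sym (ℕ.+-suc j d)))))))
  (trans (e₂ (H k) (H j) (r k)) (cong (λ m → H m - H j) (sym (ℕ.+-suc j d))))
  (≤exp-* (ratio≤exp j d) (1+t≤exp (0≤+ 0≤1 (0≤r k))))
  where
  k = j ℕ.+ d
  e₁ : ∀ s r t → s * r * (1ℚ + t) ≡ (t * s + s) * r
  e₁ = solve-∀ ℚ-ring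
  e₂ : ∀ s r t → s - r + t ≡ s + t - r
  e₂ = solve-∀ ℚ-ring

-- With k = j + 1, `ratio≤exp` yields both harmonic numbers at an index one lower; the summand 1
-- covers this shift.
n/k≤exp : ∀ {j n} → suc j ≤ n → ⟦ n ⟧ * r j ≤exp 1ℚ + (H n - H (suc j))
n/k≤exp {j} {suc n} (s≤s j≤n) = ≤exp-mono (0≤* 0≤⟦ suc n ⟧ (0≤r j)) ℚ.≤-refl
  (≤-by (r n + (1ℚ - r j)) (0≤+ (0≤r n) (0≤∸ (r≤1 j))) (e (H n) (H j) (r n) (r j)))
  (subst (λ m → ⟦ suc m ⟧ * r j ≤exp H m - H j) (ℕ.m+[n∸m]≡n j≤n) (ratio≤exp j (n ℕ.∸ j)))
  where
  e : ∀ h g s t → h - g + (s + (1ℚ - t)) ≡ 1ℚ + (h + s - (g + t))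
  e = solve-∀ ℚ-ring

-- 1/(p + 1) is the product of the factors 1 - 1/(i + 1), 1 ≤ i ≤ p. The first harmonic term has no
-- factor of its own, whence the 1 in the exponent.
1/n≤exp : ∀ p → r p ≤exp 1ℚ - H (suc p)
1/n≤exp zero    = 1≤exp0
1/n≤exp (suc p) = ≤exp-resp
  (*-cancelʳ-≡ 0<⟦ suc (suc p) ⟧ (trans (e₁ (r p) (r (suc p)) ⟦ suc (suc p) ⟧)
    (trans (cong₂ (λ x y → r p * (x - y)) (⟦⟧-suc (suc p)) (r-* (suc p)))
    (trans (e₂ (r p) ⟦ suc p ⟧) (trans (r-* p) (sym (r-* (suc p))))))))
  (e₃ (H (suc p)) (r (suc p)))
  (≤exp-* (1/n≤exp p) (1+t≤exp (0≤∸ (r≤1 (suc p)))))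
  where
  e₁ : ∀ a b c → a * (1ℚ - b) * c ≡ a * (c - b * c)
  e₁ = solve-∀ ℚ-ring
  e₂ : ∀ a c → a * (1ℚ + c - 1ℚ) ≡ a * c
  e₂ = solve-∀ ℚ-ring
  e₃ : ∀ h t → 1ℚ - h - t ≡ 1ℚ - (h + t)
  e₃ = solve-∀ ℚ-ring

-- Compare the terms beyond the (2c)-th with 1/2c.
H-sublinear : ∀ c → ∃[ N ] (∀ n → N ≤ n → ⟦ c ⟧ * (H n + 1ℚ) ≤ᵠ ⟦ n ⟧)
H-sublinear c = 2 ℕ.* c ℕ.* suc (2 ℕ.* c) , bound
  where
  bound : ∀ n → 2 ℕ.* c ℕ.* suc (2 ℕ.* c) ≤ n → ⟦ c ⟧ * (H n + 1ℚ) ≤ᵠ ⟦ n ⟧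
  bound n h = *-cancelʳ {z = ⟦ 2 ⟧} 0<⟦ 2 ⟧ (≤-by d (0≤+ (0≤∸ gap) (0≤+ (0≤∸ Hk) (0≤∸ kk))) eq)
    where
    k = 2 ℕ.* c
    gap : ⟦ k ⟧ * (H n - H k) ≤ᵠ ⟦ n ⟧
    gap = H-gap (ℕ.≤-trans (ℕ.m≤m*n k (suc k)) h)
    Hk : ⟦ k ⟧ * H k ≤ᵠ ⟦ k ⟧ * ⟦ k ⟧
    Hk = *-monoˡ 0≤⟦ k ⟧ (H≤ k)
    kk : ⟦ k ⟧ * (1ℚ + ⟦ k ⟧) ≤ᵠ ⟦ n ⟧
    kk = subst (_≤ᵠ ⟦ n ⟧) (trans (⟦⟧-* k (suc k)) (cong (⟦ k ⟧ *_) (⟦⟧-suc k))) (⟦⟧-mono h)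
    d = (⟦ n ⟧ - ⟦ k ⟧ * (H n - H k)) + ((⟦ k ⟧ * ⟦ k ⟧ - ⟦ k ⟧ * H k) + (⟦ n ⟧ - ⟦ k ⟧ * (1ℚ + ⟦ k ⟧)))
    eq : ⟦ c ⟧ * (H n + 1ℚ) * ⟦ 2 ⟧ + d ≡ ⟦ n ⟧ * ⟦ 2 ⟧
    eq = trans (cong (λ z → ⟦ c ⟧ * (H n + 1ℚ) * ⟦ 2 ⟧ + ((⟦ n ⟧ - z * (H n - H k)) + ((z * z - z * H k) + (⟦ n ⟧ - z * (1ℚ + z)))))
           (⟦⟧-* 2 c)) (e ⟦ c ⟧ (H n) (H k) ⟦ n ⟧)
      where
      e : ∀ c h g n → c * (h + 1ℚ) * ⟦ 2 ⟧ + ((n - ⟦ 2 ⟧ * c * (h - g)) + ((⟦ 2 ⟧ * c * (⟦ 2 ⟧ * c) - ⟦ 2 ⟧ * c * g) + (n - ⟦ 2 ⟧ * c * (1ℚ + ⟦ 2 ⟧ * c)))) ≡ n * ⟦ 2 ⟧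
      e = solve-∀ ℚ-ring

-- Binomial coefficients

nC0≡1 : ∀ n → n C 0 ≡ 1
nC0≡1 n = trans (nCk≡nC[n∸k] {n = n} z≤n) (nCn≡1 n)

pascal : ∀ n k → ⟦ suc n C suc k ⟧ ≡ ⟦ n C k ⟧ + ⟦ n C suc k ⟧
pascal n k = trans (cong ⟦_⟧ (sym (nCk+nC[k+1]≡[n+1]C[k+1] n k))) (⟦⟧-+ (n C k) (n C suc k))

absorption : ∀ n k → ⟦ suc k ⟧ * ⟦ suc n C suc k ⟧ ≡ ⟦ suc n ⟧ * ⟦ n C k ⟧
absorption zero    zero    = refl
absorption zero    (suc k) = trans (ℚ.*-zeroʳ ⟦ suc (suc k) ⟧) (sym (ℚ.*-zeroʳ 1ℚ))
absorption (suc n) zero    = trans (ℚ.*-identityˡ _) (trans (cong ⟦_⟧ (nC1≡n (suc (suc n))))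
  (trans (sym (ℚ.*-identityʳ _)) (cong (λ z → ⟦ suc (suc n) ⟧ * ⟦ z ⟧) (sym (nC0≡1 (suc n))))))
absorption (suc n) (suc k) = begin
  ⟦ suc (suc k) ⟧ * ⟦ suc (suc n) C suc (suc k) ⟧
    ≡⟨ cong₂ _*_ (⟦⟧-suc (suc k)) (pascal (suc n) (suc k)) ⟩
  (1ℚ + ⟦ suc k ⟧) * (⟦ suc n C suc k ⟧ + ⟦ suc n C suc (suc k) ⟧)
    ≡⟨ e₁ ⟦ suc k ⟧ ⟦ suc n C suc k ⟧ ⟦ suc n C suc (suc k) ⟧ ⟩
  ⟦ suc n C suc k ⟧ + (⟦ suc k ⟧ * ⟦ suc n C suc k ⟧ + (1ℚ + ⟦ suc k ⟧) * ⟦ suc n C suc (suc k) ⟧)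
    ≡⟨ cong (λ z → ⟦ suc n C suc k ⟧ + z) (cong₂ _+_ (absorption n k)
         (trans (cong (_* ⟦ suc n C suc (suc k) ⟧) (sym (⟦⟧-suc (suc k)))) (absorption n (suc k)))) ⟩
  ⟦ suc n C suc k ⟧ + (⟦ suc n ⟧ * ⟦ n C k ⟧ + ⟦ suc n ⟧ * ⟦ n C suc k ⟧)
    ≡⟨ cong (λ z → ⟦ suc n C suc k ⟧ + z) (trans (e₂ ⟦ suc n ⟧ ⟦ n C k ⟧ ⟦ n C suc k ⟧) (cong (⟦ suc n ⟧ *_) (sym (pascal n k)))) ⟩
  ⟦ suc n C suc k ⟧ + ⟦ suc n ⟧ * ⟦ suc n C suc k ⟧
    ≡⟨ trans (e₃ ⟦ suc n ⟧ ⟦ suc n C suc k ⟧) (cong (_* ⟦ suc n C suc k ⟧) (sym (⟦⟧-suc (suc n)))) ⟩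
  ⟦ suc (suc n) ⟧ * ⟦ suc n C suc k ⟧ ∎
  where
  open ≡-Reasoning
  e₁ : ∀ k x y → (1ℚ + k) * (x + y) ≡ x + (k * x + (1ℚ + k) * y)
  e₁ = solve-∀ ℚ-ring
  e₂ : ∀ k x y → k * x + k * y ≡ k * (x + y)
  e₂ = solve-∀ ℚ-ring
  e₃ : ∀ k x → x + k * x ≡ (1ℚ + k) * x
  e₃ = solve-∀ ℚ-ring

-- In other words, a random x-set misses a given one of n + 1 nodes with probability 1 - x/(n + 1).
C-pred : ∀ n x → ⟦ n C x ⟧ * ⟦ suc n ⟧ ≡ (⟦ suc n ⟧ - ⟦ x ⟧) * ⟦ suc n C x ⟧
C-pred n zero = trans (cong (λ z → ⟦ z ⟧ * ⟦ suc n ⟧) (trans (nC0≡1 n) (sym (nC0≡1 (suc n)))))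
  (e ⟦ suc n C 0 ⟧ ⟦ suc n ⟧)
  where
  e : ∀ c n → c * n ≡ (n - 0ℚ) * c
  e = solve-∀ ℚ-ring
C-pred n (suc x) = begin
  ⟦ n C suc x ⟧ * ⟦ suc n ⟧                                     ≡⟨ e₁ ⟦ n C suc x ⟧ ⟦ n C x ⟧ ⟦ suc n ⟧ ⟩
  ⟦ suc n ⟧ * (⟦ n C x ⟧ + ⟦ n C suc x ⟧) - ⟦ suc n ⟧ * ⟦ n C x ⟧
    ≡⟨ cong₂ (λ y z → ⟦ suc n ⟧ * y - z) (sym (pascal n x)) (sym (absorption n x)) ⟩
  ⟦ suc n ⟧ * ⟦ suc n C suc x ⟧ - ⟦ suc x ⟧ * ⟦ suc n C suc x ⟧  ≡⟨ e₂ ⟦ suc n ⟧ ⟦ suc n C suc x ⟧ ⟦ suc x ⟧ ⟩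
  (⟦ suc n ⟧ - ⟦ suc x ⟧) * ⟦ suc n C suc x ⟧ ∎
  where
  open ≡-Reasoning
  e₁ : ∀ c d n → c * n ≡ n * (d + c) - n * d
  e₁ = solve-∀ ℚ-ring
  e₂ : ∀ n c x → n * c - x * c ≡ (n - x) * c
  e₂ = solve-∀ ℚ-ring

-- The left side is one term of the binomial expansion. The free `y` serves both kinds of cuts: y =
-- k/n leads to (en/k)^k, and y = 1 to 2ⁿ.
C*y^k≤[1+y]^n : ∀ {y} → 0ℚ ≤ᵠ y → ∀ n k → ⟦ n C k ⟧ * y ^ k ≤ᵠ (1ℚ + y) ^ n
C*y^k≤[1+y]^n {y} 0≤y n zero = subst (_≤ᵠ (1ℚ + y) ^ n) (cong (λ z → ⟦ z ⟧ * 1ℚ) (sym (nC0≡1 n)))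
  (subst (_≤ᵠ (1ℚ + y) ^ n) (1^ n) (^-mono n 0≤1 (≤-by y 0≤y refl)))
C*y^k≤[1+y]^n {y} 0≤y zero (suc k) = subst (_≤ᵠ 1ℚ) (sym (ℚ.*-zeroˡ (y * y ^ k))) 0≤1
C*y^k≤[1+y]^n {y} 0≤y (suc n) (suc k) = subst₂ _≤ᵠ_
  (trans (e₁ y ⟦ n C k ⟧ (y ^ k) ⟦ n C suc k ⟧) (cong (_* (y * y ^ k)) (sym (pascal n k))))
  (e₂ y ((1ℚ + y) ^ n))
  (ℚ.+-mono-≤ (*-monoˡ 0≤y (C*y^k≤[1+y]^n 0≤y n k)) (C*y^k≤[1+y]^n 0≤y n (suc k)))
  where
  e₁ : ∀ y c p d → y * (c * p) + d * (y * p) ≡ (c + d) * (y * p)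
  e₁ = solve-∀ ℚ-ring
  e₂ : ∀ y p → y * p + p ≡ (1ℚ + y) * p
  e₂ = solve-∀ ℚ-ring

-- Drawing x nodes without replacement stays in a set of density κ at most as often as drawing with
-- replacement. `absorption` peels off one draw, and κ ≤ 1 preserves the density hypothesis when
-- both sizes drop by one.
C-ratio≤ : ∀ {κ} → 0ℚ ≤ᵠ κ → κ ≤ᵠ 1ℚ → ∀ a n x → ⟦ a ⟧ ≤ᵠ κ * ⟦ n ⟧ → ⟦ a C x ⟧ ≤ᵠ κ ^ x * ⟦ n C x ⟧
C-ratio≤ {κ} 0≤κ κ≤1 a n zero _ = ℚ.≤-reflexive
  (trans (cong ⟦_⟧ (trans (nC0≡1 a) (sym (nC0≡1 n)))) (sym (ℚ.*-identityˡ _)))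
C-ratio≤ {κ} 0≤κ κ≤1 zero n (suc x) _ = 0≤* (^-nonneg (suc x) 0≤κ) 0≤⟦ n C suc x ⟧
C-ratio≤ {κ} 0≤κ κ≤1 (suc a) zero (suc x) h =
  contradiction (ℚ.<-≤-trans 0<⟦ suc a ⟧ (subst (⟦ suc a ⟧ ≤ᵠ_) (ℚ.*-zeroʳ κ) h)) (ℚ.<-irrefl refl)
C-ratio≤ {κ} 0≤κ κ≤1 (suc a) (suc n) (suc x) h = *-cancelʳ 0<⟦ suc x ⟧ (begin
  ⟦ suc a C suc x ⟧ * ⟦ suc x ⟧              ≡⟨ trans (ℚ.*-comm _ ⟦ suc x ⟧) (absorption a x) ⟩
  ⟦ suc a ⟧ * ⟦ a C x ⟧                      ≤⟨ *-mono 0≤⟦ suc a ⟧ (0≤* (^-nonneg x 0≤κ) 0≤⟦ n C x ⟧) h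
                                                  (C-ratio≤ 0≤κ κ≤1 a n x h′) ⟩
  κ * ⟦ suc n ⟧ * (κ ^ x * ⟦ n C x ⟧)        ≡⟨ e₁ κ ⟦ suc n ⟧ (κ ^ x) ⟦ n C x ⟧ ⟩
  κ * κ ^ x * (⟦ suc n ⟧ * ⟦ n C x ⟧)        ≡⟨ cong (κ * κ ^ x *_) (sym (absorption n x)) ⟩
  κ * κ ^ x * (⟦ suc x ⟧ * ⟦ suc n C suc x ⟧) ≡⟨ e₂ (κ * κ ^ x) ⟦ suc x ⟧ ⟦ suc n C suc x ⟧ ⟩
  κ * κ ^ x * ⟦ suc n C suc x ⟧ * ⟦ suc x ⟧  ∎)
  where
  open ℚ.≤-Reasoning
  e₁ : ∀ k n p c → k * n * (p * c) ≡ k * p * (n * c)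
  e₁ = solve-∀ ℚ-ring
  e₂ : ∀ a b c → a * (b * c) ≡ a * c * b
  e₂ = solve-∀ ℚ-ring
  e₃ : ∀ k a n → a + (k * (1ℚ + n) - (1ℚ + a) + (1ℚ - k)) ≡ k * n
  e₃ = solve-∀ ℚ-ring
  h′ : ⟦ a ⟧ ≤ᵠ κ * ⟦ n ⟧
  h′ = ≤-by (κ * (1ℚ + ⟦ n ⟧) - (1ℚ + ⟦ a ⟧) + (1ℚ - κ))
    (0≤+ (0≤∸ (subst₂ (λ u v → u ≤ᵠ κ * v) (⟦⟧-suc a) (⟦⟧-suc n) h)) (0≤∸ κ≤1))
    (e₃ κ ⟦ a ⟧ ⟦ n ⟧)

module _ {κ} (0≤κ : 0ℚ ≤ᵠ κ) (κ≤1 : κ ≤ᵠ 1ℚ) where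

  ⟦⟧-square-≥ : ∀ x → ⟦ x ⟧ ≤ᵠ ⟦ x ⟧ * ⟦ x ⟧
  ⟦⟧-square-≥ zero    = ℚ.≤-refl
  ⟦⟧-square-≥ x@(suc _) = subst (⟦ x ⟧ ≤ᵠ_) (⟦⟧-* x x) (⟦⟧-mono (ℕ.m≤m*n x x))

  -- The second-order Bonferroni bound with its pair term C(x,2) κ² doubled, which keeps the
  -- coefficients integral.
  bonferroni : ∀ x → (1ℚ - κ) ^ x ≤ᵠ 1ℚ - ⟦ x ⟧ * κ + (⟦ x ⟧ * ⟦ x ⟧ - ⟦ x ⟧) * (κ * κ)
  bonferroni zero    = ℚ.≤-reflexive (e κ)
    where
    e : ∀ k → 1ℚ ≡ 1ℚ - 0ℚ * k + (0ℚ * 0ℚ - 0ℚ) * (k * k)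
    e = solve-∀ ℚ-ring
  bonferroni (suc x) = ℚ.≤-trans (*-monoˡ (0≤∸ κ≤1) (bonferroni x))
    (subst (λ s → (1ℚ - κ) * (1ℚ - ⟦ x ⟧ * κ + (⟦ x ⟧ * ⟦ x ⟧ - ⟦ x ⟧) * (κ * κ)) ≤ᵠ 1ℚ - s * κ + (s * s - s) * (κ * κ)) (sym (⟦⟧-suc x))
      (≤-by (κ * (κ * κ) * (⟦ x ⟧ * ⟦ x ⟧ - ⟦ x ⟧) + ⟦ x ⟧ * (κ * κ))
        (0≤+ (0≤* (0≤* 0≤κ (0≤* 0≤κ 0≤κ)) (0≤∸ (⟦⟧-square-≥ x))) (0≤* 0≤⟦ x ⟧ (0≤* 0≤κ 0≤κ))) (e κ ⟦ x ⟧)))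
    where
    e : ∀ k x → (1ℚ - k) * (1ℚ - x * k + (x * x - x) * (k * k)) + (k * (k * k) * (x * x - x) + x * (k * k))
        ≡ 1ℚ - (1ℚ + x) * k + ((1ℚ + x) * (1ℚ + x) - (1ℚ + x)) * (k * k)
    e = solve-∀ ℚ-ring

  [1-κ]^x≤ : ∀ x → (1ℚ - κ) ^ x ≤ᵠ 1ℚ - (⟦ x ⟧ * κ - ⟦ x ⟧ * ⟦ x ⟧ * (κ * κ))
  [1-κ]^x≤ x = ℚ.≤-trans (bonferroni x)
    (≤-by (⟦ x ⟧ * (κ * κ)) (0≤* 0≤⟦ x ⟧ (0≤* 0≤κ 0≤κ)) (e κ ⟦ x ⟧))
    where
    e : ∀ k x → 1ℚ - x * k + (x * x - x) * (k * k) + x * (k * k) ≡ 1ℚ - (x * k - x * x * (k * k))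
    e = solve-∀ ℚ-ring

  κ^x≤κ² : ∀ x → κ ^ suc (suc x) ≤ᵠ κ * κ
  κ^x≤κ² x = *-monoˡ 0≤κ (subst (κ * κ ^ x ≤ᵠ_) (ℚ.*-identityʳ κ) (*-monoˡ 0≤κ
    (subst (κ ^ x ≤ᵠ_) (1^ x) (^-mono x 0≤κ κ≤1))))

  [1-κ]^x≤[1-κ]² : ∀ x → (1ℚ - κ) ^ suc (suc x) ≤ᵠ (1ℚ - κ) * (1ℚ - κ)
  [1-κ]^x≤[1-κ]² x = *-monoˡ (0≤∸ κ≤1) (subst ((1ℚ - κ) * (1ℚ - κ) ^ x ≤ᵠ_) (ℚ.*-identityʳ (1ℚ - κ)) (*-monoˡ (0≤∸ κ≤1)
    (subst ((1ℚ - κ) ^ x ≤ᵠ_) (1^ x) (^-mono x (0≤∸ κ≤1) (≤-by κ 0≤κ (e κ))))))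
    where
    e : ∀ k → 1ℚ - k + k ≡ 1ℚ
    e = solve-∀ ℚ-ring

  -- For x ≥ 2 one has κ^x ≤ κ², and this fits into the gap between x² - x and x².
  split-bound₁ : ∀ x → 2 ≤ x → κ ^ x + (1ℚ - κ) ^ x ≤ᵠ 1ℚ - (⟦ x ⟧ * κ - ⟦ x ⟧ * ⟦ x ⟧ * (κ * κ))
  split-bound₁ x@(suc (suc y)) (s≤s (s≤s z≤n)) = ℚ.≤-trans (ℚ.+-mono-≤ (κ^x≤κ² y) (bonferroni x))
    (≤-by ((⟦ x ⟧ - 1ℚ) * (κ * κ)) (0≤* (0≤∸ 1≤⟦ x ⟧) (0≤* 0≤κ 0≤κ)) (e κ ⟦ x ⟧))
    where
    e : ∀ k x → k * k + (1ℚ - x * k + (x * x - x) * (k * k)) + (x - 1ℚ) * (k * k) ≡ 1ℚ - (x * k - x * x * (k * k))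
    e = solve-∀ ℚ-ring

  -- κ² + (1 - κ)² = 1 - 2κ(1 - κ), and 1 - κ ≥ ½.
  split-bound₂ : κ + κ ≤ᵠ 1ℚ → ∀ x → 2 ≤ x → κ ^ x + (1ℚ - κ) ^ x ≤ᵠ 1ℚ - κ
  split-bound₂ 2κ≤1 x@(suc (suc y)) (s≤s (s≤s z≤n)) = ℚ.≤-trans (ℚ.+-mono-≤ (κ^x≤κ² y) ([1-κ]^x≤[1-κ]² y))
    (≤-by (κ * (1ℚ - (κ + κ))) (0≤* 0≤κ (0≤∸ 2κ≤1)) (e κ))
    where
    e : ∀ k → k * k + (1ℚ - k) * (1ℚ - k) + k * (1ℚ - (k + k)) ≡ 1ℚ - k
    e = solve-∀ ℚ-ring

-- Finite sums and random sets

𝟙 : ∀ {P : Set} → Dec P → ℚ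
𝟙 (yes _) = 1ℚ
𝟙 (no _)  = 0ℚ

module _ {P : Set} where

  0≤𝟙 : (p? : Dec P) → 0ℚ ≤ᵠ 𝟙 p?
  0≤𝟙 (yes _) = 0≤1
  0≤𝟙 (no _)  = ℚ.≤-refl

  𝟙≤1 : (p? : Dec P) → 𝟙 p? ≤ᵠ 1ℚ
  𝟙≤1 (yes _) = ℚ.≤-refl
  𝟙≤1 (no _)  = 0≤1

  𝟙-yes : (p? : Dec P) → P → 𝟙 p? ≡ 1ℚ
  𝟙-yes (yes _) _ = refl
  𝟙-yes (no ¬p) p = contradiction p ¬p

  𝟙-no : (p? : Dec P) → ¬ P → 𝟙 p? ≡ 0ℚ
  𝟙-no (yes p) ¬p = contradiction p ¬p
  𝟙-no (no _)  _  = refl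

  𝟙-idem : (p? : Dec P) → 𝟙 p? * 𝟙 p? ≡ 𝟙 p?
  𝟙-idem (yes _) = refl
  𝟙-idem (no _)  = refl

𝟙-cong : ∀ {P Q : Set} (p? : Dec P) (q? : Dec Q) → (P → Q) → (Q → P) → 𝟙 p? ≡ 𝟙 q?
𝟙-cong (yes p) q? to from = sym (𝟙-yes q? (to p))
𝟙-cong (no ¬p) q? to from = sym (𝟙-no q? (¬p ∘ from))

𝟙-⊎ : ∀ {P Q : Set} (p? : Dec P) (q? : Dec Q) → 𝟙 (p? ⊎-dec q?) ≤ᵠ 𝟙 p? + 𝟙 q?
𝟙-⊎ (yes _) q? = ≤-by (𝟙 q?) (0≤𝟙 q?) refl
𝟙-⊎ (no _) (yes _) = ℚ.≤-refl
𝟙-⊎ (no _) (no _)  = ℚ.≤-refl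

module _ {A : Set} where

  ∑ : List A → (A → ℚ) → ℚ
  ∑ []       f = 0ℚ
  ∑ (x ∷ xs) f = f x + ∑ xs f

  ∑-cong : ∀ xs {f g : A → ℚ} → (∀ x → f x ≡ g x) → ∑ xs f ≡ ∑ xs g
  ∑-cong []       h = refl
  ∑-cong (x ∷ xs) h = cong₂ _+_ (h x) (∑-cong xs h)

  ∑-mono : ∀ xs {f g : A → ℚ} → (∀ x → f x ≤ᵠ g x) → ∑ xs f ≤ᵠ ∑ xs g
  ∑-mono []       h = ℚ.≤-refl
  ∑-mono (x ∷ xs) h = ℚ.+-mono-≤ (h x) (∑-mono xs h)

  ∑-nonneg : ∀ xs {f : A → ℚ} → (∀ x → 0ℚ ≤ᵠ f x) → 0ℚ ≤ᵠ ∑ xs f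
  ∑-nonneg []       h = ℚ.≤-refl
  ∑-nonneg (x ∷ xs) h = 0≤+ (h x) (∑-nonneg xs h)

  ∑-zero : ∀ xs → ∑ xs (λ _ → 0ℚ) ≡ 0ℚ
  ∑-zero []       = refl
  ∑-zero (x ∷ xs) = trans (ℚ.+-identityˡ _) (∑-zero xs)

  ∑-+ : ∀ xs (f g : A → ℚ) → ∑ xs (λ x → f x + g x) ≡ ∑ xs f + ∑ xs g
  ∑-+ []       f g = refl
  ∑-+ (x ∷ xs) f g = trans (cong (λ z → f x + g x + z) (∑-+ xs f g)) (e (f x) (g x) (∑ xs f) (∑ xs g))
    where
    e : ∀ a b c d → a + b + (c + d) ≡ a + c + (b + d)
    e = solve-∀ ℚ-ring

  ∑-* : ∀ xs c (f : A → ℚ) → ∑ xs (λ x → c * f x) ≡ c * ∑ xs f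
  ∑-* []       c f = sym (ℚ.*-zeroʳ c)
  ∑-* (x ∷ xs) c f = trans (cong (λ z → c * f x + z) (∑-* xs c f)) (sym (ℚ.*-distribˡ-+ c (f x) (∑ xs f)))

  ∑-++ : ∀ xs ys (f : A → ℚ) → ∑ (xs ++ ys) f ≡ ∑ xs f + ∑ ys f
  ∑-++ []       ys f = sym (ℚ.+-identityˡ _)
  ∑-++ (x ∷ xs) ys f = trans (cong (λ z → f x + z) (∑-++ xs ys f)) (sym (ℚ.+-assoc (f x) (∑ xs f) _))

  ∑-filter : ∀ {P : Pred A 0ℓ} (P? : U.Decidable P) xs (f : A → ℚ) →
             ∑ (filter P? xs) f ≡ ∑ xs (λ x → 𝟙 (P? x) * f x)
  ∑-filter P? []       f = refl
  ∑-filter P? (x ∷ xs) f with P? x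
  ... | yes _ = cong₂ _+_ (sym (ℚ.*-identityˡ (f x))) (∑-filter P? xs f)
  ... | no _  = trans (∑-filter P? xs f) (sym (trans (cong (_+ rest) (ℚ.*-zeroˡ (f x))) (ℚ.+-identityˡ rest)))
    where rest = ∑ xs (λ x → 𝟙 (P? x) * f x)

module _ {A B : Set} where

  ∑-map : ∀ (h : A → B) xs (f : B → ℚ) → ∑ (map h xs) f ≡ ∑ xs (f ∘ h)
  ∑-map h []       f = refl
  ∑-map h (x ∷ xs) f = cong (λ z → f (h x) + z) (∑-map h xs f)

  ∑-swap : ∀ xs ys (f : A → B → ℚ) → ∑ xs (λ x → ∑ ys (f x)) ≡ ∑ ys (λ y → ∑ xs (λ x → f x y))
  ∑-swap []       ys f = sym (∑-zero ys)
  ∑-swap (x ∷ xs) ys f = trans (cong (λ z → ∑ ys (f x) + z) (∑-swap xs ys f)) (sym (∑-+ ys (f x) _))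

∑-cartesianProductWith : ∀ {A B C : Set} (h : A → B → C) xs ys (f : C → ℚ) →
  ∑ (cartesianProductWith h xs ys) f ≡ ∑ xs (λ x → ∑ ys (λ y → f (h x y)))
∑-cartesianProductWith h []       ys f = refl
∑-cartesianProductWith h (x ∷ xs) ys f = trans (∑-++ (map (h x) ys) _ f)
  (cong₂ _+_ (∑-map (h x) ys f) (∑-cartesianProductWith h xs ys f))

∑-allFin-suc : ∀ {n} (f : Fin (suc n) → ℚ) → ∑ (allFin (suc n)) f ≡ f zero + ∑ (allFin n) (f ∘ suc)
∑-allFin-suc {n} f = cong (λ z → f zero + z) (trans (cong (λ xs → ∑ xs f) (sym (List.map-tabulate {n = n} (λ i → i) suc))) (∑-map suc (allFin n) f))

∑-point : ∀ {n} (y : Fin n) (f : Fin n → ℚ) → ∑ (allFin n) (λ x → 𝟙 (y Fin.≟ x) * f x) ≡ f y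
∑-point {suc n} zero f = trans (∑-allFin-suc {n} (λ x → 𝟙 (zero Fin.≟ x) * f x))
  (trans (cong₂ _+_ (ℚ.*-identityˡ (f zero))
    (trans (∑-cong (allFin n) (λ x → ℚ.*-zeroˡ (f (suc x)))) (∑-zero (allFin n)))) (ℚ.+-identityʳ _))
∑-point {suc n} (suc y) f = trans (∑-allFin-suc {n} (λ x → 𝟙 (suc y Fin.≟ x) * f x))
  (trans (cong₂ _+_ (ℚ.*-zeroˡ (f zero))
    (trans (∑-cong (allFin n) (λ x → cong (_* f (suc x)) (𝟙-cong (suc y Fin.≟ suc x) (y Fin.≟ x) Fin.suc-injective (cong suc))))
      (∑-point y (f ∘ suc)))) (ℚ.+-identityˡ _))

∑-ones : ∀ n → ∑ (allFin n) (λ _ → 1ℚ) ≡ ⟦ n ⟧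
∑-ones zero    = refl
∑-ones (suc n) = trans (∑-allFin-suc {n} (λ _ → 1ℚ)) (trans (cong (λ z → 1ℚ + z) (∑-ones n)) (sym (⟦⟧-suc n)))

module _ {A : Set} where

  prodᵛ : ∀ {m} → (A → ℚ) → Vec A m → ℚ
  prodᵛ φ []      = 1ℚ
  prodᵛ φ (a ∷ v) = φ a * prodᵛ φ v

  prodᵛ-* : ∀ {m} φ ψ (v : Vec A m) → prodᵛ φ v * prodᵛ ψ v ≡ prodᵛ (λ a → φ a * ψ a) v
  prodᵛ-* φ ψ []      = refl
  prodᵛ-* φ ψ (a ∷ v) = trans (e (φ a) (prodᵛ φ v) (ψ a) (prodᵛ ψ v)) (cong (λ z → φ a * ψ a * z) (prodᵛ-* φ ψ v))
    where
    e : ∀ a b c d → a * b * (c * d) ≡ a * c * (b * d)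
    e = solve-∀ ℚ-ring

  prodᵛ-nonneg : ∀ {m φ} → (∀ a → 0ℚ ≤ᵠ φ a) → (v : Vec A m) → 0ℚ ≤ᵠ prodᵛ φ v
  prodᵛ-nonneg h []      = 0≤1
  prodᵛ-nonneg h (a ∷ v) = 0≤* (h a) (prodᵛ-nonneg h v)

  prodᵛ-cong : ∀ {m φ ψ} → (∀ a → φ a ≡ ψ a) → (v : Vec A m) → prodᵛ φ v ≡ prodᵛ ψ v
  prodᵛ-cong h []      = refl
  prodᵛ-cong h (a ∷ v) = cong₂ _*_ (h a) (prodᵛ-cong h v)

  -- This is where independence enters: a sum of products over all vectors factors into one sum per
  -- coordinate.
  ∑-vectors : ∀ (as : List A) m φ → ∑ (vectors as m) (prodᵛ φ) ≡ ∑ as φ ^ m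
  ∑-vectors as zero    φ = ℚ.+-identityʳ 1ℚ
  ∑-vectors as (suc m) φ = trans (∑-cartesianProductWith _∷_ as (vectors as m) (prodᵛ φ))
    (trans (∑-cong as (λ a → trans (∑-* (vectors as m) (φ a) (prodᵛ φ)) (cong (λ z → φ a * z) (∑-vectors as m φ))))
    (trans (∑-cong as (λ a → ℚ.*-comm (φ a) (∑ as φ ^ m)))
    (trans (∑-* as (∑ as φ ^ m) φ) (ℚ.*-comm _ (∑ as φ)))))

  prodᵛ-𝟙-yes : ∀ {m} {P : Pred A 0ℓ} (P? : U.Decidable P) (v : Vec A m) → (∀ k → P (lookup v k)) →
                prodᵛ (λ a → 𝟙 (P? a)) v ≡ 1ℚ
  prodᵛ-𝟙-yes P? []      h = refl
  prodᵛ-𝟙-yes P? (a ∷ v) h = cong₂ _*_ (𝟙-yes (P? a) (h zero)) (prodᵛ-𝟙-yes P? v (h ∘ suc))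

  prodᵛ-𝟙-no : ∀ {m} {P : Pred A 0ℓ} (P? : U.Decidable P) (v : Vec A m) → ¬ (∀ k → P (lookup v k)) →
               prodᵛ (λ a → 𝟙 (P? a)) v ≡ 0ℚ
  prodᵛ-𝟙-no P? []      h = contradiction (λ ()) h
  prodᵛ-𝟙-no P? (a ∷ v) h with P? a
  ... | no _  = ℚ.*-zeroˡ (prodᵛ (λ a → 𝟙 (P? a)) v)
  ... | yes p = trans (ℚ.*-identityˡ _) (prodᵛ-𝟙-no P? v (λ h′ → h λ { zero → p ; (suc k) → h′ k }))

∑-allSubsets-suc : ∀ n (f : Subset (suc n) → ℚ) → ∑ (allSubsets (suc n)) f ≡
  ∑ (allSubsets n) (λ A → f (outside ∷ A)) + ∑ (allSubsets n) (λ A → f (inside ∷ A))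
∑-allSubsets-suc n f = trans (∑-cartesianProductWith _∷_ (outside ∷ inside ∷ []) (allSubsets n) f)
  (cong (λ z → ∑ (allSubsets n) (λ A → f (outside ∷ A)) + z) (ℚ.+-identityʳ _))

≤∑-allSubsets : ∀ {n} (f : Subset n → ℚ) → (∀ A → 0ℚ ≤ᵠ f A) → ∀ S → f S ≤ᵠ ∑ (allSubsets n) f
≤∑-allSubsets f h [] = ℚ.≤-reflexive (sym (ℚ.+-identityʳ (f [])))
≤∑-allSubsets {suc n} f h (outside ∷ S) = subst (f (outside ∷ S) ≤ᵠ_) (sym (∑-allSubsets-suc n f))
  (ℚ.≤-trans (≤∑-allSubsets (λ A → f (outside ∷ A)) (λ A → h (outside ∷ A)) S)
    (≤-by _ (∑-nonneg (allSubsets n) (λ A → h (inside ∷ A))) refl))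
≤∑-allSubsets {suc n} f h (inside ∷ S) = subst (f (inside ∷ S) ≤ᵠ_) (trans (ℚ.+-comm in′ out′) (sym (∑-allSubsets-suc n f)))
  (ℚ.≤-trans (≤∑-allSubsets (λ A → f (inside ∷ A)) (λ A → h (inside ∷ A)) S)
    (≤-by out′ (∑-nonneg (allSubsets n) (λ A → h (outside ∷ A))) refl))
  where
  out′ = ∑ (allSubsets n) (λ A → f (outside ∷ A))
  in′ = ∑ (allSubsets n) (λ A → f (inside ∷ A))

count : ∀ {n} → ℕ → (Subset n → ℚ) → ℚ
count {n} x φ = ∑ (allSubsets n) (λ A → 𝟙 (∣ A ∣ ℕ.≟ x) * φ A)

-- Fixing the membership of the first node splits the count; if that node lies in S, the two parts
-- recombine by Pascal's rule.
count-⊆ : ∀ {n} (S : Subset n) x → count x (λ A → 𝟙 (A ⊆? S)) ≡ ⟦ ∣ S ∣ C x ⟧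
count-⊆ {zero}  [] zero    = refl
count-⊆ {zero}  [] (suc x) = refl
count-⊆ {suc n} (outside ∷ S) x = trans (∑-allSubsets-suc n _) (trans (cong₂ _+_
  (trans (∑-cong (allSubsets n) λ A → cong (𝟙 (∣ A ∣ ℕ.≟ x) *_)
    (𝟙-cong ((outside ∷ A) ⊆? (outside ∷ S)) (A ⊆? S) Subset.drop-∷-⊆ Subset.out⊆)) (count-⊆ S x))
  (trans (∑-cong (allSubsets n) λ A → trans (cong (𝟙 (suc ∣ A ∣ ℕ.≟ x) *_)
    (𝟙-no ((inside ∷ A) ⊆? (outside ∷ S)) λ h → case-absurd (h Vec.here))) (ℚ.*-zeroʳ (𝟙 (suc ∣ A ∣ ℕ.≟ x)))) (∑-zero (allSubsets n))))
  (ℚ.+-identityʳ _))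
  where
  case-absurd : ∀ {P : Set} → zero ∈ (outside ∷ S) → P
  case-absurd ()
count-⊆ {suc n} (inside ∷ S) zero = trans (∑-allSubsets-suc n _) (trans (cong₂ _+_
  (trans (∑-cong (allSubsets n) λ A → cong (𝟙 (∣ A ∣ ℕ.≟ 0) *_)
    (𝟙-cong ((outside ∷ A) ⊆? (inside ∷ S)) (A ⊆? S) Subset.drop-∷-⊆ Subset.out⊆)) (count-⊆ S 0))
  (trans (∑-cong (allSubsets n) λ A → ℚ.*-zeroˡ (𝟙 ((inside ∷ A) ⊆? (inside ∷ S)))) (∑-zero (allSubsets n))))
  (trans (ℚ.+-identityʳ _) (cong ⟦_⟧ (trans (nC0≡1 ∣ S ∣) (sym (nC0≡1 (suc ∣ S ∣)))))))
count-⊆ {suc n} (inside ∷ S) (suc x) = trans (∑-allSubsets-suc n _) (trans (cong₂ _+_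
  (trans (∑-cong (allSubsets n) λ A → cong (𝟙 (∣ A ∣ ℕ.≟ suc x) *_)
    (𝟙-cong ((outside ∷ A) ⊆? (inside ∷ S)) (A ⊆? S) Subset.drop-∷-⊆ Subset.out⊆)) (count-⊆ S (suc x)))
  (trans (∑-cong (allSubsets n) λ A → cong₂ _*_ (𝟙-cong (suc ∣ A ∣ ℕ.≟ suc x) (∣ A ∣ ℕ.≟ x) ℕ.suc-injective (cong suc))
    (𝟙-cong ((inside ∷ A) ⊆? (inside ∷ S)) (A ⊆? S) Subset.drop-∷-⊆ Subset.in⊆in)) (count-⊆ S x)))
  (trans (ℚ.+-comm _ ⟦ ∣ S ∣ C x ⟧) (sym (pascal ∣ S ∣ x))))

count-1 : ∀ {n} x → count {n} x (λ _ → 1ℚ) ≡ ⟦ n C x ⟧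
count-1 {n} x = trans (∑-cong (allSubsets n) λ A → cong (𝟙 (∣ A ∣ ℕ.≟ x) *_) (sym (𝟙-yes (A ⊆? ⊤ {n}) Subset.⊆⊤)))
  (trans (count-⊆ (⊤ {n}) x) (cong (λ s → ⟦ s C x ⟧) (Subset.∣⊤∣≡n n)))

count-mono : ∀ {n} x {φ ψ : Subset n → ℚ} → (∀ A → ∣ A ∣ ≡ x → φ A ≤ᵠ ψ A) → count x φ ≤ᵠ count x ψ
count-mono {n} x {φ} {ψ} h = ∑-mono (allSubsets n) go
  where
  go : ∀ A → 𝟙 (∣ A ∣ ℕ.≟ x) * φ A ≤ᵠ 𝟙 (∣ A ∣ ℕ.≟ x) * ψ A
  go A with ∣ A ∣ ℕ.≟ x
  ... | yes eq = *-monoˡ 0≤1 (h A eq)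
  ... | no _   = ℚ.≤-reflexive (trans (ℚ.*-zeroˡ (φ A)) (sym (ℚ.*-zeroˡ (ψ A))))

count-cong : ∀ {n} x {φ ψ : Subset n → ℚ} → (∀ A → ∣ A ∣ ≡ x → φ A ≡ ψ A) → count x φ ≡ count x ψ
count-cong x h = ℚ.≤-antisym (count-mono x (λ A eq → ℚ.≤-reflexive (h A eq)))
  (count-mono x (λ A eq → ℚ.≤-reflexive (sym (h A eq))))

count-+ : ∀ {n} x (φ ψ : Subset n → ℚ) → count x (λ A → φ A + ψ A) ≡ count x φ + count x ψ
count-+ {n} x φ ψ = trans (∑-cong (allSubsets n) λ A → ℚ.*-distribˡ-+ (𝟙 (∣ A ∣ ℕ.≟ x)) (φ A) (ψ A))
  (∑-+ (allSubsets n) _ _)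

-- The law of one random set and expectations

invC : ∀ n {k} → k ≤ n → ℚ
invC n {k} k≤n = (+ 1 / (n C k)) {{nCk≢0 k≤n}}

invC-* : ∀ n {k} (k≤n : k ≤ n) → invC n k≤n * ⟦ n C k ⟧ ≡ 1ℚ
invC-* n {k} k≤n = /-*-cancel 1 (n C k) {{nCk≢0 k≤n}}

0≤invC : ∀ n {k} (k≤n : k ≤ n) → 0ℚ ≤ᵠ invC n k≤n
0≤invC n {k} k≤n = 0≤/ 1 (n C k) {{nCk≢0 k≤n}}

invC-cong : ∀ n {k l} (k≤n : k ≤ n) (l≤n : l ≤ n) → k ≡ l → invC n k≤n ≡ invC n l≤n
invC-cong n k≤n l≤n refl = refl

weight : ∀ {n} → (Fin (suc n) → ℚ) → Subset n → ℚ
weight {n} g A = invC n (∣p∣≤n A) * g (fromℕ< (s≤s (∣p∣≤n A)))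

-- The conditional expectation of φ given that the random set has size x.
density : ∀ {n} → (Subset n → ℚ) → Fin (suc n) → ℚ
density {n} φ x = invC n (Fin.toℕ≤pred[n] x) * count (toℕ x) φ

-- Total expectation over the size: a sum over x with the indicator of x = |A| is inserted, and the
-- two sums are exchanged.
∑-weight : ∀ {n} (g : Fin (suc n) → ℚ) (φ : Subset n → ℚ) →
           ∑ (allSubsets n) (λ A → weight g A * φ A) ≡ ∑ (allFin (suc n)) (λ x → g x * density φ x)
∑-weight {n} g φ = begin
  ∑ (allSubsets n) (λ A → weight g A * φ A)
    ≡⟨ ∑-cong (allSubsets n) (λ A → trans (cong (_* φ A) (weight≡ A))
         (trans (sym (∑-point (size A) (λ x → inv x * g x * φ A))) (∑-cong (allFin (suc n)) (λ x → regroup A x)))) ⟩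
  ∑ (allSubsets n) (λ A → ∑ (allFin (suc n)) (λ x → g x * inv x * (𝟙 (∣ A ∣ ℕ.≟ toℕ x) * φ A)))
    ≡⟨ ∑-swap (allSubsets n) (allFin (suc n)) _ ⟩
  ∑ (allFin (suc n)) (λ x → ∑ (allSubsets n) (λ A → g x * inv x * (𝟙 (∣ A ∣ ℕ.≟ toℕ x) * φ A)))
    ≡⟨ ∑-cong (allFin (suc n)) (λ x → trans (∑-* (allSubsets n) (g x * inv x) _) (ℚ.*-assoc (g x) (inv x) _)) ⟩
  ∑ (allFin (suc n)) (λ x → g x * density φ x) ∎
  where
  open ≡-Reasoning
  inv : Fin (suc n) → ℚ
  inv x = invC n (Fin.toℕ≤pred[n] x)
  size : Subset n → Fin (suc n)
  size A = fromℕ< (s≤s (∣p∣≤n A))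
  toℕ-size : ∀ A → toℕ (size A) ≡ ∣ A ∣
  toℕ-size A = Fin.toℕ-fromℕ< (s≤s (∣p∣≤n A))
  weight≡ : ∀ A → weight g A ≡ inv (size A) * g (size A)
  weight≡ A = cong (_* g (size A)) (invC-cong n (∣p∣≤n A) (Fin.toℕ≤pred[n] (size A)) (sym (toℕ-size A)))
  e : ∀ d i g p → d * (i * g * p) ≡ g * i * (d * p)
  e = solve-∀ ℚ-ring
  regroup : ∀ A x → 𝟙 (size A Fin.≟ x) * (inv x * g x * φ A) ≡ g x * inv x * (𝟙 (∣ A ∣ ℕ.≟ toℕ x) * φ A)
  regroup A x = trans (e (𝟙 (size A Fin.≟ x)) (inv x) (g x) (φ A)) (cong (λ d → g x * inv x * (d * φ A))
    (𝟙-cong (size A Fin.≟ x) (∣ A ∣ ℕ.≟ toℕ x) (λ eq → trans (sym (toℕ-size A)) (cong toℕ eq))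
      (λ eq → Fin.toℕ-injective (trans (toℕ-size A) eq))))

density-≤ : ∀ {n} (φ : Subset n → ℚ) x {c} → count (toℕ x) φ ≤ᵠ c * ⟦ n C toℕ x ⟧ → density φ x ≤ᵠ c
density-≤ {n} φ x {c} h = subst (density φ x ≤ᵠ_)
  (trans (e (invC n x≤n) c ⟦ n C toℕ x ⟧) (trans (cong (c *_) (invC-* n x≤n)) (ℚ.*-identityʳ c)))
  (*-monoˡ (0≤invC n x≤n) h)
  where
  x≤n = Fin.toℕ≤pred[n] x
  e : ∀ i c d → i * (c * d) ≡ c * (i * d)
  e = solve-∀ ℚ-ring

density-≡ : ∀ {n} (φ : Subset n → ℚ) x {c} → count (toℕ x) φ ≡ c * ⟦ n C toℕ x ⟧ → density φ x ≡ c
density-≡ {n} φ x {c} h = trans (cong (invC n x≤n *_) h)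
  (trans (e (invC n x≤n) c ⟦ n C toℕ x ⟧) (trans (cong (c *_) (invC-* n x≤n)) (ℚ.*-identityʳ c)))
  where
  x≤n = Fin.toℕ≤pred[n] x
  e : ∀ i c d → i * (c * d) ≡ c * (i * d)
  e = solve-∀ ℚ-ring

∑-weight-1 : ∀ {n} (g : Fin (suc n) → ℚ) → ∑ (allSubsets n) (weight g) ≡ ∑ (allFin (suc n)) g
∑-weight-1 {n} g = trans (∑-cong (allSubsets n) (λ A → sym (ℚ.*-identityʳ (weight g A)))) (trans (∑-weight g (λ _ → 1ℚ))
  (∑-cong (allFin (suc n)) λ x → trans (cong (g x *_) (density-≡ (λ _ → 1ℚ) x {1ℚ}
    (trans (count-1 {n} (toℕ x)) (sym (ℚ.*-identityˡ _))))) (ℚ.*-identityʳ (g x))))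

record IsPmf {n} (g : Fin (suc n) → ℚ) : Set where
  field
    nonneg : ∀ x → 0ℚ ≤ᵠ g x
    total  : ∑ (allFin (suc n)) g ≡ 1ℚ

big? : ∀ {n} (x : Fin n) → Dec (2 ≤ toℕ x)
big? x = 2 ℕ.≤? toℕ x

mom : ∀ {n} → (Fin (suc n) → ℚ) → ℕ → ℚ
mom {n} g k = ∑ (allFin (suc n)) (λ x → 𝟙 (big? x) * (⟦ toℕ x ℕ.^ k ⟧ * g x))

-- The summand 1 absorbs the error of approximating a real distribution.
Sparse : ∀ {n} → ℕ → ℕ → (Fin (suc n) → ℚ) → Set
Sparse m K g = ⟦ m ⟧ * mom g 2 ≤ᵠ ⟦ K ⟧ * (⟦ m ⟧ * mom g 0) + 1ℚ

-- This is λ = (m/n)(g)₁ for n = n′ + 1, so that `r n′` is 1/n.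
rate : ∀ {n′} → ℕ → (Fin (suc (suc n′)) → ℚ) → ℚ
rate {n′} m g = ⟦ m ⟧ * r n′ * mom g 1

module _ {n} {g : Fin (suc n) → ℚ} (isPmf : IsPmf g) where
  open IsPmf isPmf renaming (nonneg to g≥0; total to ∑g)

  0≤weight : ∀ A → 0ℚ ≤ᵠ weight g A
  0≤weight A = 0≤* (0≤invC n (∣p∣≤n A)) (g≥0 (fromℕ< (s≤s (∣p∣≤n A))))

  𝔼₁ : (Subset n → ℚ) → ℚ
  𝔼₁ φ = ∑ (allSubsets n) (λ A → weight g A * φ A)

  𝔼₁-nonneg : ∀ {φ} → (∀ A → 0ℚ ≤ᵠ φ A) → 0ℚ ≤ᵠ 𝔼₁ φ
  𝔼₁-nonneg h = ∑-nonneg (allSubsets n) λ A → 0≤* (0≤weight A) (h A)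

  private
    affine : ∀ (h : Fin (suc n) → ℚ) → ∑ (allFin (suc n)) (λ x → g x * (1ℚ - 𝟙 (big? x) * h x))
             ≡ 1ℚ - ∑ (allFin (suc n)) (λ x → 𝟙 (big? x) * h x * g x)
    affine h = trans (∑-cong (allFin (suc n)) λ x → e (g x) (𝟙 (big? x)) (h x))
      (trans (∑-+ (allFin (suc n)) g _)
        (cong₂ _+_ ∑g (trans (∑-* (allFin (suc n)) (- 1ℚ) (λ x → 𝟙 (big? x) * h x * g x))
          (e′ (∑ (allFin (suc n)) (λ x → 𝟙 (big? x) * h x * g x))))))
      where
      e : ∀ g b h → g * (1ℚ - b * h) ≡ g + (- 1ℚ) * (b * h * g)
      e = solve-∀ ℚ-ring
      e′ : ∀ s → (- 1ℚ) * s ≡ - s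
      e′ = solve-∀ ℚ-ring

  -- A set with at most one element neither crosses a cut nor joins two nodes. The events below
  -- therefore have densities of, or bounded by, the form 1 - 𝟙(x ≥ 2) h(x), and their expectations
  -- become 1 minus a combination of moments.
  𝔼₁-≡ : ∀ φ h → (∀ x → density φ x ≡ 1ℚ - 𝟙 (big? x) * h x) →
         𝔼₁ φ ≡ 1ℚ - ∑ (allFin (suc n)) (λ x → 𝟙 (big? x) * h x * g x)
  𝔼₁-≡ φ h d = trans (∑-weight g φ) (trans (∑-cong (allFin (suc n)) λ x → cong (g x *_) (d x)) (affine h))

  𝔼₁-≤ : ∀ φ h → (∀ x → density φ x ≤ᵠ 1ℚ - 𝟙 (big? x) * h x) →
         𝔼₁ φ ≤ᵠ 1ℚ - ∑ (allFin (suc n)) (λ x → 𝟙 (big? x) * h x * g x)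
  𝔼₁-≤ φ h d = subst₂ _≤ᵠ_ (sym (∑-weight g φ)) (affine h) (∑-mono (allFin (suc n)) λ x → *-monoˡ (g≥0 x) (d x))

  module _ (m : ℕ) where

    joint : Vec (Subset n) m → ℚ
    joint = prodᵛ (weight g)

    𝔼 : (Vec (Subset n) m → ℚ) → ℚ
    𝔼 F = ∑ (vectors (allSubsets n) m) (λ V → joint V * F V)

    0≤joint : ∀ V → 0ℚ ≤ᵠ joint V
    0≤joint = prodᵛ-nonneg 0≤weight

    𝔼-mono : ∀ {F G} → (∀ V → F V ≤ᵠ G V) → 𝔼 F ≤ᵠ 𝔼 G
    𝔼-mono h = ∑-mono (vectors (allSubsets n) m) λ V → *-monoˡ (0≤joint V) (h V)

    𝔼-cong : ∀ {F G} → (∀ V → F V ≡ G V) → 𝔼 F ≡ 𝔼 G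
    𝔼-cong h = ∑-cong (vectors (allSubsets n) m) λ V → cong (joint V *_) (h V)

    𝔼-+ : ∀ F G → 𝔼 (λ V → F V + G V) ≡ 𝔼 F + 𝔼 G
    𝔼-+ F G = trans (∑-cong (vectors (allSubsets n) m) λ V → ℚ.*-distribˡ-+ (joint V) (F V) (G V))
      (∑-+ (vectors (allSubsets n) m) _ _)

    𝔼-* : ∀ c F → 𝔼 (λ V → c * F V) ≡ c * 𝔼 F
    𝔼-* c F = trans (∑-cong (vectors (allSubsets n) m) λ V → e (joint V) c (F V)) (∑-* (vectors (allSubsets n) m) c _)
      where
      e : ∀ j c f → j * (c * f) ≡ c * (j * f)
      e = solve-∀ ℚ-ring

    𝔼-∑ : ∀ {A : Set} (xs : List A) (F : A → Vec (Subset n) m → ℚ) → 𝔼 (λ V → ∑ xs (λ x → F x V)) ≡ ∑ xs (λ x → 𝔼 (F x))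
    𝔼-∑ xs F = trans (∑-cong (vectors (allSubsets n) m) λ V → sym (∑-* xs (joint V) (λ x → F x V)))
      (∑-swap (vectors (allSubsets n) m) xs _)

    𝔼-prod : ∀ φ → 𝔼 (prodᵛ φ) ≡ 𝔼₁ φ ^ m
    𝔼-prod φ = trans (∑-cong (vectors (allSubsets n) m) (prodᵛ-* (weight g) φ)) (∑-vectors (allSubsets n) m _)

    𝔼-1 : 𝔼 (λ _ → 1ℚ) ≡ 1ℚ
    𝔼-1 = trans (∑-cong (vectors (allSubsets n) m) λ V → ℚ.*-identityʳ (joint V))
      (trans (∑-vectors (allSubsets n) m (weight g))
      (trans (cong (_^ m) (trans (∑-weight-1 g) ∑g)) (1^ m)))

    𝔼-nonneg : ∀ {F} → (∀ V → 0ℚ ≤ᵠ F V) → 0ℚ ≤ᵠ 𝔼 F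
    𝔼-nonneg h = ∑-nonneg (vectors (allSubsets n) m) λ V → 0≤* (0≤joint V) (h V)

-- Connectivity

NonCrossing : ∀ {n} → Subset n → Pred (Subset n) 0ℓ
NonCrossing S A = A ⊆ S ⊎ A ⊆ ∁ S

nonCrossing? : ∀ {n} (S : Subset n) → U.Decidable (NonCrossing S)
nonCrossing? S A = (A ⊆? S) ⊎-dec (A ⊆? ∁ S)

SmallSide : ∀ {n} → Pred (Subset n) 0ℓ
SmallSide {n} S = 1 ≤ ∣ S ∣ × 2 ℕ.* ∣ S ∣ ≤ n

smallSide? : ∀ {n} → U.Decidable (SmallSide {n})
smallSide? {n} S = (1 ℕ.≤? ∣ S ∣) ×-dec (2 ℕ.* ∣ S ∣ ℕ.≤? n)

module _ {n m} (V : Vec (Subset n) m) where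

  Uncrossed : Subset n → Set
  Uncrossed S = ∀ k → NonCrossing S (lookup V k)

  private
    _~_ = Adjacent V

    uncrossed-∁ : ∀ {S} → Uncrossed S → Uncrossed (∁ S)
    uncrossed-∁ {S} h k with h k
    ... | inj₁ A⊆S  = inj₂ λ u∈A → Subset.x∉p⇒x∈∁p (Subset.x∈p⇒x∉∁p (A⊆S u∈A))
    ... | inj₂ A⊆∁S = inj₁ A⊆∁S

    -- A set meeting both R and its complement, in v and u say, makes v and u adjacent across R.
    -- Deciding `nonCrossing?` first turns the resulting refutation into a choice of side.
    closed⇒uncrossed : ∀ {R} → ¬ (∃[ v ] ∃[ u ] (v ∈ R × u ∉ R × v ~ u)) → Uncrossed R
    closed⇒uncrossed {R} closed k with nonCrossing? R (lookup V k)
    ... | yes nc = nc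
    ... | no ¬nc = inj₁ λ {u} u∈A → case (u ∈? R) of λ where
      (yes u∈R) → u∈R
      (no u∉R)  → contradiction (inj₂ λ {v} v∈A → case (v ∈? R) of λ where
        (no v∉R)  → Subset.x∉p⇒x∈∁p v∉R
        (yes v∈R) → contradiction
          (v , u , v∈R , u∉R , (λ { refl → u∉R v∈R }) , k , v∈A , u∈A) closed) ¬nc

    -- A set and its complement are uncrossed together, and one of the two has at most n/2 nodes.
    -- This is why cuts up to n/2 suffice.
    notSmall : (∀ S → SmallSide S → ¬ Uncrossed S) → ∀ {R} → 1 ≤ ∣ R ∣ → suc ∣ R ∣ ≤ n → ¬ Uncrossed R
    notSmall cut {R} 1≤R R<n unc with 2 ℕ.* ∣ R ∣ ℕ.≤? n
    ... | yes 2R≤n = cut R (1≤R , 2R≤n) unc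
    ... | no 2R≰n  = cut (∁ R) (subst (1 ≤_) (sym (Subset.∣∁p∣≡n∸∣p∣ R)) (ℕ.m<n⇒0<n∸m R<n) ,
      subst (λ s → 2 ℕ.* s ≤ n) (sym (Subset.∣∁p∣≡n∸∣p∣ R)) small) (uncrossed-∁ unc)
      where
      s = ∣ R ∣
      small : 2 ℕ.* (n ℕ.∸ s) ≤ n
      small = subst (_≤ n) (sym (ℕ.*-distribˡ-∸ 2 n s)) (ℕ.m≤n+o⇒m∸n≤o (2 ℕ.* n) (2 ℕ.* s)
        (ℕ.≤-trans (ℕ.≤-reflexive (cong (n ℕ.+_) (ℕ.+-identityʳ n))) (ℕ.+-monoˡ-≤ n (ℕ.<⇒≤ (ℕ.≰⇒> 2R≰n)))))

    -- Search from i, with R the nodes reached so far. An edge leaving R adds a node; if there is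
    -- none while j is missing, R is a proper uncrossed set, against `cut`. The fuel bounds the
    -- number of missing nodes.
    grow : (∀ S → SmallSide S → ¬ Uncrossed S) → ∀ i fuel (R : Subset n) → n ≤ fuel ℕ.+ ∣ R ∣ → 1 ≤ ∣ R ∣ →
           (∀ {v} → v ∈ R → Star _~_ i v) → ∀ j → Star _~_ i j
    grow cut i fuel R enough 1≤R reach j with j ∈? R
    ... | yes j∈R = reach j∈R
    ... | no j∉R with Fin.any? (λ v → Fin.any? (λ u → (v ∈? R) ×-dec (¬? (u ∈? R) ×-dec adjacent? V v u)))
    ... | no closed = contradiction (closed⇒uncrossed closed)
            (notSmall cut 1≤R (subst (∣ R ∣ ℕ.<_) (Subset.∣⊤∣≡n n)
              (Subset.p⊂q⇒∣p∣<∣q∣ (Subset.⊆⊤ , j , Subset.∈⊤ , j∉R))))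
    grow cut i zero R enough 1≤R reach j | no j∉R | yes _ =
      contradiction (ℕ.<-≤-trans (subst (∣ R ∣ ℕ.<_) (Subset.∣⊤∣≡n n)
              (Subset.p⊂q⇒∣p∣<∣q∣ (Subset.⊆⊤ , j , Subset.∈⊤ , j∉R))) enough) (ℕ.<-irrefl refl)
    grow cut i (suc fuel) R enough 1≤R reach j | no j∉R | yes (v , u , v∈R , u∉R , v~u) =
      grow cut i fuel (R ∪ ⁅ u ⁆)
        (ℕ.≤-trans enough (ℕ.≤-trans (ℕ.≤-reflexive (sym (ℕ.+-suc fuel ∣ R ∣))) (ℕ.+-monoʳ-≤ fuel R<)))
        (ℕ.≤-trans 1≤R (ℕ.<⇒≤ R<)) reach′ j
      where
      R< : ∣ R ∣ ℕ.< ∣ R ∪ ⁅ u ⁆ ∣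
      R< = Subset.p⊂q⇒∣p∣<∣q∣ (Subset.p⊆p∪q ⁅ u ⁆ , u , Subset.x∈p∪q⁺ (inj₂ (Subset.x∈⁅x⁆ u)) , u∉R)
      reach′ : ∀ {w} → w ∈ R ∪ ⁅ u ⁆ → Star _~_ i w
      reach′ {w} w∈ with Subset.x∈p∪q⁻ R ⁅ u ⁆ w∈
      ... | inj₁ w∈R = reach w∈R
      ... | inj₂ w∈u with refl ← Subset.x∈⁅y⁆⇒x≡y u w∈u = reach v∈R ◅◅ (v~u ◅ Star.ε)

  allCutsCrossed⇒connected : (∀ S → SmallSide S → ¬ Uncrossed S) → Connected (Adjacent V)
  allCutsCrossed⇒connected cut i = grow cut i n ⁅ i ⁆ (ℕ.m≤m+n n _) (ℕ.≤-reflexive (sym (Subset.∣⁅x⁆∣≡1 i)))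
    λ {v} v∈ → subst (Star _~_ i) (sym (Subset.x∈⁅y⁆⇒x≡y i v∈)) Star.ε

Isolating : ∀ {n} → Fin n → Pred (Subset n) 0ℓ
Isolating i A = i ∉ A ⊎ ∣ A ∣ ≤ 1

isolating? : ∀ {n} (i : Fin n) → U.Decidable (Isolating i)
isolating? i A = ¬? (i ∈? A) ⊎-dec (∣ A ∣ ℕ.≤? 1)

∈⇒1≤∣∣ : ∀ {n} {A : Subset n} {u} → u ∈ A → 1 ≤ ∣ A ∣
∈⇒1≤∣∣ {A = A} {u} u∈A = subst (_≤ ∣ A ∣) (Subset.∣⁅x⁆∣≡1 u)
  (Subset.p⊆q⇒∣p∣≤∣q∣ λ w∈ → subst (_∈ A) (sym (Subset.x∈⁅y⁆⇒x≡y u w∈)) u∈A)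

connected⇒¬isolated : ∀ {n m} (V : Vec (Subset (suc (suc n))) m) → Connected (Adjacent V) →
                      ∀ i → ¬ (∀ k → Isolating i (lookup V k))
connected⇒¬isolated {n} V conn i iso = absurd (conn i (proj₁ (two i))) (proj₂ (two i))
  where
  two : ∀ (i : Fin (suc (suc n))) → ∃[ j ] i ≢ j
  two zero    = suc zero , λ ()
  two (suc _) = zero , λ ()
  noEdge : ∀ {u} → ¬ Adjacent V i u
  noEdge {u} (i≢u , k , i∈A , u∈A) with iso k
  ... | inj₁ i∉A = i∉A i∈A
  -- Removing i from the set still leaves u, so the set has at least two elements.
  ... | inj₂ A≤1 = ℕ.<-irrefl refl (ℕ.<-≤-trans
          (ℕ.≤-<-trans (∈⇒1≤∣∣ (Subset.x∈p∧x≢y⇒x∈p-y u∈A (λ eq → i≢u (sym eq)))) (Subset.x∈p⇒∣p-x∣<∣p∣ i∈A)) A≤1)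
  absurd : ∀ {j} → Star (Adjacent V) i j → ¬ i ≢ j
  absurd Star.ε  i≢j = i≢j refl
  absurd (e ◅ _) _   = noEdge e

-- Moments of one random set

module _ {n} {g : Fin (suc n) → ℚ} (isPmf : IsPmf g) where
  open IsPmf isPmf renaming (nonneg to g≥0; total to ∑g)

  private
    xs = allFin (suc n)
    bigᵍ : Fin (suc n) → ℚ
    bigᵍ x = 𝟙 (big? x) * g x

  mom0 : mom g 0 ≡ ∑ xs bigᵍ
  mom0 = ∑-cong xs λ x → e (𝟙 (big? x)) (g x)
    where
    e : ∀ b g → b * (1ℚ * g) ≡ b * g
    e = solve-∀ ℚ-ring

  mom1 : mom g 1 ≡ ∑ xs (λ x → ⟦ toℕ x ⟧ * bigᵍ x)
  mom1 = ∑-cong xs λ x → trans (cong (λ k → 𝟙 (big? x) * (⟦ k ⟧ * g x)) (ℕ.*-identityʳ (toℕ x))) (e (𝟙 (big? x)) ⟦ toℕ x ⟧ (g x))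
    where
    e : ∀ b x g → b * (x * g) ≡ x * (b * g)
    e = solve-∀ ℚ-ring

  mom2 : mom g 2 ≡ ∑ xs (λ x → ⟦ toℕ x ⟧ * ⟦ toℕ x ⟧ * bigᵍ x)
  mom2 = ∑-cong xs λ x → trans (cong (λ k → 𝟙 (big? x) * (k * g x)) (trans (cong (λ k → ⟦ toℕ x ℕ.* k ⟧) (ℕ.*-identityʳ (toℕ x)))
      (⟦⟧-* (toℕ x) (toℕ x)))) (e (𝟙 (big? x)) ⟦ toℕ x ⟧ (g x))
    where
    e : ∀ b x g → b * (x * x * g) ≡ x * x * (b * g)
    e = solve-∀ ℚ-ring

  0≤mom : ∀ k → 0ℚ ≤ᵠ mom g k
  0≤mom k = ∑-nonneg xs λ x → 0≤* (0≤𝟙 (big? x)) (0≤* 0≤⟦ toℕ x ℕ.^ k ⟧ (g≥0 x))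

  mom-mono : ∀ {j k} → j ≤ k → mom g j ≤ᵠ mom g k
  mom-mono {j} {k} j≤k = ∑-mono xs go
    where
    go : ∀ x → 𝟙 (big? x) * (⟦ toℕ x ℕ.^ j ⟧ * g x) ≤ᵠ 𝟙 (big? x) * (⟦ toℕ x ℕ.^ k ⟧ * g x)
    go x with big? x
    ... | yes 2≤x = *-monoˡ 0≤1 (*-monoʳ (g≥0 x) (⟦⟧-mono (ℕ.^-monoʳ-≤ (toℕ x) {{ℕ.>-nonZero (ℕ.<⇒≤ 2≤x)}} j≤k)))
    ... | no _    = ℚ.≤-reflexive (trans (ℚ.*-zeroˡ (⟦ toℕ x ℕ.^ j ⟧ * g x)) (sym (ℚ.*-zeroˡ (⟦ toℕ x ℕ.^ k ⟧ * g x))))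

  ∑-linear : ∀ a b → ∑ xs (λ x → 𝟙 (big? x) * (⟦ toℕ x ⟧ * a - ⟦ toℕ x ⟧ * ⟦ toℕ x ⟧ * b) * g x) ≡ a * mom g 1 - b * mom g 2
  ∑-linear a b = trans (∑-cong xs λ x → e (𝟙 (big? x)) ⟦ toℕ x ⟧ (g x) a b)
    (trans (∑-+ xs (λ x → a * (⟦ toℕ x ⟧ * bigᵍ x)) (λ x → (- b) * (⟦ toℕ x ⟧ * ⟦ toℕ x ⟧ * bigᵍ x))) (cong₂ _+_
      (trans (∑-* xs a (λ x → ⟦ toℕ x ⟧ * bigᵍ x)) (cong (a *_) (sym mom1)))
      (trans (∑-* xs (- b) (λ x → ⟦ toℕ x ⟧ * ⟦ toℕ x ⟧ * bigᵍ x)) (trans (cong ((- b) *_) (sym mom2)) (sym (ℚ.neg-distribˡ-* b (mom g 2)))))))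
    where
    e : ∀ d x g a b → d * (x * a - x * x * b) * g ≡ a * (x * (d * g)) + (- b) * (x * x * (d * g))
    e = solve-∀ ℚ-ring

  ∑-constant : ∀ a → ∑ xs (λ x → 𝟙 (big? x) * a * g x) ≡ a * mom g 0
  ∑-constant a = trans (∑-cong xs λ x → e (𝟙 (big? x)) a (g x)) (trans (∑-* xs a bigᵍ) (cong (a *_) (sym mom0)))
    where
    e : ∀ d a g → d * a * g ≡ a * (d * g)
    e = solve-∀ ℚ-ring

  density-cases : ∀ {φ : Subset n → ℚ} {h : Fin (suc n) → ℚ} → (∀ A → φ A ≤ᵠ 1ℚ) →
    (∀ x → 2 ≤ toℕ x → count (toℕ x) φ ≤ᵠ (1ℚ - h x) * ⟦ n C toℕ x ⟧) →
    ∀ x → density φ x ≤ᵠ 1ℚ - 𝟙 (big? x) * h x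
  density-cases {φ} {h} φ≤1 bound x with big? x
  ... | yes 2≤x = subst (λ z → density φ x ≤ᵠ 1ℚ - z) (sym (ℚ.*-identityˡ (h x))) (density-≤ φ x (bound x 2≤x))
  ... | no _    = subst (λ z → density φ x ≤ᵠ 1ℚ - z) (sym (ℚ.*-zeroˡ (h x))) (density-≤ φ x
        (subst (count (toℕ x) φ ≤ᵠ_) (trans (count-1 {n} (toℕ x)) (sym (ℚ.*-identityˡ ⟦ n C toℕ x ⟧)))
          (count-mono (toℕ x) (λ A _ → φ≤1 A))))

  module _ (S : Subset n) {κ} (0≤κ : 0ℚ ≤ᵠ κ) (2κ≤1 : κ + κ ≤ᵠ 1ℚ) (κn : ⟦ ∣ S ∣ ⟧ ≡ κ * ⟦ n ⟧) where

    private
      κ≤1 : κ ≤ᵠ 1ℚ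
      κ≤1 = ℚ.≤-trans (≤-by κ 0≤κ refl) 2κ≤1

      -- The x-sets on either side of the cut are counted separately, and each side is a density
      -- bound of `C-ratio≤`.
      count-nonCrossing : ∀ x → count x (λ A → 𝟙 (nonCrossing? S A)) ≤ᵠ (κ ^ x + (1ℚ - κ) ^ x) * ⟦ n C x ⟧
      count-nonCrossing x = begin
        count x (λ A → 𝟙 (nonCrossing? S A))                           ≤⟨ count-mono x (λ A _ → 𝟙-⊎ (A ⊆? S) (A ⊆? ∁ S)) ⟩
        count x (λ A → 𝟙 (A ⊆? S) + 𝟙 (A ⊆? ∁ S))                      ≡⟨ count-+ x (λ A → 𝟙 (A ⊆? S)) (λ A → 𝟙 (A ⊆? ∁ S)) ⟩
        count x (λ A → 𝟙 (A ⊆? S)) + count x (λ A → 𝟙 (A ⊆? ∁ S))      ≡⟨ cong₂ _+_ (count-⊆ S x) (count-⊆ (∁ S) x) ⟩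
        ⟦ ∣ S ∣ C x ⟧ + ⟦ ∣ ∁ S ∣ C x ⟧
          ≤⟨ ℚ.+-mono-≤ (C-ratio≤ 0≤κ κ≤1 ∣ S ∣ n x (ℚ.≤-reflexive κn))
                        (C-ratio≤ (0≤∸ κ≤1) (≤-by κ 0≤κ (e₁ κ)) ∣ ∁ S ∣ n x (ℚ.≤-reflexive ∁κn)) ⟩
        κ ^ x * ⟦ n C x ⟧ + (1ℚ - κ) ^ x * ⟦ n C x ⟧                   ≡⟨ ℚ.*-distribʳ-+ ⟦ n C x ⟧ (κ ^ x) ((1ℚ - κ) ^ x) ⟨
        (κ ^ x + (1ℚ - κ) ^ x) * ⟦ n C x ⟧                             ∎
        where
        open ℚ.≤-Reasoning
        e₁ : ∀ k → 1ℚ - k + k ≡ 1ℚ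
        e₁ = solve-∀ ℚ-ring
        e₂ : ∀ k n c → n ≡ k * n + c → c ≡ (1ℚ - k) * n
        e₂ k n c eq = trans (e₃ (k * n) c) (trans (cong (_- k * n) (sym eq)) (e₄ k n))
          where
          e₃ : ∀ a c → c ≡ a + c - a
          e₃ = solve-∀ ℚ-ring
          e₄ : ∀ k n → n - k * n ≡ (1ℚ - k) * n
          e₄ = solve-∀ ℚ-ring
        ∁κn : ⟦ ∣ ∁ S ∣ ⟧ ≡ (1ℚ - κ) * ⟦ n ⟧
        ∁κn = e₂ κ ⟦ n ⟧ ⟦ ∣ ∁ S ∣ ⟧ (trans (cong ⟦_⟧ (trans (sym (ℕ.m+[n∸m]≡n (∣p∣≤n S))) (cong (∣ S ∣ ℕ.+_) (sym (Subset.∣∁p∣≡n∸∣p∣ S)))))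
          (trans (⟦⟧-+ ∣ S ∣ ∣ ∁ S ∣) (cong (_+ ⟦ ∣ ∁ S ∣ ⟧) κn)))

    -- Precise for small κ, where the full coefficient of κ M₁ is needed against log n.
    𝔼₁-nonCrossing₁ : 𝔼₁ isPmf (λ A → 𝟙 (nonCrossing? S A)) ≤ᵠ 1ℚ - (κ * mom g 1 - κ * κ * mom g 2)
    𝔼₁-nonCrossing₁ = subst (λ z → _ ≤ᵠ 1ℚ - z) (∑-linear κ (κ * κ))
      (𝔼₁-≤ isPmf (λ A → 𝟙 (nonCrossing? S A)) (λ x → ⟦ toℕ x ⟧ * κ - ⟦ toℕ x ⟧ * ⟦ toℕ x ⟧ * (κ * κ)) (density-cases (λ A → 𝟙≤1 (nonCrossing? S A)) λ x 2≤x →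
        ℚ.≤-trans (count-nonCrossing (toℕ x)) (*-monoʳ 0≤⟦ n C toℕ x ⟧ (split-bound₁ 0≤κ κ≤1 (toℕ x) 2≤x))))

    -- Free of a quadratic loss, hence useful up to κ = ½, at the price of M₀ in place of M₁.
    𝔼₁-nonCrossing₂ : 𝔼₁ isPmf (λ A → 𝟙 (nonCrossing? S A)) ≤ᵠ 1ℚ - κ * mom g 0
    𝔼₁-nonCrossing₂ = subst (λ z → _ ≤ᵠ 1ℚ - z) (∑-constant κ)
      (𝔼₁-≤ isPmf (λ A → 𝟙 (nonCrossing? S A)) (λ _ → κ) (density-cases (λ A → 𝟙≤1 (nonCrossing? S A)) λ x 2≤x →
        ℚ.≤-trans (count-nonCrossing (toℕ x)) (*-monoʳ 0≤⟦ n C toℕ x ⟧ (split-bound₂ 0≤κ κ≤1 2κ≤1 (toℕ x) 2≤x))))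

module _ {n′} {g : Fin (suc (suc n′)) → ℚ} (isPmf : IsPmf g) where

  private
    n : ℕ
    n = suc n′

  private
    avoid? : ∀ (i : Fin n) A → Dec (A ⊆ ∁ ⁅ i ⁆)
    avoid? i A = A ⊆? ∁ ⁅ i ⁆

    ∣∁⁅i⁆∣ : ∀ i → ∣ ∁ ⁅ i ⁆ ∣ ≡ n′
    ∣∁⁅i⁆∣ i = trans (Subset.∣∁p∣≡n∸∣p∣ ⁅ i ⁆) (cong (n ℕ.∸_) (Subset.∣⁅x⁆∣≡1 i))

    isolating⇒∉ : ∀ {i : Fin n} {A} → 2 ≤ ∣ A ∣ → Isolating i A → i ∉ A
    isolating⇒∉ 2≤A (inj₁ i∉A) = i∉A
    isolating⇒∉ 2≤A (inj₂ A≤1) = contradiction (ℕ.≤-trans 2≤A A≤1) (ℕ.<-irrefl refl)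

    ∉⇒⊆∁ : ∀ {i : Fin n} {A} → i ∉ A → A ⊆ ∁ ⁅ i ⁆
    ∉⇒⊆∁ {i} {A} i∉A {u} u∈A = Subset.x∉p⇒x∈∁p λ u∈ → i∉A (subst (_∈ A) (Subset.x∈⁅y⁆⇒x≡y i u∈) u∈A)

    ⊆∁⇒∉ : ∀ {i : Fin n} {A} → A ⊆ ∁ ⁅ i ⁆ → i ∉ A
    ⊆∁⇒∉ {i} A⊆ i∈A = Subset.x∈∁p⇒x∉p (A⊆ i∈A) (Subset.x∈⁅x⁆ i)

  -- An x-set with x ≥ 2 isolates i exactly when it avoids i, which has probability 1 - x/n; smaller
  -- sets always do. Equality matters, since Chebyshev's inequality uses the exact mean.
  𝔼₁-isolating : ∀ i → 𝔼₁ isPmf (λ A → 𝟙 (isolating? i A)) ≡ 1ℚ - r n′ * mom g 1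
  𝔼₁-isolating i = trans (𝔼₁-≡ isPmf φ h dens) (cong (λ z → 1ℚ - z)
    (trans (∑-cong (allFin (suc n)) λ x → e (𝟙 (big? x)) ⟦ toℕ x ⟧ (r n′) (g x)) (trans (∑-linear isPmf (r n′) 0ℚ) (e′ (r n′ * mom g 1) (mom g 2)))))
    where
    φ = λ A → 𝟙 (isolating? i A)
    h : Fin (suc n) → ℚ
    h x = ⟦ toℕ x ⟧ * r n′
    e : ∀ b x r g → b * (x * r) * g ≡ b * (x * r - x * x * 0ℚ) * g
    e = solve-∀ ℚ-ring
    e′ : ∀ a b → a - 0ℚ * b ≡ a
    e′ = solve-∀ ℚ-ring
    e₁ : ∀ c n r → c ≡ c * n * r + (1ℚ - r * n) * c
    e₁ = solve-∀ ℚ-ring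
    dens : ∀ x → density φ x ≡ 1ℚ - 𝟙 (big? x) * h x
    dens x with big? x
    ... | yes 2≤x = trans (density-≡ φ x (trans (count-cong (toℕ x) (λ A A≡x → 𝟙-cong (isolating? i A) (avoid? i A)
                        (λ iso → ∉⇒⊆∁ (isolating⇒∉ (subst (2 ≤_) (sym A≡x) 2≤x) iso)) (λ A⊆ → inj₁ (⊆∁⇒∉ A⊆))))
                    (trans (count-⊆ (∁ ⁅ i ⁆) (toℕ x)) (trans (cong (λ s → ⟦ s C toℕ x ⟧) (∣∁⁅i⁆∣ i)) (c≡ (toℕ x))))))
                    (cong (λ z → 1ℚ - z) (sym (ℚ.*-identityˡ (h x))))
      where
      c≡ : ∀ x → ⟦ n′ C x ⟧ ≡ (1ℚ - ⟦ x ⟧ * r n′) * ⟦ n C x ⟧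
      c≡ x = trans (e₁ ⟦ n′ C x ⟧ ⟦ n ⟧ (r n′)) (trans (cong₂ (λ a b → a * r n′ + (1ℚ - b) * ⟦ n′ C x ⟧) (C-pred n′ x) (r-* n′))
        (trans (e₂ ⟦ n ⟧ ⟦ x ⟧ ⟦ n C x ⟧ (r n′) ⟦ n′ C x ⟧) (cong (λ z → (z - ⟦ x ⟧ * r n′) * ⟦ n C x ⟧) (r-* n′))))
        where
        e₂ : ∀ n x c r d → (n - x) * c * r + (1ℚ - 1ℚ) * d ≡ (r * n - x * r) * c
        e₂ = solve-∀ ℚ-ring
    ... | no 2≰x  = trans (density-≡ φ x {1ℚ} (trans (count-cong (toℕ x) (λ A A≡x → 𝟙-yes (isolating? i A)
                        (inj₂ (ℕ.≤-pred (ℕ.≰⇒> (subst (λ s → ¬ 2 ≤ s) (sym A≡x) 2≰x))))))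
                    (trans (count-1 {n} (toℕ x)) (sym (ℚ.*-identityˡ _)))))
                    (cong (λ z → 1ℚ - z) (sym (ℚ.*-zeroˡ (h x))))

  -- A set with at least two elements must avoid both i and j, that is, lie in the remaining nodes,
  -- whose density is at most 1 - κ with κ = 2/n. The hypothesis 1 ≤ n′ ensures κ ≤ 1.
  𝔼₁-isolating₂ : 1 ≤ n′ → ∀ {i j} → i ≢ j → 𝔼₁ isPmf (λ A → 𝟙 (isolating? i A) * 𝟙 (isolating? j A)) ≤ᵠ
    1ℚ - (⟦ 2 ⟧ * r n′ * mom g 1 - ⟦ 2 ⟧ * r n′ * (⟦ 2 ⟧ * r n′) * mom g 2)
  𝔼₁-isolating₂ 1≤n′ {i} {j} i≢j = subst (λ z → 𝔼₁ isPmf φ ≤ᵠ 1ℚ - z) (∑-linear isPmf κ (κ * κ))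
    (𝔼₁-≤ isPmf φ (λ x → ⟦ toℕ x ⟧ * κ - ⟦ toℕ x ⟧ * ⟦ toℕ x ⟧ * (κ * κ)) (density-cases isPmf
      (λ A → *-mono (0≤𝟙 (isolating? i A)) 0≤1 (𝟙≤1 (isolating? i A)) (𝟙≤1 (isolating? j A)))
      λ x 2≤x → begin
        count (toℕ x) φ                              ≤⟨ count-mono (toℕ x) (λ A A≡x → φ≤ A (subst (2 ≤_) (sym A≡x) 2≤x)) ⟩
        count (toℕ x) (λ A → 𝟙 (A ⊆? S))             ≡⟨ count-⊆ S (toℕ x) ⟩
        ⟦ ∣ S ∣ C toℕ x ⟧                            ≤⟨ C-ratio≤ (0≤∸ κ≤1) (≤-by κ 0≤κ (e₁ κ)) ∣ S ∣ n (toℕ x) S≤ ⟩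
        (1ℚ - κ) ^ toℕ x * ⟦ n C toℕ x ⟧             ≤⟨ *-monoʳ 0≤⟦ n C toℕ x ⟧ ([1-κ]^x≤ 0≤κ κ≤1 (toℕ x)) ⟩
        _                                            ∎))
    where
    open ℚ.≤-Reasoning
    φ = λ A → 𝟙 (isolating? i A) * 𝟙 (isolating? j A)
    κ = ⟦ 2 ⟧ * r n′
    S = ∁ ⁅ i ⁆ ∖ j
    e₁ : ∀ k → 1ℚ - k + k ≡ 1ℚ
    e₁ = solve-∀ ℚ-ring
    0≤κ : 0ℚ ≤ᵠ κ
    0≤κ = 0≤* 0≤⟦ 2 ⟧ (0≤r n′)
    κn : κ * ⟦ n ⟧ ≡ ⟦ 2 ⟧
    κn = trans (ℚ.*-assoc ⟦ 2 ⟧ (r n′) ⟦ n ⟧) (trans (cong (⟦ 2 ⟧ *_) (r-* n′)) (ℚ.*-identityʳ ⟦ 2 ⟧))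
    κ≤1 : κ ≤ᵠ 1ℚ
    κ≤1 = *-cancelʳ 0<⟦ n ⟧ (subst₂ _≤ᵠ_ (sym κn) (sym (ℚ.*-identityˡ ⟦ n ⟧)) (⟦⟧-mono (s≤s 1≤n′)))
    j∈ : j ∈ ∁ ⁅ i ⁆
    j∈ = Subset.x∉p⇒x∈∁p (Subset.x≢y⇒x∉⁅y⁆ (λ eq → i≢j (sym eq)))
    2+S≤ : 2 ℕ.+ ∣ S ∣ ≤ n
    2+S≤ = s≤s (subst (suc ∣ S ∣ ≤_) (∣∁⁅i⁆∣ i) (Subset.x∈p⇒∣p-x∣<∣p∣ j∈))
    S≤ : ⟦ ∣ S ∣ ⟧ ≤ᵠ (1ℚ - κ) * ⟦ n ⟧
    S≤ = ≤-by (⟦ n ⟧ - (⟦ 2 ⟧ + ⟦ ∣ S ∣ ⟧)) (0≤∸ (subst (_≤ᵠ ⟦ n ⟧) (⟦⟧-+ 2 ∣ S ∣) (⟦⟧-mono 2+S≤)))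
      (trans (e₂ ⟦ ∣ S ∣ ⟧ ⟦ n ⟧ ⟦ 2 ⟧) (trans (cong (λ z → ⟦ n ⟧ - z) (sym κn)) (e₃ κ ⟦ n ⟧)))
      where
      e₂ : ∀ s n t → s + (n - (t + s)) ≡ n - t
      e₂ = solve-∀ ℚ-ring
      e₃ : ∀ k n → n - k * n ≡ (1ℚ - k) * n
      e₃ = solve-∀ ℚ-ring
    φ≤ : ∀ A → 2 ≤ ∣ A ∣ → φ A ≤ᵠ 𝟙 (A ⊆? S)
    φ≤ A 2≤A with isolating? i A | isolating? j A
    ... | yes p | yes q = ℚ.≤-reflexive (sym (𝟙-yes (A ⊆? S) λ {u} u∈A → Subset.x∈p∧x≢y⇒x∈p-y
                            (∉⇒⊆∁ (isolating⇒∉ 2≤A p) u∈A) λ { refl → isolating⇒∉ 2≤A q u∈A }))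
    ... | yes _ | no _  = 0≤𝟙 (A ⊆? S)
    ... | no _  | yes _ = 0≤𝟙 (A ⊆? S)
    ... | no _  | no _  = 0≤𝟙 (A ⊆? S)

-- The connected regime

-- Small cuts need the summand K + D + 3, large cuts the summand 2K² + KD + 1.
halfSlack slack : ℕ → ℕ → ℚ
halfSlack K D = ⟦ K ⟧ + ⟦ D ⟧ + ⟦ 3 ⟧ + (⟦ 2 ⟧ * (⟦ K ⟧ * ⟦ K ⟧) + ⟦ K ⟧ * ⟦ D ⟧ + 1ℚ)
slack K D     = halfSlack K D + halfSlack K D

-- For a cut of size k let κ = k/n and let ρ be the probability that one random set
-- does not cross it. Cuts with 2Kk ≤ n are handled by ρ ≤ 1 - κ M₁ + κ² M₂ and
-- C(n,k) ≤ (en/k)ᵏ, larger ones by ρ ≤ 1 - κ M₀ and C(n,k) ≤ 2ⁿ.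
module Cut {n′} {g : Fin (suc (suc n′)) → ℚ} (isPmf : IsPmf g) (m K D : ℕ) (1≤K : 1 ≤ K)
  (sparse : Sparse m K g)
  where

  private
    n : ℕ
    n = suc n′

    b B lam : ℚ
    b   = halfSlack K D
    B   = slack K D
    lam = rate m g

  module _ (dense : H n + B ≤ᵠ lam) {j} (S : Subset n) (S≡k : ∣ S ∣ ≡ suc j) (2k≤n : 2 ℕ.* suc j ≤ n) where

    private
      k : ℕ
      k = suc j

      κ ρ : ℚ
      κ = ⟦ k ⟧ * r n′
      ρ = 𝔼₁ isPmf (λ A → 𝟙 (nonCrossing? S A))

      0≤ρ : 0ℚ ≤ᵠ ρ
      0≤ρ = 𝔼₁-nonneg isPmf λ A → 0≤𝟙 (nonCrossing? S A)

      κn : κ * ⟦ n ⟧ ≡ ⟦ k ⟧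
      κn = trans (ℚ.*-assoc ⟦ k ⟧ (r n′) ⟦ n ⟧) (trans (cong (⟦ k ⟧ *_) (r-* n′)) (ℚ.*-identityʳ ⟦ k ⟧))

      0≤κ : 0ℚ ≤ᵠ κ
      0≤κ = 0≤* 0≤⟦ k ⟧ (0≤r n′)

      c*κ≤1 : ∀ c → c ℕ.* k ≤ n → ⟦ c ⟧ * κ ≤ᵠ 1ℚ
      c*κ≤1 c ck≤n = *-cancelʳ 0<⟦ n ⟧ (subst₂ _≤ᵠ_
        (trans (⟦⟧-* c k) (trans (cong (⟦ c ⟧ *_) (sym κn)) (sym (ℚ.*-assoc ⟦ c ⟧ κ ⟦ n ⟧))))
        (sym (ℚ.*-identityˡ ⟦ n ⟧)) (⟦⟧-mono ck≤n))

      2κ≤1 : κ + κ ≤ᵠ 1ℚ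
      2κ≤1 = subst (_≤ᵠ 1ℚ) (e κ) (c*κ≤1 2 2k≤n)
        where
        e : ∀ k → ⟦ 2 ⟧ * k ≡ k + k
        e = solve-∀ ℚ-ring

      κ≤1 : κ ≤ᵠ 1ℚ
      κ≤1 = ℚ.≤-trans (≤-by κ 0≤κ refl) 2κ≤1

      S≡κn : ⟦ ∣ S ∣ ⟧ ≡ κ * ⟦ n ⟧
      S≡κn = trans (cong ⟦_⟧ S≡k) (sym κn)

      k≤n : k ≤ n
      k≤n = ℕ.≤-trans (ℕ.m≤m+n k _) 2k≤n

      ρ^≤exp : ∀ s → ρ ≤ᵠ 1ℚ - s → ρ ^ m ≤exp ⟦ m ⟧ * - s
      ρ^≤exp s h = ≤exp-^ m (≤exp-mono 0≤ρ h ℚ.≤-refl (1+t≤exp (ℚ.≤-trans 0≤ρ h)))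

      D^≤exp : ⟦ suc D ⟧ ^ k ≤exp ⟦ k ⟧ * ⟦ D ⟧
      D^≤exp = ≤exp-^ k (≤exp-resp (sym (⟦⟧-suc D)) refl (1+t≤exp (0≤+ 0≤1 0≤⟦ D ⟧)))

      C≤exp : ∀ {y} → 0ℚ ≤ᵠ y → ⟦ n C k ⟧ * y ^ k ≤exp ⟦ n ⟧ * y
      C≤exp {y} 0≤y = ≤exp-mono (0≤* 0≤⟦ n C k ⟧ (^-nonneg k 0≤y)) (C*y^k≤[1+y]^n 0≤y n k) ℚ.≤-refl
        (≤exp-^ n (1+t≤exp (0≤+ 0≤1 0≤y)))

      -- Taking y = k/n gives C(n,k)(k/n)^k ≤ e^k; multiplying by (n/k)^k cancels the power.
      C≤expH : ⟦ n C k ⟧ ≤exp ⟦ k ⟧ + ⟦ k ⟧ * (1ℚ + (H n - H k))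
      C≤expH = ≤exp-resp
        (trans (ℚ.*-assoc ⟦ n C k ⟧ (κ ^ k) ((⟦ n ⟧ * r j) ^ k)) (trans (cong (⟦ n C k ⟧ *_)
          (trans (sym (^-distrib-* κ (⟦ n ⟧ * r j) k)) (trans (cong (_^ k) one) (1^ k)))) (ℚ.*-identityʳ ⟦ n C k ⟧)))
        (cong (_+ ⟦ k ⟧ * (1ℚ + (H n - H k))) (trans (ℚ.*-comm ⟦ n ⟧ κ) κn))
        (≤exp-* (C≤exp 0≤κ) (≤exp-^ k (n/k≤exp k≤n)))
        where
        one : κ * (⟦ n ⟧ * r j) ≡ 1ℚ
        one = trans (sym (ℚ.*-assoc κ ⟦ n ⟧ (r j))) (trans (cong (_* r j) κn) (trans (ℚ.*-comm ⟦ k ⟧ (r j)) (r-* j)))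

      κmM≡kλ : κ * (⟦ m ⟧ * mom g 1) ≡ ⟦ k ⟧ * lam
      κmM≡kλ = e ⟦ k ⟧ (r n′) ⟦ m ⟧ (mom g 1)
        where
        e : ∀ k r m M → k * r * (m * M) ≡ k * (m * r * M)
        e = solve-∀ ℚ-ring

      0≤H∸ : 0ℚ ≤ᵠ lam - (H n + B)
      0≤H∸ = 0≤∸ dense

      sparse₁ : ⟦ m ⟧ * mom g 2 ≤ᵠ ⟦ K ⟧ * (⟦ m ⟧ * mom g 1) + 1ℚ
      sparse₁ = ℚ.≤-trans sparse (ℚ.+-monoˡ-≤ 1ℚ (*-monoˡ 0≤⟦ K ⟧ (*-monoˡ 0≤⟦ m ⟧ (mom-mono isPmf {0} {1} z≤n))))

    -- The factor (D + 1)^k makes the union bound summable: the C(n,k) cuts of size k together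
    -- contribute at most (D + 1)^(-k).
    smallCut : 2 ℕ.* K ℕ.* k ≤ n → ρ ^ m * (⟦ n C k ⟧ * ⟦ suc D ⟧ ^ k) ≤ᵠ 1ℚ
    smallCut 2Kk≤n = ≤exp⇒≤1 (≤exp-* (ρ^≤exp (κ * mom g 1 - κ * κ * mom g 2) (𝔼₁-nonCrossing₁ isPmf S 0≤κ 2κ≤1 S≡κn))
        (≤exp-* C≤expH D^≤exp))
      (≤-by d 0≤d (trans (e₁ ⟦ k ⟧ κ ⟦ K ⟧ ⟦ D ⟧ ⟦ m ⟧ (mom g 1) (mom g 2) (H n) (H k) lam b∸)
        (trans (cong (λ z → (⟦ k ⟧ * lam - z) * (1ℚ - ⟦ K ⟧ * κ)) κmM≡kλ) (e₂ (⟦ k ⟧ * lam) (1ℚ - ⟦ K ⟧ * κ)))))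
      where
      Kκ≤1 : ⟦ K ⟧ * κ ≤ᵠ 1ℚ
      Kκ≤1 = c*κ≤1 K (ℕ.≤-trans (ℕ.*-monoˡ-≤ k (ℕ.m≤m+n K _)) 2Kk≤n)
      2Kκ≤1 : ⟦ 2 ⟧ * (⟦ K ⟧ * κ) ≤ᵠ 1ℚ
      2Kκ≤1 = subst (_≤ᵠ 1ℚ) (trans (cong (_* κ) (⟦⟧-* 2 K)) (ℚ.*-assoc ⟦ 2 ⟧ ⟦ K ⟧ κ)) (c*κ≤1 (2 ℕ.* K) 2Kk≤n)
      κ-gap : κ * (H n - H k) ≤ᵠ 1ℚ
      κ-gap = *-cancelʳ 0<⟦ n ⟧ (subst₂ _≤ᵠ_
        (trans (cong (_* (H n - H k)) (sym κn)) (e₀ κ ⟦ n ⟧ (H n - H k))) (sym (ℚ.*-identityˡ ⟦ n ⟧)) (H-gap k≤n))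
        where
        e₀ : ∀ a n h → a * n * h ≡ a * h * n
        e₀ = solve-∀ ℚ-ring
      κ²≤1 : κ * κ ≤ᵠ 1ℚ
      κ²≤1 = *-mono 0≤κ 0≤1 κ≤1 κ≤1
      b∸ = ⟦ 2 ⟧ * (⟦ K ⟧ * ⟦ K ⟧) + ⟦ K ⟧ * ⟦ D ⟧ + 1ℚ
      0≤b∸ : 0ℚ ≤ᵠ b∸
      0≤b∸ = 0≤+ (0≤+ (0≤* 0≤⟦ 2 ⟧ (0≤* 0≤⟦ K ⟧ 0≤⟦ K ⟧)) (0≤* 0≤⟦ K ⟧ 0≤⟦ D ⟧)) 0≤1
      0≤b : 0ℚ ≤ᵠ b
      0≤b = 0≤+ (0≤+ (0≤+ 0≤⟦ K ⟧ 0≤⟦ D ⟧) 0≤⟦ 3 ⟧) 0≤b∸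
      -- With κ m M₁ = kλ the exponent is at most -kλ(1 - Kκ) + κ² + k(2 + D + Hₙ - Hₖ). Inserting λ
      -- ≥ Hₙ + B leaves kKκ Hₙ, which is split at Hₖ: the part beyond it costs at most kK, and kKκ
      -- Hₖ is paid by -k Hₖ. As 1 - Kκ ≥ ½, half of `slack` survives, which is `b`: its K pays for
      -- this loss, its D for (D + 1)^k, its 3 for the 2 and for κ² ≤ k.
      rest = (1ℚ - κ * κ) + ⟦ k ⟧ * (1ℚ - ⟦ K ⟧ * κ) * (lam - (H n + B)) + ⟦ k ⟧ * ⟦ K ⟧ * (1ℚ - κ * (H n - H k))
             + ⟦ k ⟧ * H k * (1ℚ - ⟦ K ⟧ * κ) + ⟦ k ⟧ * b * (1ℚ - ⟦ 2 ⟧ * (⟦ K ⟧ * κ)) + ⟦ k ⟧ * b∸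
      d = κ * κ * (⟦ K ⟧ * (⟦ m ⟧ * mom g 1) + 1ℚ - ⟦ m ⟧ * mom g 2) + (⟦ k ⟧ - 1ℚ) + rest
      0≤rest : 0ℚ ≤ᵠ rest
      0≤rest = 0≤+ (0≤+ (0≤+ (0≤+ (0≤+ (0≤∸ κ²≤1) (0≤* (0≤* 0≤⟦ k ⟧ (0≤∸ Kκ≤1)) 0≤H∸)) (0≤* (0≤* 0≤⟦ k ⟧ 0≤⟦ K ⟧) (0≤∸ κ-gap)))
        (0≤* (0≤* 0≤⟦ k ⟧ (0≤H k)) (0≤∸ Kκ≤1))) (0≤* (0≤* 0≤⟦ k ⟧ 0≤b) (0≤∸ 2Kκ≤1))) (0≤* 0≤⟦ k ⟧ 0≤b∸)
      0≤d : 0ℚ ≤ᵠ d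
      0≤d = 0≤+ (0≤+ (0≤* (0≤* 0≤κ 0≤κ) (0≤∸ sparse₁)) (0≤∸ 1≤⟦ k ⟧)) 0≤rest
      e₁ : ∀ k κ K D m M₁ M₂ h h′ l c →
        m * - (κ * M₁ - κ * κ * M₂) + (k + k * (1ℚ + (h - h′)) + k * D) +
        (κ * κ * (K * (m * M₁) + 1ℚ - m * M₂) + (k - 1ℚ) +
         ((1ℚ - κ * κ) + k * (1ℚ - K * κ) * (l - (h + ((K + D + ⟦ 3 ⟧ + c) + (K + D + ⟦ 3 ⟧ + c))))
           + k * K * (1ℚ - κ * (h - h′)) + k * h′ * (1ℚ - K * κ)
           + k * (K + D + ⟦ 3 ⟧ + c) * (1ℚ - ⟦ 2 ⟧ * (K * κ)) + k * c))
        ≡ (k * l - κ * (m * M₁)) * (1ℚ - K * κ)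
      e₁ = solve-∀ ℚ-ring
      e₂ : ∀ a c → (a - a) * c ≡ 0ℚ
      e₂ = solve-∀ ℚ-ring

    -- Taking y = 1 bounds C(n,k) by eⁿ. The exponent is multiplied by K because M₁ enters through m
    -- M₁ ≤ m M₂ ≤ K m M₀ + 1; then kλ has to cover κ + Kn + KkD, at most k(1 + 2K² + KD).
    largeCut : n ≤ 2 ℕ.* K ℕ.* k → ρ ^ m * (⟦ n C k ⟧ * ⟦ suc D ⟧ ^ k) ≤ᵠ 1ℚ
    largeCut n≤2Kk = ≤exp⇒≤1 (≤exp-* (ρ^≤exp (κ * mom g 0) (𝔼₁-nonCrossing₂ isPmf S 0≤κ 2κ≤1 S≡κn))
        (≤exp-* (≤exp-resp (trans (cong (⟦ n C k ⟧ *_) (1^ k)) (ℚ.*-identityʳ ⟦ n C k ⟧)) (ℚ.*-identityʳ ⟦ n ⟧) (C≤exp 0≤1)) D^≤exp))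
      (*-cancelʳ {z = ⟦ K ⟧} (0<⟦_⟧ K {{ℕ.>-nonZero 1≤K}}) (≤-by d 0≤d
        (trans (e₁ ⟦ k ⟧ κ ⟦ K ⟧ ⟦ D ⟧ ⟦ m ⟧ (mom g 0) (mom g 1) (mom g 2) (H n) lam ⟦ n ⟧)
          (trans (cong (λ z → ⟦ k ⟧ * lam - z) κmM≡kλ) (e₂ (⟦ k ⟧ * lam) ⟦ K ⟧)))))
      where
      excess = ⟦ K ⟧ + ⟦ D ⟧ + ⟦ 3 ⟧ + b
      0≤3 = 0≤+ (0≤+ 0≤⟦ K ⟧ 0≤⟦ D ⟧) 0≤⟦ 3 ⟧
      0≤excess : 0ℚ ≤ᵠ excess
      0≤excess = 0≤+ 0≤3 (0≤+ 0≤3 (0≤+ (0≤+ (0≤* 0≤⟦ 2 ⟧ (0≤* 0≤⟦ K ⟧ 0≤⟦ K ⟧)) (0≤* 0≤⟦ K ⟧ 0≤⟦ D ⟧)) 0≤1))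
      n≤ : ⟦ n ⟧ ≤ᵠ ⟦ 2 ⟧ * ⟦ K ⟧ * ⟦ k ⟧
      n≤ = subst (⟦ n ⟧ ≤ᵠ_) (trans (⟦⟧-* (2 ℕ.* K) k) (cong (_* ⟦ k ⟧) (⟦⟧-* 2 K))) (⟦⟧-mono n≤2Kk)
      M₁≤M₂ : ⟦ m ⟧ * mom g 1 ≤ᵠ ⟦ m ⟧ * mom g 2
      M₁≤M₂ = *-monoˡ 0≤⟦ m ⟧ (mom-mono isPmf {1} {2} (s≤s z≤n))
      d = κ * (⟦ K ⟧ * (⟦ m ⟧ * mom g 0) + 1ℚ - ⟦ m ⟧ * mom g 2) + κ * (⟦ m ⟧ * mom g 2 - ⟦ m ⟧ * mom g 1)
          + ⟦ k ⟧ * (lam - (H n + B)) + ⟦ k ⟧ * H n + (⟦ k ⟧ - κ) + ⟦ K ⟧ * (⟦ 2 ⟧ * ⟦ K ⟧ * ⟦ k ⟧ - ⟦ n ⟧) + ⟦ k ⟧ * excess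
      0≤d : 0ℚ ≤ᵠ d
      0≤d = 0≤+ (0≤+ (0≤+ (0≤+ (0≤+ (0≤+ (0≤* 0≤κ (0≤∸ sparse)) (0≤* 0≤κ (0≤∸ M₁≤M₂))) (0≤* 0≤⟦ k ⟧ 0≤H∸))
        (0≤* 0≤⟦ k ⟧ (0≤H n))) (0≤∸ (ℚ.≤-trans κ≤1 1≤⟦ k ⟧))) (0≤* 0≤⟦ K ⟧ (0≤∸ n≤))) (0≤* 0≤⟦ k ⟧ 0≤excess)
      e₁ : ∀ k κ K D m M₀ M₁ M₂ h l n →
        (m * - (κ * M₀) + (n + k * D)) * K +
        (κ * (K * (m * M₀) + 1ℚ - m * M₂) + κ * (m * M₂ - m * M₁)
          + k * (l - (h + ((K + D + ⟦ 3 ⟧ + (⟦ 2 ⟧ * (K * K) + K * D + 1ℚ)) + (K + D + ⟦ 3 ⟧ + (⟦ 2 ⟧ * (K * K) + K * D + 1ℚ))))) + k * h + (k - κ) + K * (⟦ 2 ⟧ * K * k - n)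
          + k * (K + D + ⟦ 3 ⟧ + (K + D + ⟦ 3 ⟧ + (⟦ 2 ⟧ * (K * K) + K * D + 1ℚ))))
        ≡ k * l - κ * (m * M₁)
      e₁ = solve-∀ ℚ-ring
      e₂ : ∀ a K → a - a ≡ 0ℚ * K
      e₂ = solve-∀ ℚ-ring

    uncrossed-bound : ρ ^ m * (⟦ n C k ⟧ * ⟦ suc D ⟧ ^ k) ≤ᵠ 1ℚ
    uncrossed-bound = [ smallCut , largeCut ]′ (ℕ.≤-total (2 ℕ.* K ℕ.* k) n)

-- The union bound over cuts

𝟙*≤ : ∀ {P : Set} (p? : Dec P) {x y} → 0ℚ ≤ᵠ y → (P → x ≤ᵠ y) → 𝟙 p? * x ≤ᵠ y
𝟙*≤ (yes p) {x} {y} 0≤y h = subst (_≤ᵠ y) (sym (ℚ.*-identityˡ x)) (h p)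
𝟙*≤ (no _)  {x} {y} 0≤y h = subst (_≤ᵠ y) (sym (ℚ.*-zeroˡ x)) 0≤y

probConnected : ∀ {n} (g : Fin (suc n) → ℚ) (m : ℕ) → ℚ
probConnected {n} g m = ∑ (vectors (allSubsets n) m) (λ V → prodᵛ (weight g) V * 𝟙 (intersectionGraphConnected? V))

module _ {n} {g : Fin (suc n) → ℚ} (isPmf : IsPmf g) (m : ℕ) where

  probConnected-nonneg : 0ℚ ≤ᵠ probConnected g m
  probConnected-nonneg = 𝔼-nonneg isPmf m λ V → 0≤𝟙 (intersectionGraphConnected? V)

  probConnected≤1 : probConnected g m ≤ᵠ 1ℚ
  probConnected≤1 = subst (probConnected g m ≤ᵠ_) (𝔼-1 isPmf m) (𝔼-mono isPmf m λ V → 𝟙≤1 (intersectionGraphConnected? V))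

  -- For a disconnected outcome the search over all subsets must find an uncrossed small side, by
  -- `allCutsCrossed⇒connected`, and the term of that side alone equals 1.
  union-bound : 1ℚ ≤ᵠ probConnected g m +
    ∑ (allSubsets n) (λ S → 𝟙 (smallSide? S) * 𝔼₁ isPmf (λ A → 𝟙 (nonCrossing? S A)) ^ m)
  union-bound = begin
    1ℚ                                                                   ≡⟨ 𝔼-1 isPmf m ⟨
    𝔼 isPmf m (λ _ → 1ℚ)                                                 ≤⟨ 𝔼-mono isPmf m pointwise ⟩
    𝔼 isPmf m (λ V → 𝟙 (intersectionGraphConnected? V) + ∑ (allSubsets n) (λ S → cutTerm S V))
      ≡⟨ 𝔼-+ isPmf m (λ V → 𝟙 (intersectionGraphConnected? V)) (λ V → ∑ (allSubsets n) (λ S → cutTerm S V)) ⟩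
    probConnected g m + 𝔼 isPmf m (λ V → ∑ (allSubsets n) (λ S → cutTerm S V))
      ≡⟨ cong (λ z → probConnected g m + z) (trans (𝔼-∑ isPmf m (allSubsets n) cutTerm)
           (∑-cong (allSubsets n) λ S → trans (𝔼-* isPmf m (𝟙 (smallSide? S)) (prodᵛ (λ A → 𝟙 (nonCrossing? S A))))
             (cong (𝟙 (smallSide? S) *_) (𝔼-prod isPmf m (λ A → 𝟙 (nonCrossing? S A)))))) ⟩
    _ ∎
    where
    open ℚ.≤-Reasoning
    cutTerm : Subset n → Vec (Subset n) m → ℚ
    cutTerm S V = 𝟙 (smallSide? S) * prodᵛ (λ A → 𝟙 (nonCrossing? S A)) V
    0≤cutTerm : ∀ S V → 0ℚ ≤ᵠ cutTerm S V
    0≤cutTerm S V = 0≤* (0≤𝟙 (smallSide? S)) (prodᵛ-nonneg (λ A → 0≤𝟙 (nonCrossing? S A)) V)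
    pointwise : ∀ V → 1ℚ ≤ᵠ 𝟙 (intersectionGraphConnected? V) + ∑ (allSubsets n) (λ S → cutTerm S V)
    pointwise V with intersectionGraphConnected? V
    ... | yes _ = ≤-by _ (∑-nonneg (allSubsets n) (λ S → 0≤cutTerm S V)) refl
    ... | no ¬connected with Subset.anySubset? (λ S → smallSide? S ×-dec Fin.all? (λ k → nonCrossing? S (lookup V k)))
    ...   | no noCut = contradiction (allCutsCrossed⇒connected V (λ S small unc → noCut (S , small , unc))) ¬connected
    ...   | yes (S , small , unc) = subst (1ℚ ≤ᵠ_) (sym (ℚ.+-identityˡ _))
              (ℚ.≤-trans (ℚ.≤-reflexive (sym (trans (cong₂ _*_ (𝟙-yes (smallSide? S) small) (prodᵛ-𝟙-yes (nonCrossing? S) V unc)) (ℚ.*-identityˡ 1ℚ))))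
                (≤∑-allSubsets (λ S → cutTerm S V) (λ S → 0≤cutTerm S V) S))

geometric : ∀ {q} → 0ℚ ≤ᵠ q → q + q ≤ᵠ 1ℚ → ∀ n → ∑ (allFin n) (λ x → q ^ toℕ x) ≤ᵠ ⟦ 2 ⟧
geometric {q} 0≤q 2q≤1 zero    = 0≤⟦ 2 ⟧
geometric {q} 0≤q 2q≤1 (suc n) = subst (_≤ᵠ ⟦ 2 ⟧) (sym (∑-allFin-suc {n} (λ x → q ^ toℕ x)))
  (subst (λ z → 1ℚ + z ≤ᵠ ⟦ 2 ⟧) (sym (∑-* (allFin n) q (λ x → q ^ toℕ x)))
    (ℚ.≤-trans (ℚ.+-monoʳ-≤ 1ℚ (*-monoˡ 0≤q (geometric 0≤q 2q≤1 n)))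
      (≤-by (1ℚ - (q + q)) (0≤∸ 2q≤1) (e q))))
  where
  e : ∀ q → 1ℚ + q * ⟦ 2 ⟧ + (1ℚ - (q + q)) ≡ ⟦ 2 ⟧
  e = solve-∀ ℚ-ring

module _ {n′} {g : Fin (suc (suc n′)) → ℚ} (isPmf : IsPmf g) (m K D : ℕ)
  (1≤K : 1 ≤ K) (1≤D : 1 ≤ D)
  (sparse : Sparse m K g)
  where

  private
    n : ℕ
    n = suc n′

    module C = Cut isPmf m K D 1≤K sparse
    q = r D

    -- A profile of sizes, not a probability distribution. `weight h S` is q^k / C(n,k) for a
    -- nonempty S of size k, which is the bound for that single cut, so `∑-weight-1` collapses the
    -- sum over all cuts to a geometric series.
    h : Fin (suc n) → ℚ
    h x = 𝟙 (1 ℕ.≤? toℕ x) * q ^ toℕ x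

    0≤h : ∀ x → 0ℚ ≤ᵠ h x
    0≤h x = 0≤* (0≤𝟙 (1 ℕ.≤? toℕ x)) (^-nonneg (toℕ x) (0≤r D))

    2q≤1 : q + q ≤ᵠ 1ℚ
    2q≤1 = *-cancelʳ 0<⟦ suc D ⟧ (subst₂ _≤ᵠ_ (trans (cong₂ _+_ (sym (r-* D)) (sym (r-* D))) (sym (ℚ.*-distribʳ-+ ⟦ suc D ⟧ q q)))
      (sym (ℚ.*-identityˡ ⟦ suc D ⟧)) (⟦⟧-mono {2} (s≤s 1≤D)))

    ∑h : ∑ (allFin (suc n)) h ≤ᵠ ⟦ 2 ⟧ * q
    ∑h = subst (_≤ᵠ ⟦ 2 ⟧ * q) (sym eq) (subst (q * ∑ (allFin n) (λ x → q ^ toℕ x) ≤ᵠ_) (ℚ.*-comm q ⟦ 2 ⟧)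
      (*-monoˡ (0≤r D) (geometric (0≤r D) 2q≤1 n)))
      where
      eq : ∑ (allFin (suc n)) h ≡ q * ∑ (allFin n) (λ x → q ^ toℕ x)
      eq = trans (∑-allFin-suc {n} h) (trans (cong₂ _+_ (ℚ.*-zeroˡ 1ℚ)
        (trans (∑-cong (allFin n) (λ x → trans (cong (_* (q * q ^ toℕ x)) (𝟙-yes (1 ℕ.≤? suc (toℕ x)) (s≤s z≤n))) (ℚ.*-identityˡ (q * q ^ toℕ x))))
          (∑-* (allFin n) q (λ x → q ^ toℕ x)))) (ℚ.+-identityˡ _))

    term≤ : H n + slack K D ≤ᵠ rate m g → ∀ S → 𝟙 (smallSide? S) * 𝔼₁ isPmf (λ A → 𝟙 (nonCrossing? S A)) ^ m ≤ᵠ weight h S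
    term≤ dense S = 𝟙*≤ (smallSide? S) (0≤* (0≤invC n (∣p∣≤n S)) (0≤h (fromℕ< (s≤s (∣p∣≤n S)))))
      λ (1≤S , 2S≤n) → go ∣ S ∣ refl 1≤S 2S≤n (∣p∣≤n S)
      where
      R = 𝔼₁ isPmf (λ A → 𝟙 (nonCrossing? S A)) ^ m
      e : ∀ c ρ i p q → ρ * (c * p) * (i * q) ≡ ρ * ((i * c) * (p * q))
      e = solve-∀ ℚ-ring
      go : ∀ k → ∣ S ∣ ≡ k → 1 ≤ k → 2 ℕ.* k ≤ n → (k≤n : k ≤ n) → R ≤ᵠ weight h S
      go k@(suc j) S≡k 1≤k 2k≤n k≤n = subst₂ _≤ᵠ_ lhs rhs
        (*-monoʳ (0≤* (0≤invC n k≤n) (^-nonneg k (0≤r D))) (C.uncrossed-bound dense S S≡k 2k≤n))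
        where
        lhs : R * (⟦ n C k ⟧ * ⟦ suc D ⟧ ^ k) * (invC n k≤n * q ^ k) ≡ R
        lhs = trans (e ⟦ n C k ⟧ R (invC n k≤n) (⟦ suc D ⟧ ^ k) (q ^ k)) (trans (cong (R *_)
          (trans (cong₂ _*_ (invC-* n k≤n) (trans (sym (^-distrib-* ⟦ suc D ⟧ q k))
            (trans (cong (_^ k) (trans (ℚ.*-comm ⟦ suc D ⟧ q) (r-* D))) (1^ k)))) (ℚ.*-identityˡ 1ℚ)))
          (ℚ.*-identityʳ R))
        size = fromℕ< (s≤s (∣p∣≤n S))
        size≡ : toℕ size ≡ k
        size≡ = trans (Fin.toℕ-fromℕ< (s≤s (∣p∣≤n S))) S≡k
        rhs : 1ℚ * (invC n k≤n * q ^ k) ≡ weight h S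
        rhs = trans (ℚ.*-identityˡ (invC n k≤n * q ^ k)) (cong₂ _*_ (invC-cong n k≤n (∣p∣≤n S) (sym S≡k))
          (trans (sym (ℚ.*-identityˡ (q ^ k))) (cong₂ _*_ (sym (𝟙-yes (1 ℕ.≤? toℕ size) (subst (1 ≤_) (sym size≡) 1≤k)))
            (cong (q ^_) (sym size≡)))))

  probConnected-dense : H n + slack K D ≤ᵠ rate m g → 1ℚ ≤ᵠ probConnected g m + ⟦ 2 ⟧ * r D
  probConnected-dense dense = ℚ.≤-trans (union-bound isPmf m) (ℚ.+-monoʳ-≤ (probConnected g m)
    (ℚ.≤-trans (∑-mono (allSubsets n) (term≤ dense)) (subst (_≤ᵠ ⟦ 2 ⟧ * r D) (sym (∑-weight-1 h)) ∑h)))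

-- The disconnected regime

0≤x*x : ∀ x → 0ℚ ≤ᵠ x * x
0≤x*x x with ℚ.≤-total 0ℚ x
... | inj₁ 0≤x = 0≤* 0≤x 0≤x
... | inj₂ x≤0 = subst (0ℚ ≤ᵠ_) (e x) (0≤* (ℚ.neg-antimono-≤ x≤0) (ℚ.neg-antimono-≤ x≤0))
  where
  e : ∀ x → (- x) * (- x) ≡ x * x
  e = solve-∀ ℚ-ring

module SecondMoment {n″} {g : Fin (3 ℕ.+ n″) → ℚ} (isPmf : IsPmf g) (m : ℕ) where

  private
    n′ n : ℕ
    n′ = suc n″
    n  = suc n′

  private
    isolated : Fin n → Vec (Subset n) m → ℚ
    isolated i = prodᵛ (λ A → 𝟙 (isolating? i A))

    X : Vec (Subset n) m → ℚ
    X V = ∑ (allFin n) (λ i → isolated i V)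

  a₀ μ : ℚ
  a₀ = 1ℚ - r n′ * mom g 1
  μ  = ⟦ n ⟧ * a₀ ^ m

  module _ {b₀} (pair : ∀ {i j : Fin n} → i ≢ j → 𝔼₁ isPmf (λ A → 𝟙 (isolating? i A) * 𝟙 (isolating? j A)) ≤ᵠ b₀)
    (0≤b₀ : 0ℚ ≤ᵠ b₀) where

    private
      ∑-const : ∀ c → ∑ (allFin n) (λ _ → c) ≡ ⟦ n ⟧ * c
      ∑-const c = trans (∑-cong (allFin n) λ _ → sym (ℚ.*-identityʳ c))
        (trans (∑-* (allFin n) c (λ _ → 1ℚ)) (trans (cong (c *_) (∑-ones n)) (ℚ.*-comm c ⟦ n ⟧)))

      𝔼X : 𝔼 isPmf m X ≡ μ
      𝔼X = trans (𝔼-∑ isPmf m (allFin n) isolated) (trans (∑-cong (allFin n) λ i →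
        trans (𝔼-prod isPmf m (λ A → 𝟙 (isolating? i A))) (cong (_^ m) (𝔼₁-isolating isPmf i))) (∑-const (a₀ ^ m)))

      -- On the diagonal the product of indicators is a single indicator, with expectation `a₀ ^ m`.
      -- Adding `b₀ ^ m` there too only weakens the bound and makes the double sum uniform.
      𝔼II : ∀ i j → 𝔼 isPmf m (λ V → isolated i V * isolated j V) ≤ᵠ 𝟙 (i Fin.≟ j) * a₀ ^ m + b₀ ^ m
      𝔼II i j = subst (_≤ᵠ 𝟙 (i Fin.≟ j) * a₀ ^ m + b₀ ^ m)
        (sym (trans (𝔼-cong isPmf m (prodᵛ-* (λ A → 𝟙 (isolating? i A)) (λ A → 𝟙 (isolating? j A)))) (𝔼-prod isPmf m φ)))
        (bound (i Fin.≟ j))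
        where
        φ = λ A → 𝟙 (isolating? i A) * 𝟙 (isolating? j A)
        bound : (d : Dec (i ≡ j)) → 𝔼₁ isPmf φ ^ m ≤ᵠ 𝟙 d * a₀ ^ m + b₀ ^ m
        bound (yes refl) = ≤-by (b₀ ^ m) (^-nonneg m 0≤b₀) (cong (_+ b₀ ^ m) (trans
          (cong (_^ m) (trans (∑-cong (allSubsets n) (λ A → cong (weight g A *_) (𝟙-idem (isolating? i A)))) (𝔼₁-isolating isPmf i)))
          (sym (ℚ.*-identityˡ (a₀ ^ m)))))
        bound (no i≢j)   = subst (𝔼₁ isPmf φ ^ m ≤ᵠ_) (e (a₀ ^ m) (b₀ ^ m))
          (^-mono m (𝔼₁-nonneg isPmf λ A → 0≤* (0≤𝟙 (isolating? i A)) (0≤𝟙 (isolating? j A))) (pair i≢j))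
          where
          e : ∀ a b → b ≡ 0ℚ * a + b
          e = solve-∀ ℚ-ring

      𝔼XX : 𝔼 isPmf m (λ V → X V * X V) ≤ᵠ μ + ⟦ n ⟧ * (⟦ n ⟧ * b₀ ^ m)
      𝔼XX = begin
        𝔼 isPmf m (λ V → X V * X V)
          ≡⟨ trans (𝔼-cong isPmf m λ V → trans (sym (∑-* (allFin n) (X V) (λ i → isolated i V)))
                    (∑-cong (allFin n) λ i → trans (ℚ.*-comm (X V) (isolated i V)) (sym (∑-* (allFin n) (isolated i V) (λ j → isolated j V)))))
              (trans (𝔼-∑ isPmf m (allFin n) (λ i V → ∑ (allFin n) (λ j → isolated i V * isolated j V)))
                (∑-cong (allFin n) λ i → 𝔼-∑ isPmf m (allFin n) (λ j V → isolated i V * isolated j V))) ⟩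
        ∑ (allFin n) (λ i → ∑ (allFin n) (λ j → 𝔼 isPmf m (λ V → isolated i V * isolated j V)))
          ≤⟨ ∑-mono (allFin n) (λ i → ∑-mono (allFin n) (𝔼II i)) ⟩
        ∑ (allFin n) (λ i → ∑ (allFin n) (λ j → 𝟙 (i Fin.≟ j) * a₀ ^ m + b₀ ^ m))
          ≡⟨ ∑-cong (allFin n) (λ i → trans (∑-+ (allFin n) (λ j → 𝟙 (i Fin.≟ j) * a₀ ^ m) (λ _ → b₀ ^ m))
               (cong₂ _+_ (∑-point i (λ _ → a₀ ^ m)) (∑-const (b₀ ^ m)))) ⟩
        ∑ (allFin n) (λ _ → a₀ ^ m + ⟦ n ⟧ * b₀ ^ m)
          ≡⟨ trans (∑-const (a₀ ^ m + ⟦ n ⟧ * b₀ ^ m)) (ℚ.*-distribˡ-+ ⟦ n ⟧ (a₀ ^ m) (⟦ n ⟧ * b₀ ^ m)) ⟩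
        μ + ⟦ n ⟧ * (⟦ n ⟧ * b₀ ^ m) ∎
        where open ℚ.≤-Reasoning

      connected⇒X≡0 : ∀ V → Connected (Adjacent V) → X V ≡ 0ℚ
      connected⇒X≡0 V conn = trans (∑-cong (allFin n) λ i → prodᵛ-𝟙-no (isolating? i) V (connected⇒¬isolated V conn i)) (∑-zero (allFin n))

      -- On connected outcomes the number X of isolated nodes vanishes, so (X - μ)² = μ²; on all
      -- others the left side is 0. Taking expectations yields Chebyshev's inequality.
      pointwise : ∀ V → μ * μ * 𝟙 (intersectionGraphConnected? V) ≤ᵠ (X V * X V + (- (μ + μ)) * X V) + μ * μ * 1ℚ
      pointwise V = subst (μ * μ * 𝟙 (intersectionGraphConnected? V) ≤ᵠ_) (e (X V) μ) (bound (intersectionGraphConnected? V))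
        where
        e : ∀ x μ → (x - μ) * (x - μ) ≡ (x * x + (- (μ + μ)) * x) + μ * μ * 1ℚ
        e = solve-∀ ℚ-ring
        e₀ : ∀ μ → μ * μ * 1ℚ ≡ (0ℚ - μ) * (0ℚ - μ)
        e₀ = solve-∀ ℚ-ring
        bound : (d : Dec (Connected (Adjacent V))) → μ * μ * 𝟙 d ≤ᵠ (X V - μ) * (X V - μ)
        bound (yes conn) = ℚ.≤-reflexive (trans (e₀ μ) (cong (λ x → (x - μ) * (x - μ)) (sym (connected⇒X≡0 V conn))))
        bound (no _)     = subst (_≤ᵠ (X V - μ) * (X V - μ)) (sym (ℚ.*-zeroʳ (μ * μ))) (0≤x*x (X V - μ))

    chebyshev : μ * μ * probConnected g m ≤ᵠ μ + ⟦ n ⟧ * (⟦ n ⟧ * b₀ ^ m) - μ * μ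
    chebyshev = begin
      μ * μ * probConnected g m                                        ≡⟨ 𝔼-* isPmf m (μ * μ) (λ V → 𝟙 (intersectionGraphConnected? V)) ⟨
      𝔼 isPmf m (λ V → μ * μ * 𝟙 (intersectionGraphConnected? V))      ≤⟨ 𝔼-mono isPmf m pointwise ⟩
      𝔼 isPmf m (λ V → (X V * X V + (- (μ + μ)) * X V) + μ * μ * 1ℚ)
        ≡⟨ trans (𝔼-+ isPmf m (λ V → X V * X V + (- (μ + μ)) * X V) (λ _ → μ * μ * 1ℚ)) (cong₂ _+_
             (trans (𝔼-+ isPmf m (λ V → X V * X V) (λ V → (- (μ + μ)) * X V)) (cong (λ z → 𝔼 isPmf m (λ V → X V * X V) + z)
               (trans (𝔼-* isPmf m (- (μ + μ)) X) (cong ((- (μ + μ)) *_) 𝔼X))))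
             (trans (𝔼-* isPmf m (μ * μ) (λ _ → 1ℚ)) (cong (μ * μ *_) (𝔼-1 isPmf m)))) ⟩
      𝔼 isPmf m (λ V → X V * X V) + (- (μ + μ)) * μ + μ * μ * 1ℚ
        ≤⟨ ℚ.+-monoˡ-≤ (μ * μ * 1ℚ) (ℚ.+-monoˡ-≤ ((- (μ + μ)) * μ) 𝔼XX) ⟩
      μ + ⟦ n ⟧ * (⟦ n ⟧ * b₀ ^ m) + (- (μ + μ)) * μ + μ * μ * 1ℚ      ≡⟨ e μ (⟦ n ⟧ * (⟦ n ⟧ * b₀ ^ m)) ⟩
      μ + ⟦ n ⟧ * (⟦ n ⟧ * b₀ ^ m) - μ * μ                             ∎
      where
      open ℚ.≤-Reasoning
      e : ∀ μ b → μ + b + (- (μ + μ)) * μ + μ * μ * 1ℚ ≡ μ + b - μ * μ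
      e = solve-∀ ℚ-ring

module Isolated {n″} {g : Fin (3 ℕ.+ n″) → ℚ} (isPmf : IsPmf g) (m K d : ℕ)
  (1≤m : 1 ≤ m)
  (sparse : Sparse m K g)
  (large : ⟦ 16 ℕ.* suc (suc d) ℕ.* suc K ⟧ * (H (2 ℕ.+ n″) + 1ℚ) ≤ᵠ ⟦ 2 ℕ.+ n″ ⟧)
  where

  private
    n′ n : ℕ
    n′ = suc n″
    n  = suc n′

  open SecondMoment isPmf m using (a₀; μ; chebyshev)

  private
    lam : ℚ
    lam = rate m g

    -- `1 - p` is the probability that one random set isolates a given node, `b₀` bounds that for
    -- two nodes, and `t` measures the dependence between them. `u` = (K + 1)/n bounds `p`, and `w`
    -- is d + 2.
    R p t u w b₀ : ℚ
    R = r n′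
    p = R * mom g 1
    t = ⟦ 16 ⟧ * (R * R) * mom g 2
    u = R * (1ℚ + ⟦ K ⟧)
    w = 1ℚ + (1ℚ + ⟦ d ⟧)
    b₀ = 1ℚ - (⟦ 2 ⟧ * R * mom g 1 - ⟦ 2 ⟧ * R * (⟦ 2 ⟧ * R) * mom g 2)

    w≡ : ⟦ suc (suc d) ⟧ ≡ w
    w≡ = trans (⟦⟧-suc (suc d)) (cong (λ z → 1ℚ + z) (⟦⟧-suc d))

    0≤K+1 : 0ℚ ≤ᵠ 1ℚ + ⟦ K ⟧
    0≤K+1 = 0≤+ 0≤1 0≤⟦ K ⟧

    0≤u : 0ℚ ≤ᵠ u
    0≤u = 0≤* (0≤r n′) 0≤K+1

    0≤w : 0ℚ ≤ᵠ w
    0≤w = 0≤+ 0≤1 (0≤+ 0≤1 0≤⟦ d ⟧)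

    0≤p : 0ℚ ≤ᵠ p
    0≤p = 0≤* (0≤r n′) (0≤mom isPmf 1)

    -- This is `large` divided by n. Its constant is chosen to yield p ≤ ½, 2λp ≤ 1 and m t ≤ 1/(d +
    -- 2).
    uw≤1 : ⟦ 16 ⟧ * w * u * (H n + 1ℚ) ≤ᵠ 1ℚ
    uw≤1 = subst₂ _≤ᵠ_ eq (r-* n′) (*-monoˡ (0≤r n′) large)
      where
      e : ∀ R c w k h → R * (c * w * k * h) ≡ c * w * (R * k) * h
      e = solve-∀ ℚ-ring
      eq : R * (⟦ 16 ℕ.* suc (suc d) ℕ.* suc K ⟧ * (H n + 1ℚ)) ≡ ⟦ 16 ⟧ * w * u * (H n + 1ℚ)
      eq = trans (cong (λ z → R * (z * (H n + 1ℚ))) (trans (⟦⟧-* (16 ℕ.* suc (suc d)) (suc K))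
        (cong₂ _*_ (trans (⟦⟧-* 16 (suc (suc d))) (cong (⟦ 16 ⟧ *_) w≡)) (⟦⟧-suc K)))) (e R ⟦ 16 ⟧ w (1ℚ + ⟦ K ⟧) (H n + 1ℚ))

    0≤16w-2 : 0ℚ ≤ᵠ ⟦ 16 ⟧ * ⟦ d ⟧ + ⟦ 30 ⟧
    0≤16w-2 = 0≤+ (0≤* 0≤⟦ 16 ⟧ 0≤⟦ d ⟧) 0≤⟦ 30 ⟧

    2u≤1 : u + u ≤ᵠ 1ℚ
    2u≤1 = ℚ.≤-trans (≤-by (⟦ 16 ⟧ * w * u * H n + (⟦ 16 ⟧ * ⟦ d ⟧ + ⟦ 30 ⟧) * u)
        (0≤+ (0≤* (0≤* (0≤* 0≤⟦ 16 ⟧ 0≤w) 0≤u) (0≤H n)) (0≤* 0≤16w-2 0≤u)) (e ⟦ d ⟧ u (H n))) uw≤1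
      where
      e : ∀ d u h → u + u + (⟦ 16 ⟧ * (1ℚ + (1ℚ + d)) * u * h + (⟦ 16 ⟧ * d + ⟦ 30 ⟧) * u) ≡ ⟦ 16 ⟧ * (1ℚ + (1ℚ + d)) * u * (h + 1ℚ)
      e = solve-∀ ℚ-ring

    2Hu≤1 : H n * (u + u) ≤ᵠ 1ℚ
    2Hu≤1 = ℚ.≤-trans (≤-by (⟦ 16 ⟧ * w * u + (⟦ 16 ⟧ * ⟦ d ⟧ + ⟦ 30 ⟧) * u * H n)
        (0≤+ (0≤* (0≤* 0≤⟦ 16 ⟧ 0≤w) 0≤u) (0≤* (0≤* 0≤16w-2 0≤u) (0≤H n))) (e ⟦ d ⟧ u (H n))) uw≤1
      where
      e : ∀ d u h → h * (u + u) + (⟦ 16 ⟧ * (1ℚ + (1ℚ + d)) * u + (⟦ 16 ⟧ * d + ⟦ 30 ⟧) * u * h) ≡ ⟦ 16 ⟧ * (1ℚ + (1ℚ + d)) * u * (h + 1ℚ)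
      e = solve-∀ ℚ-ring

    M₀≤1 : mom g 0 ≤ᵠ 1ℚ
    M₀≤1 = subst₂ _≤ᵠ_ (sym (mom0 isPmf)) (IsPmf.total isPmf) (∑-mono (allFin (suc n)) λ x →
      subst (𝟙 (big? x) * g x ≤ᵠ_) (ℚ.*-identityˡ (g x)) (*-monoʳ (IsPmf.nonneg isPmf x) (𝟙≤1 (big? x))))

    -- M₁ ≤ M₂ and M₀ ≤ 1; the summand 1 in `Sparse` is absorbed by m ≥ 1.
    M₁≤ : mom g 1 ≤ᵠ 1ℚ + ⟦ K ⟧
    M₁≤ = *-cancelʳ {z = ⟦ m ⟧} (0<⟦_⟧ m {{ℕ.>-nonZero 1≤m}}) (ℚ.≤-trans (*-monoʳ 0≤⟦ m ⟧ (mom-mono isPmf {1} {2} (s≤s z≤n)))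
      (≤-by ((⟦ K ⟧ * (⟦ m ⟧ * mom g 0) + 1ℚ - ⟦ m ⟧ * mom g 2) + ⟦ K ⟧ * ⟦ m ⟧ * (1ℚ - mom g 0) + (⟦ m ⟧ - 1ℚ))
        (0≤+ (0≤+ (0≤∸ sparse) (0≤* (0≤* 0≤⟦ K ⟧ 0≤⟦ m ⟧) (0≤∸ M₀≤1))) (0≤∸ (⟦⟧-mono 1≤m)))
        (e ⟦ K ⟧ ⟦ m ⟧ (mom g 0) (mom g 2))))
      where
      e : ∀ K m M₀ M₂ → M₂ * m + ((K * (m * M₀) + 1ℚ - m * M₂) + K * m * (1ℚ - M₀) + (m - 1ℚ)) ≡ (1ℚ + K) * m
      e = solve-∀ ℚ-ring

    p≤u : p ≤ᵠ u
    p≤u = *-monoˡ (0≤r n′) M₁≤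

    2p≤1 : p + p ≤ᵠ 1ℚ
    2p≤1 = ℚ.≤-trans (ℚ.+-mono-≤ p≤u p≤u) 2u≤1

    0≤a₀ : 0ℚ ≤ᵠ a₀
    0≤a₀ = 0≤∸ {p} (ℚ.≤-trans (≤-by p 0≤p refl) 2p≤1)

    0≤lam : 0ℚ ≤ᵠ lam
    0≤lam = 0≤* (0≤* 0≤⟦ m ⟧ (0≤r n′)) (0≤mom isPmf 1)

    mp≡lam : ⟦ m ⟧ * p ≡ lam
    mp≡lam = sym (ℚ.*-assoc ⟦ m ⟧ R (mom g 1))

    0≤t : 0ℚ ≤ᵠ t
    0≤t = 0≤* (0≤* 0≤⟦ 16 ⟧ (0≤* (0≤r n′) (0≤r n′))) (0≤mom isPmf 2)

    -- `b₀` is 1 - 2p + 4M₂/n², while p ≤ ½ gives (1 - p)² ≥ ¼. Hence a correction factor 1 +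
    -- 16M₂/n² to (1 - p)² covers the term 4M₂/n².
    b₀≤ : b₀ ≤ᵠ a₀ * a₀ * (1ℚ + t)
    b₀≤ = ≤-by (p * p + ⟦ 4 ⟧ * (R * R * mom g 2) * ((1ℚ - (p + p)) * (⟦ 3 ⟧ - (p + p))))
      (0≤+ (0≤* 0≤p 0≤p) (0≤* (0≤* 0≤⟦ 4 ⟧ (0≤* (0≤* (0≤r n′) (0≤r n′)) (0≤mom isPmf 2)))
        (0≤* (0≤∸ 2p≤1) (0≤∸ (ℚ.≤-trans 2p≤1 (1≤⟦ 3 ⟧)))))) (e R (mom g 1) (mom g 2))
      where
      e : ∀ R M₁ M₂ → 1ℚ - (⟦ 2 ⟧ * R * M₁ - ⟦ 2 ⟧ * R * (⟦ 2 ⟧ * R) * M₂)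
          + (R * M₁ * (R * M₁) + ⟦ 4 ⟧ * (R * R * M₂) * ((1ℚ - (R * M₁ + R * M₁)) * (⟦ 3 ⟧ - (R * M₁ + R * M₁))))
          ≡ (1ℚ - R * M₁) * (1ℚ - R * M₁) * (1ℚ + ⟦ 16 ⟧ * (R * R) * M₂)
      e = solve-∀ ℚ-ring

    pair : ∀ {i j : Fin n} → i ≢ j → 𝔼₁ isPmf (λ A → 𝟙 (isolating? i A) * 𝟙 (isolating? j A)) ≤ᵠ b₀
    pair = 𝔼₁-isolating₂ isPmf (s≤s z≤n)

    0≤b₀ : 0ℚ ≤ᵠ b₀
    0≤b₀ = ℚ.≤-trans (𝔼₁-nonneg isPmf λ A → 0≤* (0≤𝟙 (isolating? zero A)) (0≤𝟙 (isolating? (suc zero) A)))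
      (pair {zero} {suc zero} λ ())

  module _ (below : lam + ⟦ d ⟧ + ⟦ 2 ⟧ ≤ᵠ H n) where

    private
      lam≤H : lam ≤ᵠ H n
      lam≤H = ℚ.≤-trans (≤-by (⟦ d ⟧ + ⟦ 2 ⟧) (0≤+ 0≤⟦ d ⟧ 0≤⟦ 2 ⟧) (sym (ℚ.+-assoc lam ⟦ d ⟧ ⟦ 2 ⟧))) below

      -- m M₂ ≤ K m M₁ + 1, and m M₁/n = λ ≤ Hₙ, so m t is at most 16(K Hₙ + 1/n)/n.
      mt≤ : ⟦ m ⟧ * t ≤ᵠ r (suc d)
      mt≤ = ≤r (suc d) (subst (λ z → ⟦ m ⟧ * t * z ≤ᵠ 1ℚ) (sym w≡) (ℚ.≤-trans
        (≤-by (⟦ 16 ⟧ * w * R * (R * (⟦ K ⟧ * (⟦ m ⟧ * mom g 1) + 1ℚ - ⟦ m ⟧ * mom g 2) + ⟦ K ⟧ * (H n - lam) + (1ℚ - R) + ⟦ K ⟧ + H n))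
          (0≤* (0≤* (0≤* 0≤⟦ 16 ⟧ 0≤w) (0≤r n′)) (0≤+ (0≤+ (0≤+ (0≤+ (0≤* (0≤r n′) (0≤∸ sparse₁)) (0≤* 0≤⟦ K ⟧ (0≤∸ lam≤H)))
            (0≤∸ (r≤1 n′))) 0≤⟦ K ⟧) (0≤H n)))
          (e ⟦ m ⟧ R (mom g 1) (mom g 2) w ⟦ K ⟧ (H n))) uw≤1))
        where
        sparse₁ : ⟦ m ⟧ * mom g 2 ≤ᵠ ⟦ K ⟧ * (⟦ m ⟧ * mom g 1) + 1ℚ
        sparse₁ = ℚ.≤-trans sparse (ℚ.+-monoˡ-≤ 1ℚ (*-monoˡ 0≤⟦ K ⟧ (*-monoˡ 0≤⟦ m ⟧ (mom-mono isPmf {0} {1} z≤n))))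
        e : ∀ m R M₁ M₂ w K h → m * (⟦ 16 ⟧ * (R * R) * M₂) * w +
            ⟦ 16 ⟧ * w * R * (R * (K * (m * M₁) + 1ℚ - m * M₂) + K * (h - m * R * M₁) + (1ℚ - R) + K + h)
            ≡ ⟦ 16 ⟧ * w * (R * (1ℚ + K)) * (h + 1ℚ)
        e = solve-∀ ℚ-ring

      -- Since 1 - 1/(d + 2) is the inverse of 1 + 1/(d + 1), it suffices that (1 + t)^m (1 - 1/(d +
      -- 2)) ≤ 1, and its exponent m t - 1/(d + 2) is at most 0.
      [1+t]^m≤ : (1ℚ + t) ^ m ≤ᵠ 1ℚ + r d
      [1+t]^m≤ = subst₂ _≤ᵠ_ lhs (ℚ.*-identityˡ (1ℚ + r d)) (*-monoʳ (0≤+ 0≤1 (0≤r d))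
        (≤exp⇒≤1 (≤exp-* (≤exp-^ m (1+t≤exp (0≤+ 0≤1 0≤t))) (1+t≤exp {t = - r (suc d)} (0≤∸ (r≤1 (suc d)))))
          (subst (⟦ m ⟧ * t - r (suc d) ≤ᵠ_) (ℚ.+-inverseʳ (r (suc d))) (ℚ.+-monoˡ-≤ (- r (suc d)) mt≤))))
        where
        q = (1ℚ - r (suc d)) * (1ℚ + r d)
        q≡1 : q ≡ 1ℚ
        q≡1 = *-cancelʳ-≡ 0<⟦ suc (suc d) ⟧ (*-cancelʳ-≡ 0<⟦ suc d ⟧ (trans (e₁ (r d) (r (suc d)) ⟦ suc d ⟧ ⟦ suc (suc d) ⟧)
          (trans (cong₂ (λ x y → (⟦ suc (suc d) ⟧ - x) * (⟦ suc d ⟧ + y)) (r-* (suc d)) (r-* d))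
          (trans (cong (λ z → (z - 1ℚ) * (⟦ suc d ⟧ + 1ℚ)) (⟦⟧-suc (suc d))) (trans (e₂ ⟦ suc d ⟧)
            (cong (λ z → 1ℚ * z * ⟦ suc d ⟧) (sym (⟦⟧-suc (suc d)))))))))
          where
          e₁ : ∀ a b x y → (1ℚ - b) * (1ℚ + a) * y * x ≡ (y - b * y) * (x + a * x)
          e₁ = solve-∀ ℚ-ring
          e₂ : ∀ x → (1ℚ + x - 1ℚ) * (x + 1ℚ) ≡ 1ℚ * (1ℚ + x) * x
          e₂ = solve-∀ ℚ-ring
        lhs : (1ℚ + t) ^ m * (1ℚ - r (suc d)) * (1ℚ + r d) ≡ (1ℚ + t) ^ m
        lhs = trans (ℚ.*-assoc ((1ℚ + t) ^ m) (1ℚ - r (suc d)) (1ℚ + r d)) (trans (cong ((1ℚ + t) ^ m *_) q≡1) (ℚ.*-identityʳ ((1ℚ + t) ^ m)))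

      n²b₀^m≤ : ⟦ n ⟧ * (⟦ n ⟧ * b₀ ^ m) ≤ᵠ μ * μ * (1ℚ + r d)
      n²b₀^m≤ = begin
        ⟦ n ⟧ * (⟦ n ⟧ * b₀ ^ m)                          ≤⟨ *-monoˡ 0≤⟦ n ⟧ (*-monoˡ 0≤⟦ n ⟧ (^-mono m 0≤b₀ b₀≤)) ⟩
        ⟦ n ⟧ * (⟦ n ⟧ * (a₀ * a₀ * (1ℚ + t)) ^ m)
          ≡⟨ cong (λ z → ⟦ n ⟧ * (⟦ n ⟧ * z)) (trans (^-distrib-* (a₀ * a₀) (1ℚ + t) m) (cong (_* (1ℚ + t) ^ m) (^-distrib-* a₀ a₀ m))) ⟩
        ⟦ n ⟧ * (⟦ n ⟧ * (a₀ ^ m * a₀ ^ m * (1ℚ + t) ^ m)) ≡⟨ e ⟦ n ⟧ (a₀ ^ m) ((1ℚ + t) ^ m) ⟩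
        μ * μ * (1ℚ + t) ^ m                              ≤⟨ *-monoˡ (0≤x*x μ) [1+t]^m≤ ⟩
        μ * μ * (1ℚ + r d)                                ∎
        where
        open ℚ.≤-Reasoning
        e : ∀ n a c → n * (n * (a * a * c)) ≡ n * a * (n * a) * c
        e = solve-∀ ℚ-ring

      -- `≤exp` only bounds from above, so the lower bound on (1 - p)^m comes from its inverse: (1 -
      -- p)(1 + p + 2p²) = 1 + p²(1 - 2p) ≥ 1, and it remains to bound (1 + p + 2p²)^m (d + 1)/n by
      -- 1.
      ≤μ : ⟦ suc d ⟧ ≤ᵠ μ
      ≤μ = begin
        ⟦ suc d ⟧                                               ≡⟨ ℚ.*-identityʳ ⟦ suc d ⟧ ⟨
        ⟦ suc d ⟧ * 1ℚ                                          ≤⟨ *-monoˡ 0≤⟦ suc d ⟧ 1≤ ⟩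
        ⟦ suc d ⟧ * (a₀ ^ m * (1ℚ + p″) ^ m)                    ≡⟨ trans (e₁ ⟦ suc d ⟧ (a₀ ^ m) ((1ℚ + p″) ^ m)) (cong (_* (⟦ suc d ⟧ * a₀ ^ m * (1ℚ + p″) ^ m)) (sym (r-* n′))) ⟩
        R * ⟦ n ⟧ * (⟦ suc d ⟧ * a₀ ^ m * (1ℚ + p″) ^ m)        ≡⟨ e₂ R ⟦ n ⟧ ⟦ suc d ⟧ (a₀ ^ m) ((1ℚ + p″) ^ m) ⟩
        μ * ((1ℚ + p″) ^ m * (R * ⟦ suc d ⟧))                   ≤⟨ *-monoˡ (0≤* 0≤⟦ n ⟧ (^-nonneg m 0≤a₀)) expo ⟩
        μ * 1ℚ                                                  ≡⟨ ℚ.*-identityʳ μ ⟩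
        μ                                                       ∎
        where
        open ℚ.≤-Reasoning
        p″ = p + (p + p) * p
        0≤p″ : 0ℚ ≤ᵠ p″
        0≤p″ = 0≤+ 0≤p (0≤* (0≤+ 0≤p 0≤p) 0≤p)
        e₁ : ∀ d a c → d * (a * c) ≡ 1ℚ * (d * a * c)
        e₁ = solve-∀ ℚ-ring
        e₂ : ∀ R n d a c → R * n * (d * a * c) ≡ n * a * (c * (R * d))
        e₂ = solve-∀ ℚ-ring
        1≤ : 1ℚ ≤ᵠ a₀ ^ m * (1ℚ + p″) ^ m
        1≤ = subst₂ _≤ᵠ_ (1^ m) (^-distrib-* a₀ (1ℚ + p″) m) (^-mono m 0≤1 (≤-by (p * p * (1ℚ - (p + p)))
          (0≤* (0≤* 0≤p 0≤p) (0≤∸ 2p≤1)) (e p)))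
          where
          e : ∀ p → 1ℚ + p * p * (1ℚ - (p + p)) ≡ (1ℚ - p) * (1ℚ + (p + (p + p) * p))
          e = solve-∀ ℚ-ring
        mp″≤ : ⟦ m ⟧ * p″ ≤ᵠ lam + 1ℚ
        mp″≤ = subst (_≤ᵠ lam + 1ℚ) (trans (cong (λ z → z + z * (p + p)) (sym mp≡lam)) (e ⟦ m ⟧ p)) (ℚ.+-monoʳ-≤ lam
          (ℚ.≤-trans (*-mono 0≤lam (0≤+ 0≤u 0≤u) lam≤H (ℚ.+-mono-≤ p≤u p≤u)) 2Hu≤1))
          where
          e : ∀ m p → m * p + m * p * (p + p) ≡ m * (p + (p + p) * p)
          e = solve-∀ ℚ-ring
        -- Of the 2 in `below`, one unit pays for m · 2p² ≤ 1 and the other for the 1 in 1/n ≤ e^(1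
        -- - Hₙ).
        expo : (1ℚ + p″) ^ m * (R * ⟦ suc d ⟧) ≤ᵠ 1ℚ
        expo = ≤exp⇒≤1 (≤exp-* (≤exp-^ m (1+t≤exp (0≤+ 0≤1 0≤p″))) (≤exp-* (1/n≤exp n′)
            (≤exp-resp (sym (⟦⟧-suc d)) refl (1+t≤exp (0≤+ 0≤1 0≤⟦ d ⟧)))))
          (≤-by ((lam + 1ℚ - ⟦ m ⟧ * p″) + (H n - (lam + ⟦ d ⟧ + ⟦ 2 ⟧))) (0≤+ (0≤∸ mp″≤) (0≤∸ below))
            (e (⟦ m ⟧ * p″) (H n) ⟦ d ⟧ lam))
          where
          e : ∀ x h d l → x + (1ℚ - h + d) + ((l + 1ℚ - x) + (h - (l + d + ⟦ 2 ⟧))) ≡ 0ℚ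
          e = solve-∀ ℚ-ring

      0<μ : 0ℚ <ᵠ μ
      0<μ = ℚ.<-≤-trans 0<⟦ suc d ⟧ ≤μ

    -- Dividing Chebyshev's bound by μ² leaves 1/μ and the relative excess of the second moment,
    -- each at most 1/(d + 1).
    probConnected-sparse : probConnected g m ≤ᵠ ⟦ 2 ⟧ * r d
    probConnected-sparse = *-cancelʳ 0<μ (*-cancelʳ 0<μ (begin
      probConnected g m * μ * μ                     ≡⟨ e₁ (probConnected g m) μ ⟩
      μ * μ * probConnected g m                     ≤⟨ chebyshev pair 0≤b₀ ⟩
      μ + ⟦ n ⟧ * (⟦ n ⟧ * b₀ ^ m) - μ * μ          ≤⟨ ℚ.+-monoˡ-≤ (- (μ * μ)) (ℚ.+-mono-≤ μ≤ n²b₀^m≤) ⟩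
      r d * μ * μ + μ * μ * (1ℚ + r d) - μ * μ      ≡⟨ e₂ (r d) μ ⟩
      ⟦ 2 ⟧ * r d * μ * μ                           ∎))
      where
      open ℚ.≤-Reasoning
      e₁ : ∀ P μ → P * μ * μ ≡ μ * μ * P
      e₁ = solve-∀ ℚ-ring
      e₂ : ∀ r μ → r * μ * μ + μ * μ * (1ℚ + r) - μ * μ ≡ ⟦ 2 ⟧ * r * μ * μ
      e₂ = solve-∀ ℚ-ring
      μ≤ : μ ≤ᵠ r d * μ * μ
      μ≤ = subst (_≤ᵠ r d * μ * μ) (ℚ.*-identityˡ μ) (*-monoʳ (ℚ.<⇒≤ 0<μ)
        (subst (_≤ᵠ r d * μ) (r-* d) (*-monoˡ (0≤r d) ≤μ)))

-- Rational approximation of real distributions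

0<½* : ∀ {ε} → 0ℚ <ᵠ ε → 0ℚ <ᵠ ½ * ε
0<½* {ε} 0<ε = subst (_<ᵠ ½ * ε) (ℚ.*-zeroʳ ½) (ℚ.*-monoʳ-<-pos ½ 0<ε)

½+½ : ∀ ε → ½ * ε + ½ * ε ≡ ε
½+½ ε = trans (sym (ℚ.*-distribʳ-+ ε ½ ½)) (ℚ.*-identityˡ ε)

0<* : ∀ {x y} → 0ℚ <ᵠ x → 0ℚ <ᵠ y → 0ℚ <ᵠ x * y
0<* {x} {y} 0<x 0<y = ℚ.positive⁻¹ (x * y) {{ℚ.pos*pos⇒pos x {{ℚ.positive 0<x}} y {{ℚ.positive 0<y}}}}

0<r : ∀ k → 0ℚ <ᵠ r k
0<r k = ℚ.positive⁻¹ (r k) {{ℚ.normalize-pos 1 (suc k)}}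

≤⟦⟧ : ∀ q → ∃[ n ] q ≤ᵠ ⟦ n ⟧
≤⟦⟧ q@(ℚ.mkℚ (+ k) d _) = k , *-cancelʳ 0<⟦ suc d ⟧ (begin
  q * ⟦ suc d ⟧                ≡⟨ cong (_* ⟦ suc d ⟧) (ℚ.↥p/↧p≡p q) ⟨
  (+ k / suc d) * ⟦ suc d ⟧    ≡⟨ /-*-cancel k (suc d) ⟩
  ⟦ k ⟧                        ≤⟨ ⟦⟧-mono (ℕ.m≤m*n k (suc d)) ⟩
  ⟦ k ℕ.* suc d ⟧              ≡⟨ ⟦⟧-* k (suc d) ⟩
  ⟦ k ⟧ * ⟦ suc d ⟧            ∎)
  where open ℚ.≤-Reasoning
≤⟦⟧ q@(ℚ.mkℚ ℤ.-[1+ _ ] _ _) = 0 , ℚ.<⇒≤ (ℚ.negative⁻¹ q)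

⟦⟧≤⟦suc⟧ : ∀ n → ⟦ n ⟧ ≤ᵠ ⟦ suc n ⟧
⟦⟧≤⟦suc⟧ n = ⟦⟧-mono (ℕ.n≤1+n n)

∃r≤ : ∀ {ε} → 0ℚ <ᵠ ε → ∃[ d ] r d ≤ᵠ ε
∃r≤ {ε} 0<ε = d , r≤ d (begin
  1ℚ              ≡⟨ ℚ.*-inverseʳ ε ⟨
  ε * ℚ.1/ ε      ≤⟨ *-monoˡ (ℚ.<⇒≤ 0<ε) (proj₂ (≤⟦⟧ (ℚ.1/ ε))) ⟩
  ε * ⟦ d ⟧       ≤⟨ *-monoˡ (ℚ.<⇒≤ 0<ε) (⟦⟧≤⟦suc⟧ d) ⟩
  ε * ⟦ suc d ⟧   ∎)
  where
  open ℚ.≤-Reasoning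
  instance
    ε≢0 : ℚ.NonZero ε
    ε≢0 = ℚ.pos⇒nonZero ε {{ℚ.positive 0<ε}}
  d = proj₁ (≤⟦⟧ (ℚ.1/ ε))

∣∣≤ : ∀ {x y} → x ≤ᵠ y → - x ≤ᵠ y → ℚ.∣ x ∣ ≤ᵠ y
∣∣≤ {x} {y} x≤y -x≤y = [ (λ eq → subst (_≤ᵠ y) (sym eq) x≤y) , (λ eq → subst (_≤ᵠ y) (sym eq) -x≤y) ]′ (ℚ.∣p∣≡p∨∣p∣≡-p x)

≤∣∣ : ∀ x → x ≤ᵠ ℚ.∣ x ∣
≤∣∣ x = [ (λ 0≤x → ℚ.≤-reflexive (sym (ℚ.0≤p⇒∣p∣≡p 0≤x))) , (λ x≤0 → ℚ.≤-trans x≤0 (ℚ.0≤∣p∣ x)) ]′ (ℚ.≤-total 0ℚ x)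

-- Asymptotic comparison of rational sequences

Eventually : (ℕ → Set) → Set
Eventually P = ∃[ N ] (∀ i → N ≤ i → P i)

infixr 3 _∧ᵉ_

_∧ᵉ_ : ∀ {P Q} → Eventually P → Eventually Q → Eventually (λ i → P i × Q i)
(M , p) ∧ᵉ (N , q) = M ℕ.⊔ N , λ i h → p i (ℕ.m⊔n≤o⇒m≤o M N h) , q i (ℕ.m⊔n≤o⇒n≤o M N h)

mapᵉ : ∀ {P Q} → (∀ i → P i → Q i) → Eventually P → Eventually Q
mapᵉ f (N , p) = N , λ i h → f i (p i h)

Null Bounded AsympNonneg : (ℕ → ℚ) → Set
Null u        = ∀ ε → 0ℚ <ᵠ ε → Eventually (λ i → ℚ.∣ u i ∣ ≤ᵠ ε)
Bounded u     = ∃[ n ] Eventually (λ i → ℚ.∣ u i ∣ ≤ᵠ ⟦ suc n ⟧)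
AsympNonneg u = ∀ ε → 0ℚ <ᵠ ε → Eventually (λ i → - ε ≤ᵠ u i)

null-cong : ∀ {u v} → (∀ i → u i ≡ v i) → Null u → Null v
null-cong eq h ε 0<ε = mapᵉ (λ i → subst (λ z → ℚ.∣ z ∣ ≤ᵠ ε) (eq i)) (h ε 0<ε)

null-0 : Null (λ _ → 0ℚ)
null-0 ε 0<ε = 0 , λ _ _ → ℚ.<⇒≤ 0<ε

null-+ : ∀ {u v} → Null u → Null v → Null (λ i → u i + v i)
null-+ {u} {v} hu hv ε 0<ε = mapᵉ
  (λ i (p , q) → ℚ.≤-trans (ℚ.∣p+q∣≤∣p∣+∣q∣ (u i) (v i)) (subst (ℚ.∣ u i ∣ + ℚ.∣ v i ∣ ≤ᵠ_) (½+½ ε) (ℚ.+-mono-≤ p q)))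
  (hu (½ * ε) (0<½* 0<ε) ∧ᵉ hv (½ * ε) (0<½* 0<ε))

null-* : ∀ {u v} → Bounded u → Null v → Null (λ i → u i * v i)
null-* {u} {v} (n , hu) hv ε 0<ε = mapᵉ
  (λ i (p , q) → subst (_≤ᵠ ε) (sym (ℚ.∣p*q∣≡∣p∣*∣q∣ (u i) (v i)))
    (subst (ℚ.∣ u i ∣ * ℚ.∣ v i ∣ ≤ᵠ_) δ≡ (*-mono (ℚ.0≤∣p∣ (u i)) (ℚ.<⇒≤ 0<δ) p q)))
  (hu ∧ᵉ hv (r n * ε) 0<δ)
  where
  0<δ : 0ℚ <ᵠ r n * ε
  0<δ = 0<* (0<r n) 0<ε
  δ≡ : ⟦ suc n ⟧ * (r n * ε) ≡ ε
  δ≡ = trans (sym (ℚ.*-assoc ⟦ suc n ⟧ (r n) ε)) (trans (cong (_* ε) (trans (ℚ.*-comm ⟦ suc n ⟧ (r n)) (r-* n))) (ℚ.*-identityˡ ε))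

null-neg : ∀ {u} → Null u → Null (λ i → - u i)
null-neg {u} h ε 0<ε = mapᵉ (λ i → subst (_≤ᵠ ε) (sym (ℚ.∣-p∣≡∣p∣ (u i)))) (h ε 0<ε)

bounded-by : ∀ {u} q → Eventually (λ i → ℚ.∣ u i ∣ ≤ᵠ q) → Bounded u
bounded-by q h = proj₁ (≤⟦⟧ q) , mapᵉ (λ _ p → ℚ.≤-trans p (ℚ.≤-trans (proj₂ (≤⟦⟧ q)) (⟦⟧≤⟦suc⟧ (proj₁ (≤⟦⟧ q))))) h

bounded-const : ∀ c → Bounded (λ _ → c)
bounded-const c = bounded-by ℚ.∣ c ∣ (0 , λ _ _ → ℚ.≤-refl)

bounded-+ : ∀ {u v} → Bounded u → Bounded v → Bounded (λ i → u i + v i)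
bounded-+ {u} {v} (m , hu) (n , hv) = bounded-by (⟦ suc m ⟧ + ⟦ suc n ⟧)
  (mapᵉ (λ i (p , q) → ℚ.≤-trans (ℚ.∣p+q∣≤∣p∣+∣q∣ (u i) (v i)) (ℚ.+-mono-≤ p q)) (hu ∧ᵉ hv))

bounded-* : ∀ {u v} → Bounded u → Bounded v → Bounded (λ i → u i * v i)
bounded-* {u} {v} (m , hu) (n , hv) = bounded-by (⟦ suc m ⟧ * ⟦ suc n ⟧)
  (mapᵉ (λ i (p , q) → subst (_≤ᵠ ⟦ suc m ⟧ * ⟦ suc n ⟧) (sym (ℚ.∣p*q∣≡∣p∣*∣q∣ (u i) (v i)))
    (*-mono (ℚ.0≤∣p∣ (u i)) 0≤⟦ suc n ⟧ p q)) (hu ∧ᵉ hv))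

cauchy⇒bounded : ∀ (x : ℝ) → Bounded (seq x)
cauchy⇒bounded x = bounded-by (1ℚ + ℚ.∣ seq x N ∣) (N , λ i N≤i → begin
  ℚ.∣ seq x i ∣                                ≡⟨ cong ℚ.∣_∣ (e (seq x i) (seq x N)) ⟩
  ℚ.∣ (seq x i - seq x N) + seq x N ∣          ≤⟨ ℚ.∣p+q∣≤∣p∣+∣q∣ (seq x i - seq x N) (seq x N) ⟩
  ℚ.∣ seq x i - seq x N ∣ + ℚ.∣ seq x N ∣      ≤⟨ ℚ.+-monoˡ-≤ ℚ.∣ seq x N ∣ (close i N N≤i ℕ.≤-refl) ⟩
  1ℚ + ℚ.∣ seq x N ∣                           ∎)
  where
  open ℚ.≤-Reasoning
  N = proj₁ (cauchy x 1ℚ 0<⟦ 1 ⟧)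
  close = proj₂ (cauchy x 1ℚ 0<⟦ 1 ⟧)
  e : ∀ a b → a ≡ (a - b) + b
  e = solve-∀ ℚ-ring

-- Boundedness is carried along because closeness of products requires it; the bound on `v` then
-- follows from closeness.
record _≈_ (u v : ℕ → ℚ) : Set where
  constructor mk≈
  field
    close    : Null (λ i → u i - v i)
    boundedˡ : Bounded u

infix 4 _≈_

open _≈_

boundedʳ : ∀ {u v} → u ≈ v → Bounded v
boundedʳ {u} {v} (mk≈ c (m , hu)) = bounded-by (⟦ suc m ⟧ + 1ℚ) (mapᵉ (λ i (p , q) →
  ℚ.≤-trans (subst (ℚ._≤ ℚ.∣ u i ∣ + ℚ.∣ u i - v i ∣) (cong ℚ.∣_∣ (e (u i) (v i))) (ℚ.∣p-q∣≤∣p∣+∣q∣ (u i) (u i - v i)))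
    (ℚ.+-mono-≤ p q)) (hu ∧ᵉ c 1ℚ 0<⟦ 1 ⟧))
  where
  e : ∀ a b → a - (a - b) ≡ b
  e = solve-∀ ℚ-ring

≈-const : ∀ c → (λ _ → c) ≈ (λ _ → c)
≈-const c = mk≈ (null-cong (λ _ → sym (ℚ.+-inverseʳ c)) null-0) (bounded-const c)

≈-+ : ∀ {u v u′ v′} → u ≈ v → u′ ≈ v′ → (λ i → u i + u′ i) ≈ (λ i → v i + v′ i)
≈-+ {u} {v} {u′} {v′} (mk≈ c b) (mk≈ c′ b′) = mk≈ (null-cong (λ i → e (u i) (v i) (u′ i) (v′ i)) (null-+ c c′)) (bounded-+ b b′)
  where
  e : ∀ a b c d → (a - b) + (c - d) ≡ (a + c) - (b + d)
  e = solve-∀ ℚ-ring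

≈-* : ∀ {u v u′ v′} → u ≈ v → u′ ≈ v′ → (λ i → u i * u′ i) ≈ (λ i → v i * v′ i)
≈-* {u} {v} {u′} {v′} p@(mk≈ c b) q@(mk≈ c′ b′) =
  mk≈ (null-cong (λ i → e (u i) (v i) (u′ i) (v′ i)) (null-+ (null-* b c′) (null-* (boundedʳ q) c))) (bounded-* b b′)
  where
  e : ∀ a b c d → a * (c - d) + d * (a - b) ≡ a * c - b * d
  e = solve-∀ ℚ-ring

≈-∑ : ∀ {A : Set} (xs : List A) {u v : A → ℕ → ℚ} → (∀ x → u x ≈ v x) → (λ i → ∑ xs (λ x → u x i)) ≈ (λ i → ∑ xs (λ x → v x i))
≈-∑ []       h = ≈-const 0ℚ
≈-∑ (x ∷ xs) h = ≈-+ (h x) (≈-∑ xs h)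

≈-prodᵛ : ∀ {A : Set} {m} (V : Vec A m) {u v : A → ℕ → ℚ} → (∀ x → u x ≈ v x) →
          (λ i → prodᵛ (λ x → u x i) V) ≈ (λ i → prodᵛ (λ x → v x i) V)
≈-prodᵛ []      h = ≈-const 1ℚ
≈-prodᵛ (x ∷ V) h = ≈-* (h x) (≈-prodᵛ V h)

clamp : ℚ → ℚ → ℚ
clamp c u = (0ℚ ℚ.⊔ u) ℚ.⊓ c

clamp-cases : ∀ c u → 0ℚ ≤ᵠ c → (u ≤ᵠ 0ℚ × clamp c u ≡ 0ℚ) ⊎ (0ℚ ≤ᵠ u × u ≤ᵠ c × clamp c u ≡ u) ⊎ (c ≤ᵠ u × clamp c u ≡ c)
clamp-cases c u 0≤c with ℚ.≤-total u 0ℚ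
... | inj₁ u≤0 = inj₁ (u≤0 , trans (cong (ℚ._⊓ c) (ℚ.p≥q⇒p⊔q≡p u≤0)) (ℚ.p≤q⇒p⊓q≡p 0≤c))
... | inj₂ 0≤u with ℚ.≤-total u c
...   | inj₁ u≤c = inj₂ (inj₁ (0≤u , u≤c , trans (cong (ℚ._⊓ c) (ℚ.p≤q⇒p⊔q≡q 0≤u)) (ℚ.p≤q⇒p⊓q≡p u≤c)))
...   | inj₂ c≤u = inj₂ (inj₂ (c≤u , trans (cong (ℚ._⊓ c) (ℚ.p≤q⇒p⊔q≡q 0≤u)) (ℚ.p≥q⇒p⊓q≡q c≤u)))

0≤clamp : ∀ c u → 0ℚ ≤ᵠ c → 0ℚ ≤ᵠ clamp c u
0≤clamp c u 0≤c = ℚ.⊓-glb (ℚ.p≤p⊔q 0ℚ u) 0≤c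

clamp≤ : ∀ c u → clamp c u ≤ᵠ c
clamp≤ c u = ℚ.p⊓q≤q (0ℚ ℚ.⊔ u) c

clamp-close : ∀ c u ε → 0ℚ ≤ᵠ c → 0ℚ <ᵠ ε → - ε ≤ᵠ u → - ε ≤ᵠ c - u → ℚ.∣ clamp c u - u ∣ ≤ᵠ ε
clamp-close c u ε 0≤c 0<ε -ε≤u -ε≤c-u with clamp-cases c u 0≤c
... | inj₁ (u≤0 , eq) rewrite eq = ∣∣≤ (≤-by (u - - ε) (0≤∸ -ε≤u) (e₁ u ε)) (≤-by (ε - u) (0≤∸ (ℚ.≤-trans u≤0 (ℚ.<⇒≤ 0<ε))) (e₂ u ε))
  where
  e₁ : ∀ u ε → 0ℚ - u + (u - - ε) ≡ ε
  e₁ = solve-∀ ℚ-ring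
  e₂ : ∀ u ε → - (0ℚ - u) + (ε - u) ≡ ε
  e₂ = solve-∀ ℚ-ring
... | inj₂ (inj₁ (_ , _ , eq)) rewrite eq | ℚ.+-inverseʳ u = ℚ.<⇒≤ 0<ε
... | inj₂ (inj₂ (c≤u , eq)) rewrite eq = ∣∣≤ (≤-by (ε + (u - c)) (0≤+ (ℚ.<⇒≤ 0<ε) (0≤∸ c≤u)) (e₁ c u ε))
        (≤-by (c - u - - ε) (0≤∸ -ε≤c-u) (e₂ c u ε))
  where
  e₁ : ∀ c u ε → c - u + (ε + (u - c)) ≡ ε
  e₁ = solve-∀ ℚ-ring
  e₂ : ∀ c u ε → - (c - u) + (c - u - - ε) ≡ ε
  e₂ = solve-∀ ℚ-ring

-- Clamping the values in turn to the budget still available, and giving the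
-- remainder to the last one, turns them into values of total mass c.
clampPmf : ∀ {k} → ℚ → (Fin (suc k) → ℚ) → Fin (suc k) → ℚ
clampPmf {zero}  c u _       = c
clampPmf {suc k} c u zero    = clamp c (u zero)
clampPmf {suc k} c u (suc x) = clampPmf (c - clamp c (u zero)) (u ∘ suc) x

clampPmf-nonneg : ∀ {k} {c} → 0ℚ ≤ᵠ c → ∀ u (x : Fin (suc k)) → 0ℚ ≤ᵠ clampPmf c u x
clampPmf-nonneg {zero}  0≤c u _       = 0≤c
clampPmf-nonneg {suc k} {c} 0≤c u zero    = 0≤clamp c (u zero) 0≤c
clampPmf-nonneg {suc k} {c} 0≤c u (suc x) = clampPmf-nonneg (0≤∸ (clamp≤ c (u zero))) (u ∘ suc) x

clampPmf-total : ∀ {k} c (u : Fin (suc k) → ℚ) → ∑ (allFin (suc k)) (clampPmf c u) ≡ c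
clampPmf-total {zero}  c u = ℚ.+-identityʳ c
clampPmf-total {suc k} c u = trans (∑-allFin-suc {suc k} (clampPmf c u))
  (trans (cong (λ z → clamp c (u zero) + z) (clampPmf-total (c - clamp c (u zero)) (u ∘ suc))) (e (clamp c (u zero)) c))
  where
  e : ∀ a c → a + (c - a) ≡ c
  e = solve-∀ ℚ-ring

asympNonneg-+ : ∀ {u v} → AsympNonneg u → AsympNonneg v → AsympNonneg (λ i → u i + v i)
asympNonneg-+ {u} {v} hu hv ε 0<ε = mapᵉ (λ i (p , q) → subst (_≤ᵠ u i + v i)
  (trans (sym (ℚ.neg-distrib-+ (½ * ε) (½ * ε))) (cong -_ (½+½ ε))) (ℚ.+-mono-≤ p q))
  (hu (½ * ε) (0<½* 0<ε) ∧ᵉ hv (½ * ε) (0<½* 0<ε))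

asympNonneg-∑ : ∀ {A : Set} (xs : List A) {u : A → ℕ → ℚ} → (∀ x → AsympNonneg (u x)) → AsympNonneg (λ i → ∑ xs (λ x → u x i))
asympNonneg-∑ []       h ε 0<ε = 0 , λ _ _ → ℚ.neg-antimono-≤ (ℚ.<⇒≤ 0<ε)
asympNonneg-∑ (x ∷ xs) h = asympNonneg-+ (h x) (asympNonneg-∑ xs h)

null⇒asympNonneg : ∀ {u} → Null u → AsympNonneg u
null⇒asympNonneg {u} h ε 0<ε = mapᵉ (λ i p → ≤-by (u i + ε) (subst (0ℚ ≤ᵠ_) (e (u i) ε)
    (0≤∸ (ℚ.≤-trans (subst (- u i ≤ᵠ_) (ℚ.∣-p∣≡∣p∣ (u i)) (≤∣∣ (- u i))) p))) (e′ (u i) ε)) (h ε 0<ε)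
  where
  e : ∀ u ε → ε - - u ≡ u + ε
  e = solve-∀ ℚ-ring
  e′ : ∀ u ε → - ε + (u + ε) ≡ u
  e′ = solve-∀ ℚ-ring

-- The invariant is that the budget minus the sum of the remaining values tends to 0. Those values
-- are asymptotically nonnegative, so the first one exceeds the budget by arbitrarily little and
-- clamping barely moves it; the new budget inherits the invariant.
clampPmf-close : ∀ {k} (c : ℕ → ℚ) (u : Fin (suc k) → ℕ → ℚ) → (∀ i → 0ℚ ≤ᵠ c i) → (∀ x → AsympNonneg (u x)) →
  Null (λ i → c i - ∑ (allFin (suc k)) (λ x → u x i)) → ∀ x → Null (λ i → clampPmf (c i) (λ x → u x i) x - u x i)
clampPmf-close {zero} c u 0≤c u≥0 total zero = null-cong (λ i → cong (λ z → c i - z) (ℚ.+-identityʳ (u zero i))) total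
clampPmf-close {suc k} c u 0≤c u≥0 total = λ where
    zero    → first
    (suc x) → clampPmf-close (λ i → c i - clamp (c i) (u zero i)) (u ∘ suc) (λ i → 0≤∸ (clamp≤ (c i) (u zero i))) (u≥0 ∘ suc)
      (null-cong (λ i → trans (cong (λ z → c i - z + - (clamp (c i) (u zero i) - u zero i)) (∑-allFin-suc {suc k} (λ x → u x i)))
          (e₁ (c i) (u zero i) (rest i) (clamp (c i) (u zero i))))
        (null-+ total (null-neg first))) x
  where
  rest : ℕ → ℚ
  rest i = ∑ (allFin (suc k)) (λ x → u (suc x) i)
  e₁ : ∀ c u s a → c - (u + s) + - (a - u) ≡ c - a - s
  e₁ = solve-∀ ℚ-ring
  e₂ : ∀ c u s → c - (u + s) + s ≡ c - u
  e₂ = solve-∀ ℚ-ring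
  first : Null (λ i → clamp (c i) (u zero i) - u zero i)
  first ε 0<ε = mapᵉ (λ i (p , q) → clamp-close (c i) (u zero i) ε (0≤c i) 0<ε p
      (subst (- ε ≤ᵠ_) (trans (cong (λ z → c i - z + rest i) (∑-allFin-suc {suc k} (λ x → u x i))) (e₂ (c i) (u zero i) (rest i))) q))
    (u≥0 zero ε 0<ε ∧ᵉ asympNonneg-+ (null⇒asympNonneg total) (asympNonneg-∑ (allFin (suc k)) (u≥0 ∘ suc)) ε 0<ε)

seq-sumʳ : ∀ {A : Set} (xs : List A) (h : A → ℝ) i → seq (sumʳ (map h xs)) i ≡ ∑ xs (λ x → seq (h x) i)
seq-sumʳ []       h i = refl
seq-sumʳ (x ∷ xs) h i = cong (λ z → seq (h x) i + z) (seq-sumʳ xs h i)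

≈-congˡ : ∀ {u u′ v} → (∀ i → u i ≡ u′ i) → u ≈ v → u′ ≈ v
≈-congˡ {v = v} eq (mk≈ c (n , b)) = mk≈ (null-cong (λ i → cong (λ z → z - v i) (eq i)) c)
  (n , mapᵉ (λ i → subst (λ z → ℚ.∣ z ∣ ≤ᵠ ⟦ suc n ⟧) (eq i)) b)

∣-∣≤⇒≤ : ∀ {x y η} → ℚ.∣ x - y ∣ ≤ᵠ η → x ≤ᵠ y + η
∣-∣≤⇒≤ {x} {y} {η} h = ≤-by (η - (x - y)) (0≤∸ (ℚ.≤-trans (≤∣∣ (x - y)) h)) (e x y η)
  where
  e : ∀ x y η → x + (η - (x - y)) ≡ y + η
  e = solve-∀ ℚ-ring

∣-∣≤⇒≥ : ∀ {x y η} → ℚ.∣ x - y ∣ ≤ᵠ η → y ≤ᵠ x + η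
∣-∣≤⇒≥ {x} {y} {η} h = ≤-by (η - - (x - y))
  (0≤∸ (ℚ.≤-trans (subst (- (x - y) ≤ᵠ_) (ℚ.∣-p∣≡∣p∣ (x - y)) (≤∣∣ (- (x - y)))) h)) (e x y η)
  where
  e : ∀ x y η → y + (η - - (x - y)) ≡ x + η
  e = solve-∀ ℚ-ring

-- Transfer to real distributions

module _ {n} (f : Distribution n) where

  pmfAt : ℕ → Fin (suc n) → ℚ
  pmfAt i x = seq (pmf f x) i

  abstract
    -- What follows rests only on these values forming an exact distribution at every index and on
    -- their closeness to the given terms.
    rationalPmf : ℕ → Fin (suc n) → ℚ
    rationalPmf i = clampPmf 1ℚ (pmfAt i)

    rationalPmf-isPmf : ∀ i → IsPmf (rationalPmf i)
    rationalPmf-isPmf i = record { nonneg = clampPmf-nonneg 0≤1 (pmfAt i) ; total = clampPmf-total 1ℚ (pmfAt i) }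

    rationalPmf-close : (∀ x → AsympNonneg (λ i → pmfAt i x)) → Null (λ i → 1ℚ - ∑ (allFin (suc n)) (pmfAt i)) →
                        ∀ x → Null (λ i → rationalPmf i x - pmfAt i x)
    rationalPmf-close = clampPmf-close (λ _ → 1ℚ) (λ x i → pmfAt i x) (λ _ → 0≤1)

  private
    pmf≥0 : ∀ x → AsympNonneg (λ i → pmfAt i x)
    pmf≥0 x ε 0<ε = mapᵉ (λ i h → ≤-by (pmfAt i x + ε) h (e (pmfAt i x) ε)) (nonneg f x ε 0<ε)
      where
      e : ∀ u ε → - ε + (u + ε) ≡ u
      e = solve-∀ ℚ-ring

    ∑pmf : Null (λ i → 1ℚ - ∑ (allFin (suc n)) (pmfAt i))
    ∑pmf ε 0<ε = mapᵉ (λ i (p , q) → subst (λ s → ℚ.∣ 1ℚ - s ∣ ≤ᵠ ε) (seq-sumʳ (allFin (suc n)) (pmf f) i)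
        (∣∣≤ (≤-by _ (0≤∸ q) (e₁ (s i) ε)) (≤-by _ (0≤∸ p) (e₂ (s i) ε))))
      (proj₁ (total f) ε 0<ε ∧ᵉ proj₂ (total f) ε 0<ε)
      where
      s = seq (sumʳ (map (pmf f) (allFin (suc n))))
      e₁ : ∀ s ε → 1ℚ - s + (s + ε - 1ℚ) ≡ ε
      e₁ = solve-∀ ℚ-ring
      e₂ : ∀ s ε → - (1ℚ - s) + (1ℚ + ε - s) ≡ ε
      e₂ = solve-∀ ℚ-ring

    pmf≈ : ∀ x → (λ i → pmfAt i x) ≈ (λ i → rationalPmf i x)
    pmf≈ x = mk≈ (null-cong (λ i → e (rationalPmf i x) (pmfAt i x))
        (null-neg (rationalPmf-close pmf≥0 ∑pmf x)))
      (cauchy⇒bounded (pmf f x))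
      where
      e : ∀ g u → - (g - u) ≡ u - g
      e = solve-∀ ℚ-ring

    weight≈ : ∀ A → (λ i → weight (pmfAt i) A) ≈ (λ i → weight (rationalPmf i) A)
    weight≈ A = ≈-* (≈-const (invC n (∣p∣≤n A))) (pmf≈ (fromℕ< (s≤s (∣p∣≤n A))))

    seq-jointPmf : ∀ {k} (V : Vec (Subset n) k) i → seq (jointPmf f V) i ≡ prodᵛ (weight (pmfAt i)) V
    seq-jointPmf []      i = refl
    seq-jointPmf (A ∷ V) i = cong (λ z → weight (pmfAt i) A * z) (seq-jointPmf V i)

  moment≈ : ∀ k → seq (moment f k) ≈ (λ i → mom (rationalPmf i) k)
  moment≈ k = ≈-congˡ
    (λ i → sym (trans (seq-sumʳ (filter big? (allFin (suc n))) (λ x → fromℚ (+ (toℕ x ℕ.^ k) / 1) *ʳ pmf f x) i)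
      (∑-filter big? (allFin (suc n)) (λ x → ⟦ toℕ x ℕ.^ k ⟧ * pmfAt i x))))
    (≈-∑ (allFin (suc n)) λ x → ≈-* (≈-const (𝟙 (big? x))) (≈-* (≈-const ⟦ toℕ x ℕ.^ k ⟧) (pmf≈ x)))

  -- The probability is a finite sum of products of pmf values and constants, so closeness of the
  -- values carries over.
  ℙ-connected≈ : ∀ m → seq (ℙ-connected n m f) ≈ (λ i → probConnected (rationalPmf i) m)
  ℙ-connected≈ m = ≈-congˡ
    (λ i → sym (trans (seq-sumʳ (filter intersectionGraphConnected? Vs) (jointPmf f) i)
      (trans (∑-filter intersectionGraphConnected? Vs (λ V → seq (jointPmf f V) i))
        (∑-cong Vs λ V → trans (cong (𝟙 (intersectionGraphConnected? V) *_) (seq-jointPmf V i)) (ℚ.*-comm (𝟙 (intersectionGraphConnected? V)) _)))))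
    (≈-∑ Vs λ V → ≈-* (≈-prodᵛ V weight≈) (≈-const (𝟙 (intersectionGraphConnected? V))))
    where Vs = vectors (allSubsets n) m

  ℙ-connected-near : ∀ m {ℓ ε} → Eventually (λ i → ℚ.∣ probConnected (rationalPmf i) m - ℓ ∣ ≤ᵠ ε) →
                     ∣ ℙ-connected n m f -ʳ fromℚ ℓ ∣ʳ ≤ʳ fromℚ ε
  ℙ-connected-near m {ℓ} {ε} near δ 0<δ = mapᵉ (λ i (p , q) → subst (λ z → ℚ.∣ z ∣ ≤ᵠ ε + δ)
      (e (seq (ℙ-connected n m f) i) (probConnected (rationalPmf i) m) ℓ)
      (ℚ.≤-trans (ℚ.∣p+q∣≤∣p∣+∣q∣ (probConnected (rationalPmf i) m - ℓ) (seq (ℙ-connected n m f) i - probConnected (rationalPmf i) m))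
        (ℚ.+-mono-≤ p q)))
    (near ∧ᵉ _≈_.close (ℙ-connected≈ m) δ 0<δ)
    where
    e : ∀ a b l → (b - l) + (a - b) ≡ a - l
    e = solve-∀ ℚ-ring

  rationalPmf-sparse : ∀ m {K q} → q ≤ᵠ ⟦ K ⟧ → moment f 2 ≤ʳ fromℚ q *ʳ ∣ moment f 0 ∣ʳ →
    Eventually (λ i → Sparse m K (rationalPmf i))
  rationalPmf-sparse m {K} {q} q≤K h = mapᵉ go
    (h η (0<r N) ∧ᵉ _≈_.close (moment≈ 2) η (0<r N) ∧ᵉ _≈_.close (moment≈ 0) η (0<r N))
    where
    open ℚ.≤-Reasoning
    -- The approximation costs m(K + 2)η: Kη from the zeroth moment, and η each from the second
    -- moment and from the tolerance in `≤ʳ`. This choice keeps it below the summand 1 of `Sparse`.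
    N = m ℕ.* (K ℕ.+ 2)
    η = r N
    budget : ⟦ m ⟧ * ((⟦ K ⟧ + ⟦ 2 ⟧) * η) ≤ᵠ 1ℚ
    budget = begin
      ⟦ m ⟧ * ((⟦ K ⟧ + ⟦ 2 ⟧) * η)   ≡⟨ ℚ.*-assoc ⟦ m ⟧ (⟦ K ⟧ + ⟦ 2 ⟧) η ⟨
      ⟦ m ⟧ * (⟦ K ⟧ + ⟦ 2 ⟧) * η     ≡⟨ cong (_* η) (trans (⟦⟧-* m (K ℕ.+ 2)) (cong (⟦ m ⟧ *_) (⟦⟧-+ K 2))) ⟨
      ⟦ N ⟧ * η                       ≤⟨ *-monoʳ (0≤r N) (⟦⟧≤⟦suc⟧ N) ⟩
      ⟦ suc N ⟧ * η                   ≡⟨ trans (ℚ.*-comm ⟦ suc N ⟧ η) (r-* N) ⟩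
      1ℚ                              ∎
    go : ∀ i → seq (moment f 2) i ≤ᵠ q * ℚ.∣ seq (moment f 0) i ∣ + η ×
               ℚ.∣ seq (moment f 2) i - mom (rationalPmf i) 2 ∣ ≤ᵠ η ×
               ℚ.∣ seq (moment f 0) i - mom (rationalPmf i) 0 ∣ ≤ᵠ η →
               Sparse m K (rationalPmf i)
    go i (h , near₂ , near₀) = begin
      ⟦ m ⟧ * M₂                                           ≤⟨ *-monoˡ 0≤⟦ m ⟧ (∣-∣≤⇒≥ {seq (moment f 2) i} {M₂} near₂) ⟩
      ⟦ m ⟧ * (seq (moment f 2) i + η)                     ≤⟨ *-monoˡ 0≤⟦ m ⟧ (ℚ.+-monoˡ-≤ η h) ⟩
      ⟦ m ⟧ * (q * ℚ.∣ seq (moment f 0) i ∣ + η + η)       ≤⟨ *-monoˡ 0≤⟦ m ⟧ (ℚ.+-monoˡ-≤ η (ℚ.+-monoˡ-≤ η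
                                                                prod≤)) ⟩
      ⟦ m ⟧ * (⟦ K ⟧ * (M₀ + η) + η + η)                   ≡⟨ e ⟦ m ⟧ ⟦ K ⟧ M₀ η ⟩
      ⟦ K ⟧ * (⟦ m ⟧ * M₀) + ⟦ m ⟧ * ((⟦ K ⟧ + ⟦ 2 ⟧) * η) ≤⟨ ℚ.+-monoʳ-≤ (⟦ K ⟧ * (⟦ m ⟧ * M₀)) budget ⟩
      ⟦ K ⟧ * (⟦ m ⟧ * M₀) + 1ℚ                            ∎
      where
      M₀ = mom (rationalPmf i) 0
      M₂ = mom (rationalPmf i) 2
      F₀ = seq (moment f 0) i
      abs≤ : ℚ.∣ F₀ ∣ ≤ᵠ M₀ + η
      abs≤ = ∣∣≤ (∣-∣≤⇒≤ {F₀} {M₀} near₀) (≤-by ((F₀ + η - M₀) + (M₀ + M₀)) (0≤+ (0≤∸ (∣-∣≤⇒≥ {F₀} {M₀} near₀)) (0≤+ 0≤M₀ 0≤M₀)) (e′ F₀ M₀ η))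
        where
        0≤M₀ = 0≤mom (rationalPmf-isPmf i) 0
        e′ : ∀ F M η → - F + ((F + η - M) + (M + M)) ≡ M + η
        e′ = solve-∀ ℚ-ring
      prod≤ : q * ℚ.∣ F₀ ∣ ≤ᵠ ⟦ K ⟧ * (M₀ + η)
      prod≤ = ℚ.≤-trans (*-monoʳ (ℚ.0≤∣p∣ F₀) q≤K) (*-monoˡ 0≤⟦ K ⟧ abs≤)
      e : ∀ m K M η → m * (K * (M + η) + η + η) ≡ K * (m * M) + m * ((K + ⟦ 2 ⟧) * η)
      e = solve-∀ ℚ-ring

module _ {n′} (f : Distribution (suc n′)) (m : ℕ) where

  private
    n : ℕ
    n = suc n′

    rateAt : ℕ → ℚ
    rateAt i = rate m (rationalPmf f i)

    m/n≡ : + m / n ≡ ⟦ m ⟧ * r n′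
    m/n≡ = *-cancelʳ-≡ 0<⟦ n ⟧ (trans (/-*-cancel m n) (sym (trans (ℚ.*-assoc ⟦ m ⟧ (r n′) ⟦ n ⟧)
      (trans (cong (⟦ m ⟧ *_) (r-* n′)) (ℚ.*-identityʳ ⟦ m ⟧)))))

    L : ℕ → ℚ
    L = seq (fromℚ (+ m / n) *ʳ moment f 1)

    rate≈ : L ≈ rateAt
    rate≈ = ≈-congˡ (λ i → cong (_* seq (moment f 1) i) (sym m/n≡)) (≈-* (≈-const (⟦ m ⟧ * r n′)) (moment≈ f 1))

    gap : ℝ
    gap = log n -ʳ fromℚ (+ m / n) *ʳ moment f 1

  -- The 2 covers the tolerance 1 in `≤ʳ` and a distance of at most 1 between the two rates; passing
  -- from log n to Hₙ is free in this direction.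
  rate-below : ∀ {x} → fromℚ (x + ⟦ 2 ⟧) ≤ʳ gap → Eventually (λ i → rate m (rationalPmf f i) + x ≤ᵠ H n)
  rate-below {x} h = mapᵉ (λ i (p , q) → ≤-by
      ((seq (log n) i - L i + 1ℚ - (x + ⟦ 2 ⟧)) + (L i + 1ℚ - rateAt i) + (H n - seq (log n) i))
      (0≤+ (0≤+ (0≤∸ p) (0≤∸ (∣-∣≤⇒≥ {L i} {rateAt i} q))) (0≤∸ (log≤H n i))) (e (seq (log n) i) (L i) (rateAt i) x (H n)))
    (h 1ℚ 0<⟦ 1 ⟧ ∧ᵉ _≈_.close rate≈ 1ℚ 0<⟦ 1 ⟧)
    where
    e : ∀ g L l x h → l + x + ((g - L + 1ℚ - (x + ⟦ 2 ⟧)) + (L + 1ℚ - l) + (h - g)) ≡ h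
    e = solve-∀ ℚ-ring

  -- The third unit pays for Hₙ ≤ 1 + log n.
  rate-above : ∀ {x} → gap ≤ʳ fromℚ (- (x + ⟦ 3 ⟧)) → Eventually (λ i → H n + x ≤ᵠ rate m (rationalPmf f i))
  rate-above {x} h = mapᵉ (λ i (p , q) → ≤-by
      ((- (x + ⟦ 3 ⟧) + 1ℚ - (seq (log n) i - L i)) + (rateAt i + 1ℚ - L i) + (1ℚ + seq (log n) i - H n))
      (0≤+ (0≤+ (0≤∸ p) (0≤∸ (∣-∣≤⇒≤ {L i} {rateAt i} q))) (0≤∸ (H≤log n i))) (e (seq (log n) i) (L i) (rateAt i) x (H n)))
    (h 1ℚ 0<⟦ 1 ⟧ ∧ᵉ _≈_.close rate≈ 1ℚ 0<⟦ 1 ⟧)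
    where
    e : ∀ g L l x h → h + x + ((- (x + ⟦ 3 ⟧) + 1ℚ - (g - L)) + (l + 1ℚ - L) + (1ℚ + g - h)) ≡ l
    e = solve-∀ ℚ-ring

-- The limits as n tends to infinity

ℙ-connected-near-0 : ∀ n .{{_ : NonZero n}} (f : Distribution n) {m ε} K d → 1 ≤ m → 2 ≤ n → ⟦ 2 ⟧ * r d ≤ᵠ ε →
  ⟦ 16 ℕ.* suc (suc d) ℕ.* suc K ⟧ * (H n + 1ℚ) ≤ᵠ ⟦ n ⟧ →
  Eventually (λ i → Sparse m K (rationalPmf f i)) →
  fromℚ (⟦ d ⟧ + ⟦ 2 ⟧ + ⟦ 2 ⟧) ≤ʳ log n -ʳ fromℚ (+ m / n) *ʳ moment f 1 →
  ∣ ℙ-connected n m f -ʳ 0ℝ ∣ʳ ≤ʳ fromℚ ε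
ℙ-connected-near-0 (suc zero) _ _ _ _ (s≤s ())
-- In the bound of `gap`, one summand 2 is the margin of `probConnected-sparse` and the other is the
-- loss in `rate-below`.
ℙ-connected-near-0 n@(suc (suc _)) f {m} {ε} K d 1≤m _ tol large sparse gap = ℙ-connected-near f m {0ℚ} {ε} (mapᵉ
  (λ i (sp , below) → near i (Isolated.probConnected-sparse (rationalPmf-isPmf f i) m K d 1≤m sp large
    (subst (_≤ᵠ H n) (sym (ℚ.+-assoc (rate m (rationalPmf f i)) ⟦ d ⟧ ⟦ 2 ⟧)) below)))
  (sparse ∧ᵉ rate-below f m {⟦ d ⟧ + ⟦ 2 ⟧} gap))
  where
  near : ∀ i → probConnected (rationalPmf f i) m ≤ᵠ ⟦ 2 ⟧ * r d → ℚ.∣ probConnected (rationalPmf f i) m - 0ℚ ∣ ≤ᵠ ε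
  near i P≤ = subst (λ z → ℚ.∣ z ∣ ≤ᵠ ε) (sym (ℚ.+-identityʳ (probConnected (rationalPmf f i) m))) (subst (_≤ᵠ ε)
    (sym (ℚ.0≤p⇒∣p∣≡p (probConnected-nonneg (rationalPmf-isPmf f i) m))) (ℚ.≤-trans P≤ tol))

ℙ-connected-near-1 : ∀ n .{{_ : NonZero n}} (f : Distribution n) {m ε} K d → 1 ≤ K → 1 ≤ d → ⟦ 2 ⟧ * r d ≤ᵠ ε →
  Eventually (λ i → Sparse m K (rationalPmf f i)) →
  log n -ʳ fromℚ (+ m / n) *ʳ moment f 1 ≤ʳ fromℚ (- (slack K d + ⟦ 3 ⟧)) →
  ∣ ℙ-connected n m f -ʳ 1ℝ ∣ʳ ≤ʳ fromℚ ε
ℙ-connected-near-1 (suc _) f {m} {ε} K d 1≤K 1≤d tol sparse gap = ℙ-connected-near f m {1ℚ} {ε} (mapᵉ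
  (λ i (sp , above) → near i (probConnected-dense (rationalPmf-isPmf f i) m K d 1≤K 1≤d sp above))
  (sparse ∧ᵉ rate-above f m {slack K d} gap))
  where
  near : ∀ i → 1ℚ ≤ᵠ probConnected (rationalPmf f i) m + ⟦ 2 ⟧ * r d → ℚ.∣ probConnected (rationalPmf f i) m - 1ℚ ∣ ≤ᵠ ε
  near i 1≤ = ∣∣≤
    (≤-by (ε + (1ℚ - P)) (0≤+ (ℚ.≤-trans (0≤* 0≤⟦ 2 ⟧ (0≤r d)) tol) (0≤∸ (probConnected≤1 (rationalPmf-isPmf f i) m))) (e₁ P ε))
    (≤-by ((P + ⟦ 2 ⟧ * r d - 1ℚ) + (ε - ⟦ 2 ⟧ * r d)) (0≤+ (0≤∸ 1≤) (0≤∸ tol)) (e₂ P (⟦ 2 ⟧ * r d) ε))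
    where
    P = probConnected (rationalPmf f i) m
    e₁ : ∀ P ε → P - 1ℚ + (ε + (1ℚ - P)) ≡ ε
    e₁ = solve-∀ ℚ-ring
    e₂ : ∀ P x ε → - (P - 1ℚ) + ((P + x - 1ℚ) + (ε - x)) ≡ ε
    e₂ = solve-∀ ℚ-ring

r-suc≤ : ∀ d → r (suc d) ≤ᵠ r d
r-suc≤ d = r≤ {r d} (suc d) (subst (_≤ᵠ r d * ⟦ suc (suc d) ⟧) (r-* d) (*-monoˡ (0≤r d) (⟦⟧≤⟦suc⟧ (suc d))))

2r≤ : ∀ {ε} d → r d ≤ᵠ ½ * ε → ⟦ 2 ⟧ * r (suc d) ≤ᵠ ε
2r≤ {ε} d h = subst (⟦ 2 ⟧ * r (suc d) ≤ᵠ_) (e ε) (*-monoˡ {⟦ 2 ⟧} {r (suc d)} {½ * ε} 0≤⟦ 2 ⟧ (ℚ.≤-trans (r-suc≤ d) h))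
  where
  e : ∀ ε → ⟦ 2 ⟧ * (½ * ε) ≡ ε
  e = solve-∀ ℚ-ring

-- d ≥ 1 makes 1/(d + 1) ≤ ½, as the geometric series over cut sizes requires.
tolerance : ∀ {ε} → 0ℚ <ᵠ ε → ∃[ d ] (1 ≤ d × ⟦ 2 ⟧ * r d ≤ᵠ ε)
tolerance 0<ε = let d , rd≤ = ∃r≤ (0<½* 0<ε) in suc d , s≤s z≤n , 2r≤ d rd≤

module _ (m : Seq⁺ ℕ) (f : (n : ℕ) .{{_ : NonZero n}} → Distribution n) {q K N₁} (q≤K : q ≤ᵠ ⟦ K ⟧)
  (sparse : ∀ n .{{_ : NonZero n}} → N₁ ≤ n → moment (f n) 2 ≤ʳ fromℚ q *ʳ ∣ moment (f n) 0 ∣ʳ)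
  where

  private
    sparseAt : ∀ n .{{_ : NonZero n}} → N₁ ≤ n → Eventually (λ i → Sparse (m n) K (rationalPmf (f n) i))
    sparseAt n N₁≤n = rationalPmf-sparse (f n) (m n) {K} q≤K (sparse n N₁≤n)

  eventually-near-0 : (∀ n .{{_ : NonZero n}} → 1 ≤ m n) → ∀ {ε} d N₂ N₃ → ⟦ 2 ⟧ * r d ≤ᵠ ε →
    (∀ n → N₃ ≤ n → ⟦ 16 ℕ.* suc (suc d) ℕ.* suc K ⟧ * (H n + 1ℚ) ≤ᵠ ⟦ n ⟧) →
    (∀ n .{{_ : NonZero n}} → N₂ ≤ n → fromℚ (⟦ d ⟧ + ⟦ 2 ⟧ + ⟦ 2 ⟧) ≤ʳ log n -ʳ fromℚ (+ m n / n) *ʳ moment (f n) 1) →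
    ∃[ N ] (∀ n .{{_ : NonZero n}} → N ≤ n → ∣ ℙ-connected n (m n) (f n) -ʳ 0ℝ ∣ʳ ≤ʳ fromℚ ε)
  eventually-near-0 1≤m {ε} d N₂ N₃ tol large gap = N₁ ℕ.⊔ N₂ ℕ.⊔ N₃ ℕ.⊔ 2 , near
    where
    near : ∀ n .{{_ : NonZero n}} → N₁ ℕ.⊔ N₂ ℕ.⊔ N₃ ℕ.⊔ 2 ≤ n → ∣ ℙ-connected n (m n) (f n) -ʳ 0ℝ ∣ʳ ≤ʳ fromℚ ε
    near n N≤n = ℙ-connected-near-0 n (f n) {m n} {ε} K d (1≤m n) (ℕ.m⊔n≤o⇒n≤o (N₁ ℕ.⊔ N₂ ℕ.⊔ N₃) 2 N≤n) tol
      (large n (ℕ.m⊔n≤o⇒n≤o (N₁ ℕ.⊔ N₂) N₃ N₁₂₃≤n)) (sparseAt n (ℕ.m⊔n≤o⇒m≤o N₁ N₂ N₁₂≤n)) (gap n (ℕ.m⊔n≤o⇒n≤o N₁ N₂ N₁₂≤n))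
      where
      N₁₂₃≤n = ℕ.m⊔n≤o⇒m≤o (N₁ ℕ.⊔ N₂ ℕ.⊔ N₃) 2 N≤n
      N₁₂≤n = ℕ.m⊔n≤o⇒m≤o (N₁ ℕ.⊔ N₂) N₃ N₁₂₃≤n

  eventually-near-1 : 1 ≤ K → ∀ {ε} d N₂ → 1 ≤ d → ⟦ 2 ⟧ * r d ≤ᵠ ε →
    (∀ n .{{_ : NonZero n}} → N₂ ≤ n → log n -ʳ fromℚ (+ m n / n) *ʳ moment (f n) 1 ≤ʳ fromℚ (- (slack K d + ⟦ 3 ⟧))) →
    ∃[ N ] (∀ n .{{_ : NonZero n}} → N ≤ n → ∣ ℙ-connected n (m n) (f n) -ʳ 1ℝ ∣ʳ ≤ʳ fromℚ ε)
  eventually-near-1 1≤K {ε} d N₂ 1≤d tol gap = N₁ ℕ.⊔ N₂ , near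
    where
    near : ∀ n .{{_ : NonZero n}} → N₁ ℕ.⊔ N₂ ≤ n → ∣ ℙ-connected n (m n) (f n) -ʳ 1ℝ ∣ʳ ≤ʳ fromℚ ε
    near n N≤n = ℙ-connected-near-1 n (f n) {m n} {ε} K d 1≤K 1≤d tol
      (sparseAt n (ℕ.m⊔n≤o⇒m≤o N₁ N₂ N≤n)) (gap n (ℕ.m⊔n≤o⇒n≤o N₁ N₂ N≤n))

mainTheorem3 : (m : Seq⁺ ℕ) (f : (n : ℕ) .{{_ : NonZero n}} → Distribution n) →
    ((n : ℕ) .{{_ : NonZero n}} → 1 ≤ m n) →
    (λ n → moment (f n) 2) ≲ (λ n → moment (f n) 0) →
    ((λ n → log n -ʳ fromℚ (+ m n / n) *ʳ moment (f n) 1) ⟶+∞ →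
    (λ n → ℙ-connected n (m n) (f n)) ⟶ 0ℝ)
    ×
    ((λ n → log n -ʳ fromℚ (+ m n / n) *ʳ moment (f n) 1) ⟶-∞ →
    (λ n → ℙ-connected n (m n) (f n)) ⟶ 1ℝ)
mainTheorem3 m f 1≤m (q , N₁ , sparse) = sparseCase , denseCase
  where
  -- The successor makes K positive, so that `largeCut` can cancel it.
  K = suc (proj₁ (≤⟦⟧ q))
  q≤K : q ≤ᵠ ⟦ K ⟧
  q≤K = ℚ.≤-trans (proj₂ (≤⟦⟧ q)) (⟦⟧≤⟦suc⟧ (proj₁ (≤⟦⟧ q)))
  sparseCase : (λ n → log n -ʳ fromℚ (+ m n / n) *ʳ moment (f n) 1) ⟶+∞ → (λ n → ℙ-connected n (m n) (f n)) ⟶ 0ℝ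
  sparseCase gap ε 0<ε =
    let d , _ , tol = tolerance 0<ε
        N₂ , gap₂ = gap (⟦ d ⟧ + ⟦ 2 ⟧ + ⟦ 2 ⟧)
        N₃ , large = H-sublinear (16 ℕ.* suc (suc d) ℕ.* suc K)
    in eventually-near-0 m f {q} {K} {N₁} q≤K sparse 1≤m {ε} d N₂ N₃ tol large gap₂
  denseCase : (λ n → log n -ʳ fromℚ (+ m n / n) *ʳ moment (f n) 1) ⟶-∞ → (λ n → ℙ-connected n (m n) (f n)) ⟶ 1ℝ
  denseCase gap ε 0<ε =
    let d , 1≤d , tol = tolerance 0<ε
        N₂ , gap₂ = gap (- (slack K d + ⟦ 3 ⟧))
    in eventually-near-1 m f {q} {K} {N₁} q≤K sparse (s≤s z≤n) {ε} d N₂ 1≤d tol gap₂
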